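{- For unit-weight instances, the \textsc{Spanner} problem (given a connected undirected graph $G=(V,E)$ with weights $w(e)=1$ for all $e\in E$, edge lengths $\ell\colon E\to\mathbb{N}_{\ge1}$, a stretch factor $\alpha\ge1$ and a weight bound $W\in\mathbb{N}$, is there an $\alpha$-spanner $H=(V,F)$ of $G$ with $w(H)=|F|\le W$?) admits an FPT algorithm w.r.t. the combined parameter $(\varphi,\tau)$, where $\varphi=|E|-|V|+1$ is the feedback edge set number of $G$ and $\tau$ is the tightness of the instance. The algorithm is obtained by running, for all $1\le\varrho\le\varphi$, an FPT algorithm w.r.t. $(\varrho,\tau)$ that decides whether $G$ has an $\alpha$-spanner obtained by removing at least $\varrho$ nontrivial edges.
   Context: For a subgraph $G'\subseteq G$ and $u,v\in V$, $\ell_{G'}[u,v]$ is the length of a shortest $u$-$v$-path in $G'$ w.r.t. $\ell$. A subgraph $H=(V,F)$, $F\subseteq E$, is an $\alpha$-spanner of $G$ if $\ell_H[u,v]\le\alpha\,\ell_G[u,v]$ for all $u,v\in V$; equivalently, for all $\{u,v\}\in E$. The set of terminal pairs is $K=E$. The feedback edge set number is the minimum number of edges whose removal yields an acyclic subgraph. For $\{u,v\}\in E$, a simple $u$-$v$-path $P$ is settling if $\ell(P)\le\alpha\,\ell_G[u,v]$; it is alternative if it does not contain the edge $\{u,v\}$. $\mathcal{P}_{uv}$ is the set of all settling $u$-$v$-paths. As a preprocessing convention, edges that do not settle themselves (i.e., $\ell(\{u,v\})>\alpha\,\ell_G[u,v]$) are assumed to have been removed from the instance. An edge $\{u,v\}$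 is mandatory if $\mathcal{P}_{uv}$ contains no alternative path. The trivial edges $T\subseteq E$ are the mandatory edges and the edges of weight $0$ (none of the latter exist for unit weights); the nontrivial edges are $N=E\setminus T$. A terminal pair $\{u,v\}\in E$ is critical if no settling $u$-$v$-path consists only of trivial edges; $C$ denotes the set of critical terminal pairs ($C\subseteq N$). For $\{u,v\}\in C$, the tightest alternative path $A_{uv}\in\mathcal{P}_{uv}$ is an alternative settling path with the minimum number of nontrivial edges, and $A^N_{uv}=A_{uv}\cap N$. The tightness of the instance is $\tau=\max\{|A^N_{uv}| : \{u,v\}\in C\}$. An algorithm is FPT w.r.t. a (possibly combined) parameter $k$ if on instance $I$ it runs in $\mathcal{O}(f(k)\cdot p(\langle I\rangle))$ time for a computable function $f$ and a polynomial $p$ in the encoding length $\langle I\rangle$. -}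

module Defs where

open import Level using (0ℓ)
open import Data.Nat.Base using (ℕ; suc; _+_; _*_; _∸_; _≤_; NonZero)
open import Data.Nat.Binary.Base using (ℕᵇ; fromℕ; 2[1+_]; 1+[2_])
open import Data.Integer.Base using (∣_∣; +_)
open import Data.Rational.Base as ℚ using (ℚ; 1ℚ; ↥_; ↧ₙ_)
open import Data.Fin.Base as Fin using (Fin; toℕ)
open import Data.Fin.Subset as Subset using (Subset; _∈_; _∉_)
open import Data.Fin.Subset.Properties using (_∈?_)
open import Data.List.Base as List using (List; []; _∷_; length; sum; foldr; filter; allFin)
import Data.List.Membership.Propositional as List∈
open import Data.List.Relation.Unary.All as All using (All)
open import Data.List.Relation.Unary.Unique.Propositional using (Unique)
open import Data.Vec.Base as Vec using (Vec; []; _∷_)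
open import Data.Product.Base using (Σ; ∃; ∃₂; _×_; _,_; proj₁; proj₂)
open import Data.Sum.Base using (_⊎_)
open import Data.Empty using (⊥)
open import Data.Unit.Base using (⊤)
open import Function.Base using (_∘_)
open import Function.Bundles using (_⇔_)
open import Function.Definitions using (Injective)
open import Relation.Nullary.Negation.Core using (¬_)
open import Relation.Unary using (Pred; U)
open import Relation.Binary.PropositionalEquality.Core using (_≡_)

-- Model of computation: first-order call-by-value recursive programs
-- over binary trees.
--
-- Every evaluation step costs one unit.  An implementation that shares
-- subtrees through pointers performs each step in constant time, so this
-- cost agrees with Turing-machine time up to a polynomial (compare the
-- tree languages in N. D. Jones, "Computability and Complexity").

data Tree : Set where
  leaf : Tree
  node : Tree → Tree → Tree

size : Tree → ℕ
size leaf       = 1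
size (node l r) = suc (size l + size r)

IsNode : Tree → Set
IsNode leaf       = ⊥
IsNode (node _ _) = ⊤

-- Sg lists the arities of the available functions; n counts the variables
-- in scope.

data Exp (Sg : List ℕ) (n : ℕ) : Set where
  var   : Fin n → Exp Sg n
  leaf  : Exp Sg n
  node  : Exp Sg n → Exp Sg n → Exp Sg n
  bind  : Exp Sg n → Exp Sg (suc n) → Exp Sg n
  match : Exp Sg n → Exp Sg n → Exp Sg (suc (suc n)) → Exp Sg n
  call  : ∀ {k} → k List∈.∈ Sg → Vec (Exp Sg n) k → Exp Sg n

Bodies : List ℕ → Set
Bodies Sg = All (Exp Sg) Sg

record Program : Set where
  constructor program
  field
    {signature} : List ℕ
    bodies      : Bodies signature
    main        : Exp signature 1

module Evaluation {Sg : List ℕ} (bodies : Bodies Sg) where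

  infix 4 _⊢_⇓_⟨_⟩ _⊢*_⇓_⟨_⟩

  mutual

    -- ρ ⊢ e ⇓ v ⟨ c ⟩: in environment ρ, e evaluates to v at cost c.

    data _⊢_⇓_⟨_⟩ {n} (ρ : Vec Tree n) : Exp Sg n → Tree → ℕ → Set where

      var : ∀ i → ρ ⊢ var i ⇓ Vec.lookup ρ i ⟨ 1 ⟩

      leaf : ρ ⊢ leaf ⇓ leaf ⟨ 1 ⟩

      node : ∀ {e₁ e₂ v₁ v₂ c₁ c₂} →
             ρ ⊢ e₁ ⇓ v₁ ⟨ c₁ ⟩ → ρ ⊢ e₂ ⇓ v₂ ⟨ c₂ ⟩ →
             ρ ⊢ node e₁ e₂ ⇓ node v₁ v₂ ⟨ suc (c₁ + c₂) ⟩

      bind : ∀ {e₁ e₂ v₁ v₂ c₁ c₂} →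
             ρ ⊢ e₁ ⇓ v₁ ⟨ c₁ ⟩ → (v₁ ∷ ρ) ⊢ e₂ ⇓ v₂ ⟨ c₂ ⟩ →
             ρ ⊢ bind e₁ e₂ ⇓ v₂ ⟨ suc (c₁ + c₂) ⟩

      match-leaf : ∀ {e e₁ e₂ v c c₁} →
                   ρ ⊢ e ⇓ leaf ⟨ c ⟩ → ρ ⊢ e₁ ⇓ v ⟨ c₁ ⟩ →
                   ρ ⊢ match e e₁ e₂ ⇓ v ⟨ suc (c + c₁) ⟩

      match-node : ∀ {e e₁ e₂ l r v c c₂} →
                   ρ ⊢ e ⇓ node l r ⟨ c ⟩ → (l ∷ r ∷ ρ) ⊢ e₂ ⇓ v ⟨ c₂ ⟩ →
                   ρ ⊢ match e e₁ e₂ ⇓ v ⟨ suc (c + c₂) ⟩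

      call : ∀ {k} {f : k List∈.∈ Sg} {es vs v c₁ c₂} →
             ρ ⊢* es ⇓ vs ⟨ c₁ ⟩ → vs ⊢ All.lookup bodies f ⇓ v ⟨ c₂ ⟩ →
             ρ ⊢ call f es ⇓ v ⟨ suc (c₁ + c₂) ⟩

    data _⊢*_⇓_⟨_⟩ {n} (ρ : Vec Tree n) :
                   ∀ {k} → Vec (Exp Sg n) k → Vec Tree k → ℕ → Set where

      []  : ρ ⊢* [] ⇓ [] ⟨ 0 ⟩

      _∷_ : ∀ {k e v c₁ c₂} {es : Vec (Exp Sg n) k} {vs} →
            ρ ⊢ e ⇓ v ⟨ c₁ ⟩ → ρ ⊢* es ⇓ vs ⟨ c₂ ⟩ →
            ρ ⊢* e ∷ es ⇓ v ∷ vs ⟨ c₁ + c₂ ⟩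

-- Run p x v c: on input x, p halts with output v at cost c.

Run : Program → Tree → Tree → ℕ → Set
Run p x v c = (x ∷ []) ⊢ main ⇓ v ⟨ c ⟩
  where
  open Program p
  open Evaluation bodies

Accepts : Program → Tree → Set
Accepts p x = ∃₂ λ v c → Run p x v c × IsNode v

-- Bijective binary, hence of logarithmic size.

codeℕᵇ : ℕᵇ → Tree
codeℕᵇ ℕᵇ.zero   = leaf
codeℕᵇ 2[1+ x ]  = node leaf (codeℕᵇ x)
codeℕᵇ 1+[2 x ]  = node (node leaf leaf) (codeℕᵇ x)

codeℕ : ℕ → Tree
codeℕ = codeℕᵇ ∘ fromℕ

codeList : List Tree → Tree
codeList = foldr node leaf

Computable₂ : (ℕ → ℕ → ℕ) → Set
Computable₂ f = ∃ λ p → ∀ k l → ∃ λ c →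
  Run p (node (codeℕ k) (codeℕ l)) (codeℕ (f k l)) c

-- Coefficients in ascending order of degree.

Polynomial : Set
Polynomial = List ℕ

eval : Polynomial → ℕ → ℕ
eval p x = foldr (λ a r → a + x * r) 0 p

-- Parameter is a relation so that parameters specified as an extremum can
-- be used directly.

record ParameterizedProblem : Set₁ where
  field
    Input     : Set
    code      : Input → Tree
    Yes       : Input → Set
    Parameter : Input → ℕ → ℕ → Set

record _IsFPTAlgorithmFor_ (p : Program) (Π : ParameterizedProblem) : Set where
  open ParameterizedProblem Π
  field
    f            : ℕ → ℕ → ℕ
    f-computable : Computable₂ f
    poly         : Polynomial
    runs         : ∀ x → ∃₂ λ v c →
                   Run p (code x) v c ×
                   (IsNode v ⇔ Yes x) ×
                   (∀ k l → Parameter x k l → c ≤ f k l * eval poly (size (code x)))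

-- The undirected edge {u,v} is stored as the pair (u , v) with u < v, so
-- loops are excluded, and injectivity of ends excludes parallel edges.

record Graph : Set where
  field
    n m          : ℕ
    .{{nonEmpty}} : NonZero n
    ends         : Fin m → Fin n × Fin n
    ordered      : ∀ e → proj₁ (ends e) Fin.< proj₂ (ends e)
    simple       : Injective _≡_ _≡_ ends
    ℓ            : Fin m → ℕ
    ℓ≥1          : ∀ e → 1 ≤ ℓ e

  Vertex Edge : Set
  Vertex = Fin n
  Edge   = Fin m

  src tgt : Edge → Vertex
  src = proj₁ ∘ ends
  tgt = proj₂ ∘ ends

  Joins : Edge → Vertex → Vertex → Set
  Joins e u v = ends e ≡ (u , v) ⊎ ends e ≡ (v , u)

  data Walk : Vertex → Vertex → Set where
    []   : ∀ {u} → Walk u u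
    step : ∀ {u v w} (e : Edge) → Joins e u v → Walk v w → Walk u w

  vertices : ∀ {u v} → Walk u v → List Vertex
  vertices {u} []           = u ∷ []
  vertices {u} (step _ _ w) = u ∷ vertices w

  walkEdges : ∀ {u v} → Walk u v → List Edge
  walkEdges []           = []
  walkEdges (step e _ w) = e ∷ walkEdges w

  Path : Vertex → Vertex → Set
  Path u v = Σ (Walk u v) (Unique ∘ vertices)

  edges : ∀ {u v} → Path u v → List Edge
  edges = walkEdges ∘ proj₁

  pathLength : ∀ {u v} → Path u v → ℕ
  pathLength P = sum (List.map ℓ (edges P))

  -- Subgraphs are spanning and given by their edges.

  _Within_ : ∀ {u v} → Path u v → Pred Edge 0ℓ → Set
  P Within S = All S (edges P)

  -- Distance S u v d: in the subgraph with edges S, v is reachable from u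
  -- and a shortest path has length d.

  Distance : Pred Edge 0ℓ → Vertex → Vertex → ℕ → Set
  Distance S u v d =
    (∃ λ (P : Path u v) → P Within S × pathLength P ≡ d) ×
    (∀ (P : Path u v) → P Within S → d ≤ pathLength P)

-- Every edge has weight 1, so a subgraph weighs as much as it has edges.
-- The stretch factor belongs to the input and is therefore rational.

record Instance : Set where
  field
    graph : Graph
  open Graph graph public
  field
    connected : ∀ (u v : Vertex) → Path u v
    α         : ℚ
    α≥1       : 1ℚ ℚ.≤ α
    W         : ℕ

  _≤α·_ : ℕ → ℕ → Set
  x ≤α· y = (+ x ℚ./ 1) ℚ.≤ α ℚ.* (+ y ℚ./ 1)

  IsSpanner : Pred Edge 0ℓ → Set
  IsSpanner F = ∀ u v → ∃₂ λ d d′ →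
    Distance F u v d × Distance U u v d′ × d ≤α· d′

  -- The edges that settle themselves.  Preprocessing removes all others,
  -- so the notions below refer to the subgraph of the kept edges.  Removing
  -- the other edges does not change any distance.

  Kept : Pred Edge 0ℓ
  Kept e = ∃ λ d → Distance U (src e) (tgt e) d × ℓ e ≤α· d

  Settling : ∀ {u v} → Path u v → Set
  Settling {u} {v} P =
    P Within Kept × ∃ λ d → Distance U u v d × pathLength P ≤α· d

  Alternative : (e : Edge) → Path (src e) (tgt e) → Set
  Alternative e P = ¬ (e List∈.∈ edges P)

  -- With unit weights no edge has weight 0, so an edge is trivial iff it
  -- is mandatory.

  Mandatory Trivial Nontrivial Critical : Pred Edge 0ℓ
  Mandatory e  = Kept e × ¬ ∃ λ P → Settling P × Alternative e P
  Trivial      = Mandatory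
  Nontrivial e = Kept e × ¬ Trivial e
  Critical e   = Kept e ×
    ¬ ∃ λ (P : Path (src e) (tgt e)) → Settling P × P Within Trivial

  _Is_ : Subset m → Pred Edge 0ℓ → Set
  S Is Q = ∀ e → e ∈ S ⇔ Q e

  ∣_∩_∣ : ∀ {u v} → Path u v → Subset m → ℕ
  ∣ P ∩ S ∣ = length (filter (_∈? S) (edges P))

  TightestAlternative : Subset m → (e : Edge) → Path (src e) (tgt e) → Set
  TightestAlternative N e A =
    Settling A × Alternative e A ×
    (∀ P → Settling P → Alternative e P → ∣ A ∩ N ∣ ≤ ∣ P ∩ N ∣)

  -- The maximum over an empty set of critical pairs is 0.

  Tightness : ℕ → Set
  Tightness τ = ∃ λ N → N Is Nontrivial ×
    (∀ e A → Critical e → TightestAlternative N e A → ∣ A ∩ N ∣ ≤ τ) ×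
    ((∃₂ λ e A → Critical e × TightestAlternative N e A × ∣ A ∩ N ∣ ≡ τ)
     ⊎ ((∀ e → ¬ Critical e) × τ ≡ 0))

  -- |E| - |V| + 1, where truncation is harmless as the graph is connected.

  φ : ℕ
  φ = suc m ∸ n

  codeEdge : Edge → Tree
  codeEdge e = node (codeℕ (toℕ (src e))) (node (codeℕ (toℕ (tgt e))) (codeℕ (ℓ e)))

  codeInstance : Tree
  codeInstance = codeList
    ( codeℕ n
    ∷ codeList (List.map codeEdge (allFin m))
    ∷ codeℕ ∣ ↥ α ∣
    ∷ codeℕ (↧ₙ α)
    ∷ codeℕ W
    ∷ [])

Spanner : ParameterizedProblem
Spanner = record
  { Input     = Instance
  ; code      = codeInstance
  ; Yes       = λ I → let open Instance I in
                ∃ λ (F : Subset m) → IsSpanner (_∈ F) × Subset.∣ F ∣ ≤ W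
  ; Parameter = λ I k l → k ≡ φ I × Tightness I l
  }
  where open Instance using (codeInstance; φ; Tightness)

-- Given (I , ϱ), is there an α-spanner obtained from the preprocessed graph
-- by removing a set R of at least ϱ nontrivial edges?  The parameters are ϱ
-- and τ, and the weight bound of I plays no role.

NontrivialRemoval : ParameterizedProblem
NontrivialRemoval = record
  { Input     = Instance × ℕ
  ; code      = λ (I , ϱ) → node (codeInstance I) (codeℕ ϱ)
  ; Yes       = λ (I , ϱ) → let open Instance I in
                ∃ λ (R : Subset m) →
                  (∀ e → e ∈ R → Nontrivial e) ×
                  ϱ ≤ Subset.∣ R ∣ ×
                  IsSpanner (λ e → Kept e × e ∉ R)
  ; Parameter = λ (I , ϱ) k l → k ≡ ϱ × Tightness I l
  }
  where open Instance using (codeInstance; Tightness)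

-- The verdict on I obtained from running A on (I , ϱ) for all 1 ≤ ϱ ≤ φ:
-- the preprocessed graph has at most W edges, or A reports for some ϱ that
-- enough nontrivial edges can be removed to leave at most W.

SweepAccepts : Program → Instance → Set
SweepAccepts A I = ∃ λ K → K Is Kept ×
  (Subset.∣ K ∣ ≤ W ⊎
   ∃ λ ϱ → 1 ≤ ϱ × ϱ ≤ φ × Subset.∣ K ∣ ∸ ϱ ≤ W ×
           Accepts A (ParameterizedProblem.code NontrivialRemoval (I , ϱ)))
  where open Instance I

{-# OPTIONS --safe #-}

-- A set R of nontrivial edges can be removed as soon as every e ∈ R keeps a
-- settling path that avoids R.  A noncritical e has one consisting of trivial
-- edges, and a critical e has A_e, which meets at most τ nontrivial edges.  In
-- the digraph with arcs e → f for the f on that path, every independent set is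
-- therefore removable, and out-degrees at most τ yield an independent set of
-- size ϱ among any ϱ (2τ + 1) nontrivial edges.  So a search through the
-- subsets of ever longer sublists of the nontrivial edges, which stops at the
-- first success, examines at most 2 ^ (ϱ (2τ + 1)) sets and never needs to
-- know τ.
--
-- Edges that do not settle themselves can be dropped from any spanner, so the
-- weight bound W asks for a removal of at least |K| - W nontrivial edges from
-- the set K of kept edges.  The rest is connected, so never more than φ edges
-- are removed; hence there are fewer than (φ + 1) (2τ + 1) nontrivial edges in
-- total, and the same search solves Spanner.

module Submission where

open import Defs
open import Level using (0ℓ)
open import Data.Bool.Base using (Bool; true; false; T; not; _∧_; _∨_; if_then_else_)
open import Data.Bool.ListAction using (any; all)
open import Data.Bool.Properties using (T?; T-∧; ∨-zeroʳ)
open import Data.Empty using (⊥-elim)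
open import Data.Unit.Base using (tt)
open import Data.Nat.Base
  using (ℕ; zero; suc; _+_; _*_; _∸_; _^_; _≤_; _<_; _⊓_; z≤n; s≤s; s≤s⁻¹; _≤ᵇ_; _≡ᵇ_; NonZero; >-nonZero; >-nonZero⁻¹)
open import Data.Nat.Properties hiding (_≟_)
open import Data.Nat.Induction using (<-rec)
open import Data.Nat.ListAction using (sum)
open import Data.Nat.Solver using (module +-*-Solver)
open import Data.Nat.Binary.Base as ℕᵇ using (ℕᵇ; 2[1+_]; 1+[2_]; fromℕ; toℕ)
import Data.Nat.Binary.Properties as ℕᵇ
open import Data.Integer.Base as ℤ using (∣_∣)
import Data.Integer.Properties as ℤ
open import Data.Rational.Base as ℚ using (1ℚ; ↥_; ↧ₙ_; toℚᵘ)
import Data.Rational.Properties as ℚ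
open import Data.Rational.Unnormalised.Base as ℚᵘ using (mkℚᵘ; *≤*)
import Data.Rational.Unnormalised.Properties as ℚᵘ
open import Data.Fin.Base as Fin using (Fin; zero; suc; punchIn)
open import Data.Fin.Properties as Fin using (_≟_; toℕ<n; injective⇒≤; punchIn-injective; punchInᵢ≢i)
open import Data.Fin.Subset as Subset using (Subset)
import Data.Fin.Subset.Properties as Subset
open import Data.List.Base as List
  using (List; []; _∷_; _++_; length; filter; filterᵇ; allFin; tabulate; cartesianProduct)
open import Data.List.Properties as List
  using (length-++; length-map; length-tabulate; length-filter; filter-notAll; filter-none; map-∘; map-cong)
open import Data.List.Membership.Propositional using (_∈_; _∉_; find)
open import Data.List.Membership.Propositional.Properties
open import Data.List.Membership.DecPropositional using () renaming (_∈?_ to member?)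
open import Data.List.Relation.Unary.Any as Any using (Any; here; there)
open import Data.List.Relation.Unary.Any.Properties using (any⁺; any⁻)
open import Data.List.Relation.Unary.All as All using (All; []; _∷_)
open import Data.List.Relation.Unary.All.Properties using (++⁺; all⁺; all⁻; ¬Any⇒All¬)
open import Data.List.Relation.Unary.AllPairs using ([]; _∷_)
open import Data.List.Relation.Unary.Unique.Propositional using (Unique)
open import Data.List.Relation.Unary.Unique.Propositional.Properties using (filter⁺; allFin⁺)
open import Data.Vec.Base as Vec using (Vec; []; _∷_)
open import Data.Vec.Properties using (lookup∘tabulate; []=⇒lookup; lookup⇒[]=)
open import Data.Product.Base using (∃; ∃₂; _×_; _,_; proj₁; proj₂)
open import Data.Sum.Base using (_⊎_; inj₁; inj₂)
open import Function.Base using (_∘_; id)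
open import Function.Bundles using (_⇔_; mk⇔; Equivalence)
open import Relation.Nullary.Negation.Core using (¬_; contradiction)
open import Relation.Nullary.Decidable using (Dec; yes; no; does; ¬?; _×-dec_; does-⇔; decidable-stable)
open import Relation.Unary using (Pred; Decidable; U)
open import Relation.Binary.PropositionalEquality

-- Primitive recursive terms and their cost

-- rec xs s b p q recurses along the right spine of xs, with a state, initially
-- s, that p transforms on the way down; b gives the result at the end of the
-- spine, and q transforms it on the way up.

-- The cost of a run has to be fixed before `τ` is known, and `τ` is only given by a relation. Hence
-- evaluation is split from cost: a term is evaluated under a bound `B` on every list that it
-- recurses along, and its cost is at most a polynomial in `B` whose degree depends on the term
-- alone. All that remains of the running time is a bound on list lengths, where only the list of
-- examined sets can be exponential. The same run is derived twice: with `B` from the crude bound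
-- `m` on the number of nontrivial edges, which shows that it halts on every input, and with `B`
-- from the parameters. Evaluation is deterministic, so the second bound applies to the cost of the
-- first. Whether an edge is critical and which alternative path is tightest is never computed. Such
-- facts enter under double negation, which is harmless because they only serve to refute that a
-- list is too long. The factor `2τ + 1` counts a chosen edge, its at most `τ` successors and its at
-- most `τ` predecessors.

data Tm : ℕ → Set where
  var  : ∀ {n} → Fin n → Tm n
  nil  : ∀ {n} → Tm n
  cons : ∀ {n} → Tm n → Tm n → Tm n
  bind : ∀ {n} → Tm n → Tm (suc n) → Tm n
  case : ∀ {n} → Tm n → Tm n → Tm (2 + n) → Tm n
  app  : ∀ {n k} → Tm k → Vec (Tm n) k → Tm n
  rec  : ∀ {n} → Tm n → Tm n → Tm (2 + n) → Tm (4 + n) → Tm (5 + n) → Tm n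

spine : Tree → ℕ
spine leaf       = 0
spine (node _ t) = suc (spine t)

infix 4 _∣_⊢_⇓_ _∣_⊢*_⇓_

mutual

  -- B bounds the lengths of all spines recursed along.

  data _∣_⊢_⇓_ (B : ℕ) {n} (ρ : Vec Tree n) : Tm n → Tree → Set where
    var  : ∀ i → B ∣ ρ ⊢ var i ⇓ Vec.lookup ρ i
    nil  : B ∣ ρ ⊢ nil ⇓ leaf
    cons : ∀ {a b u v} → B ∣ ρ ⊢ a ⇓ u → B ∣ ρ ⊢ b ⇓ v → B ∣ ρ ⊢ cons a b ⇓ node u v
    bind : ∀ {a b u v} → B ∣ ρ ⊢ a ⇓ u → B ∣ u ∷ ρ ⊢ b ⇓ v → B ∣ ρ ⊢ bind a b ⇓ v
    case-leaf : ∀ {a b c v} → B ∣ ρ ⊢ a ⇓ leaf → B ∣ ρ ⊢ b ⇓ v → B ∣ ρ ⊢ case a b c ⇓ v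
    case-node : ∀ {a b c l r v} → B ∣ ρ ⊢ a ⇓ node l r → B ∣ l ∷ r ∷ ρ ⊢ c ⇓ v →
                B ∣ ρ ⊢ case a b c ⇓ v
    app  : ∀ {k} {f : Tm k} {es vs v} → B ∣ ρ ⊢* es ⇓ vs → B ∣ vs ⊢ f ⇓ v → B ∣ ρ ⊢ app f es ⇓ v
    rec  : ∀ {xs s b p q t u v} → B ∣ ρ ⊢ xs ⇓ t → B ∣ ρ ⊢ s ⇓ u → spine t ≤ B →
           Loop B ρ b p q t u v → B ∣ ρ ⊢ rec xs s b p q ⇓ v

  data _∣_⊢*_⇓_ (B : ℕ) {n} (ρ : Vec Tree n) : ∀ {k} → Vec (Tm n) k → Vec Tree k → Set where
    []  : B ∣ ρ ⊢* [] ⇓ []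
    _∷_ : ∀ {k e v} {es : Vec (Tm n) k} {vs} →
          B ∣ ρ ⊢ e ⇓ v → B ∣ ρ ⊢* es ⇓ vs → B ∣ ρ ⊢* e ∷ es ⇓ v ∷ vs

  data Loop (B : ℕ) {n} (ρ : Vec Tree n) (b : Tm (2 + n)) (p : Tm (4 + n)) (q : Tm (5 + n)) :
            Tree → Tree → Tree → Set where
    stop : ∀ {u v} → B ∣ leaf ∷ u ∷ ρ ⊢ b ⇓ v → Loop B ρ b p q leaf u v
    next : ∀ {h t u u′ r v} →
           B ∣ h ∷ t ∷ node h t ∷ u ∷ ρ ⊢ p ⇓ u′ →
           Loop B ρ b p q t u′ r →
           B ∣ r ∷ h ∷ t ∷ node h t ∷ u ∷ ρ ⊢ q ⇓ v →
           Loop B ρ b p q (node h t) u v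

-- Compilation of terms into programs

mutual

  -- One function for the body of each `app` and one for the loop of each `rec`. A loop takes the
  -- spine, the state and the whole environment, hence the arity `2 + n`.
  sig : ∀ {n} → Tm n → List ℕ
  sig (var _)      = []
  sig nil          = []
  sig (cons a b)   = sig a ++ sig b
  sig (bind a b)   = sig a ++ sig b
  sig (case a b c) = sig a ++ sig b ++ sig c
  sig (app {k = k} f es) = k ∷ sig f ++ sig* es
  sig (rec {n} xs s b p q) = 2 + n ∷ sig xs ++ sig s ++ sig b ++ sig p ++ sig q

  sig* : ∀ {n k} → Vec (Tm n) k → List ℕ
  sig* []       = []
  sig* (e ∷ es) = sig e ++ sig* es

infix 4 _⊑_

-- The functions of a subterm occupy only a part of the signature of the program. The embedding of
-- that part is passed down, so compiled code never has to be renamed.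
_⊑_ : List ℕ → List ℕ → Set
xs ⊑ ys = ∀ k → k ∈ xs → k ∈ ys

fst⊑ : ∀ xs ys {zs} → xs ++ ys ⊑ zs → xs ⊑ zs
fst⊑ xs ys ι k = ι k ∘ ∈-++⁺ˡ

snd⊑ : ∀ xs ys {zs} → xs ++ ys ⊑ zs → ys ⊑ zs
snd⊑ xs ys ι k = ι k ∘ ∈-++⁺ʳ xs

tail⊑ : ∀ x xs {zs} → x ∷ xs ⊑ zs → xs ⊑ zs
tail⊑ x xs ι k = ι k ∘ there

mutual

  compile : ∀ {n Sg} (e : Tm n) → sig e ⊑ Sg → Exp Sg n
  compile (var i)      ι = var i
  compile nil          ι = leaf
  compile (cons a b)   ι = node (compile a (fst⊑ (sig a) _ ι)) (compile b (snd⊑ (sig a) _ ι))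
  compile (bind a b)   ι = bind (compile a (fst⊑ (sig a) _ ι)) (compile b (snd⊑ (sig a) _ ι))
  compile (case a b c) ι = match (compile a (fst⊑ (sig a) _ ι))
    (compile b (fst⊑ (sig b) _ (snd⊑ (sig a) _ ι))) (compile c (snd⊑ (sig b) _ (snd⊑ (sig a) _ ι)))
  compile (app {k = k} f es) ι = call (ι k (here refl)) (compile* es (snd⊑ (sig f) _ (tail⊑ _ _ ι)))
  compile (rec {n} xs s b p q) ι = call (ι _ (here refl))
    (compile xs (fst⊑ (sig xs) _ ι₁) ∷ compile s (fst⊑ (sig s) _ (snd⊑ (sig xs) _ ι₁)) ∷
     Vec.tabulate var)
    where ι₁ = tail⊑ _ _ ι

  compile* : ∀ {n k Sg} (es : Vec (Tm n) k) → sig* es ⊑ Sg → Vec (Exp Sg n) k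
  compile* []       ι = []
  compile* (e ∷ es) ι = compile e (fst⊑ (sig e) _ ι) ∷ compile* es (snd⊑ (sig e) _ ι)

-- The environment is handed on unchanged: behind head, tail, spine and state it starts at variable
-- 4.
loopBody : ∀ {n Sg} → 2 + n ∈ Sg → Exp Sg (2 + n) → Exp Sg (4 + n) → Exp Sg (5 + n) → Exp Sg (2 + n)
loopBody self b p q = match (var zero) b
  (bind (call self (var (suc zero) ∷ p ∷ Vec.tabulate (λ i → var (suc (suc (suc (suc i))))))) q)

mutual

  functions : ∀ {n Sg} (e : Tm n) → sig e ⊑ Sg → All (Exp Sg) (sig e)
  functions (var i)      ι = []
  functions nil          ι = []
  functions (cons a b)   ι = ++⁺ (functions a (fst⊑ (sig a) _ ι)) (functions b (snd⊑ (sig a) _ ι))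
  functions (bind a b)   ι = ++⁺ (functions a (fst⊑ (sig a) _ ι)) (functions b (snd⊑ (sig a) _ ι))
  functions (case a b c) ι = ++⁺ (functions a (fst⊑ (sig a) _ ι))
    (++⁺ (functions b (fst⊑ (sig b) _ (snd⊑ (sig a) _ ι))) (functions c (snd⊑ (sig b) _ (snd⊑ (sig a) _ ι))))
  functions (app f es)   ι = compile f (fst⊑ (sig f) _ (tail⊑ _ _ ι)) ∷
    ++⁺ (functions f (fst⊑ (sig f) _ (tail⊑ _ _ ι))) (functions* es (snd⊑ (sig f) _ (tail⊑ _ _ ι)))
  functions (rec xs s b p q) ι =
    loopBody (ι _ (here refl)) (compile b (fst⊑ (sig b) _ ι₃)) (compile p (fst⊑ (sig p) _ ι₄))
             (compile q (snd⊑ (sig p) _ ι₄)) ∷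
    ++⁺ (functions xs (fst⊑ (sig xs) _ ι₁)) (++⁺ (functions s (fst⊑ (sig s) _ ι₂))
      (++⁺ (functions b (fst⊑ (sig b) _ ι₃))
        (++⁺ (functions p (fst⊑ (sig p) _ ι₄)) (functions q (snd⊑ (sig p) _ ι₄)))))
    where
    ι₁ = tail⊑ _ _ ι
    ι₂ = snd⊑ (sig xs) _ ι₁
    ι₃ = snd⊑ (sig s) _ ι₂
    ι₄ = snd⊑ (sig b) _ ι₃

  functions* : ∀ {n k Sg} (es : Vec (Tm n) k) → sig* es ⊑ Sg → All (Exp Sg) (sig* es)
  functions* []       ι = []
  functions* (e ∷ es) ι = ++⁺ (functions e (fst⊑ (sig e) _ ι)) (functions* es (snd⊑ (sig e) _ ι))

-- All bodies refer to one another through the signature of the whole program. This invariant says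
-- that the indices given to a subterm lead to the functions generated for it.
record Linked {Sg xs} (bodies : Bodies Sg) (ι : xs ⊑ Sg) (fs : All (Exp Sg) xs) : Set where
  constructor linked
  field link : ∀ k i → All.lookup bodies (ι k i) ≡ All.lookup fs i

open Linked

lookup-++⁺ˡ : ∀ {A : Set} {P : A → Set} {xs ys : List A} (as : All P xs) (bs : All P ys) {x} (i : x ∈ xs) →
              All.lookup (++⁺ as bs) (∈-++⁺ˡ i) ≡ All.lookup as i
lookup-++⁺ˡ (a ∷ as) bs (here refl) = refl
lookup-++⁺ˡ (a ∷ as) bs (there i)   = lookup-++⁺ˡ as bs i

lookup-++⁺ʳ : ∀ {A : Set} {P : A → Set} {xs ys : List A} (as : All P xs) (bs : All P ys) {x} (i : x ∈ ys) →
              All.lookup (++⁺ as bs) (∈-++⁺ʳ xs i) ≡ All.lookup bs i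
lookup-++⁺ʳ []       bs i = refl
lookup-++⁺ʳ (a ∷ as) bs i = lookup-++⁺ʳ as bs i

module _ {Sg : List ℕ} (bodies : Bodies Sg) where

  linked-++ : ∀ {xs ys} {ι : xs ++ ys ⊑ Sg} (as : All (Exp Sg) xs) {bs : All (Exp Sg) ys} →
              Linked bodies ι (++⁺ as bs) →
              Linked bodies (fst⊑ xs ys ι) as × Linked bodies (snd⊑ xs ys ι) bs
  linked-++ {xs} as {bs} (linked L) =
    linked (λ k i → trans (L k (∈-++⁺ˡ i)) (lookup-++⁺ˡ as bs i)) ,
    linked (λ k i → trans (L k (∈-++⁺ʳ xs i)) (lookup-++⁺ʳ as bs i))

  linked-tail : ∀ {x xs} {ι : x ∷ xs ⊑ Sg} {a : Exp Sg x} {as : All (Exp Sg) xs} →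
                Linked bodies ι (a ∷ as) → Linked bodies (tail⊑ x xs ι) as
  linked-tail (linked L) = linked λ k i → L k (there i)

-- Bounds on the cost of compiled terms

mutual

  costBound : ∀ {n} → ℕ → Tm n → ℕ
  costBound B (var i)      = 1
  costBound B nil          = 1
  costBound B (cons a b)   = suc (costBound B a + costBound B b)
  costBound B (bind a b)   = suc (costBound B a + costBound B b)
  costBound B (case a b c) = suc (costBound B a + (costBound B b + costBound B c))
  costBound B (app f es)   = suc (costBound* B es + costBound B f)
  costBound B (rec {n} xs s b p q) =
    suc (costBound B xs + (costBound B s + n) + suc B * loopStep n (costBound B b) (costBound B p) (costBound B q))

  -- The 5 counts `match`, its variable, `bind`, `call` and the variable for the tail; `n` counts
  -- the variables that copy the environment. Including the cost `b` of the end makes `suc B` such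
  -- steps cover the whole loop.
  loopStep : ℕ → ℕ → ℕ → ℕ → ℕ
  loopStep n b p q = 5 + (b + (p + n) + q)

  costBound* : ∀ {n k} → ℕ → Vec (Tm n) k → ℕ
  costBound* B []       = 0
  costBound* B (e ∷ es) = costBound B e + costBound* B es

module _ {Sg : List ℕ} (bodies : Bodies Sg) where

  open Evaluation bodies

  ⇓-tabulate : ∀ {n k} (ρ′ : Vec Tree n) (ρ : Vec Tree k) (σ : Fin k → Fin n) →
               (∀ i → Vec.lookup ρ′ (σ i) ≡ Vec.lookup ρ i) →
               ρ′ ⊢* Vec.tabulate (λ i → var (σ i)) ⇓ ρ ⟨ k ⟩
  ⇓-tabulate ρ′ []      σ eq = []
  ⇓-tabulate ρ′ (v ∷ ρ) σ eq =
    subst (λ w → ρ′ ⊢ var (σ zero) ⇓ w ⟨ 1 ⟩) (eq zero) (var (σ zero)) ∷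
    ⇓-tabulate ρ′ ρ (σ ∘ suc) (eq ∘ suc)

  Eval : ∀ {n} → Vec Tree n → Exp Sg n → Tree → ℕ → Set
  Eval ρ e v b = ∃ λ c → ρ ⊢ e ⇓ v ⟨ c ⟩ × c ≤ b

  Eval* : ∀ {n k} → Vec Tree n → Vec (Exp Sg n) k → Vec Tree k → ℕ → Set
  Eval* ρ es vs b = ∃ λ c → ρ ⊢* es ⇓ vs ⟨ c ⟩ × c ≤ b

  step-cost : ∀ {m n b p q cp cr cq : ℕ} → cp ≤ p → cr ≤ suc m * loopStep n b p q → cq ≤ q →
              suc (1 + suc (suc (1 + (cp + n) + cr) + cq)) ≤ suc (suc m) * loopStep n b p q
  step-cost {m} {n} {b} {p} {q} {cp} {cr} {cq} cp≤ cr≤ cq≤ = begin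
    suc (1 + suc (suc (1 + (cp + n) + cr) + cq))
      ≡⟨ solve 4 (λ cp n cr cq → con 2 :+ (con 1 :+ (con 2 :+ (cp :+ n) :+ cr :+ cq)) := con 5 :+ ((cp :+ n) :+ cq) :+ cr) refl cp n cr cq ⟩
    5 + ((cp + n) + cq) + cr
      ≤⟨ +-mono-≤ (+-monoʳ-≤ 5 (+-mono-≤ (≤-trans (+-monoˡ-≤ n cp≤) (m≤n+m (p + n) b)) cq≤)) cr≤ ⟩
    loopStep n b p q + suc m * loopStep n b p q ∎
    where open ≤-Reasoning
          open +-*-Solver

  mutual

    compile-⇓ : ∀ {B n} {ρ : Vec Tree n} (e : Tm n) {v} (ι : sig e ⊑ Sg) → Linked bodies ι (functions e ι) →
                B ∣ ρ ⊢ e ⇓ v → Eval ρ (compile e ι) v (costBound B e)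
    compile-⇓ _ ι L (var i) = 1 , var i , ≤-refl
    compile-⇓ _ ι L nil     = 1 , leaf , ≤-refl
    compile-⇓ (cons a b) ι L (cons d₁ d₂)
      with La , Lb ← linked-++ bodies (functions a _) L
      with c₁ , e₁ , b₁ ← compile-⇓ a _ La d₁
         | c₂ , e₂ , b₂ ← compile-⇓ b _ Lb d₂
      = _ , node e₁ e₂ , s≤s (+-mono-≤ b₁ b₂)
    compile-⇓ (bind a b) ι L (bind d₁ d₂)
      with La , Lb ← linked-++ bodies (functions a _) L
      with c₁ , e₁ , b₁ ← compile-⇓ a _ La d₁
         | c₂ , e₂ , b₂ ← compile-⇓ b _ Lb d₂
      = _ , bind e₁ e₂ , s≤s (+-mono-≤ b₁ b₂)
    compile-⇓ (case a b c) ι L (case-leaf d₁ d₂)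
      with La , Lbc ← linked-++ bodies (functions a _) L
      with Lb , _ ← linked-++ bodies (functions b _) Lbc
      with c₁ , e₁ , b₁ ← compile-⇓ a _ La d₁
         | c₂ , e₂ , b₂ ← compile-⇓ b _ Lb d₂
      = _ , match-leaf e₁ e₂ , s≤s (+-mono-≤ b₁ (≤-trans b₂ (m≤m+n _ _)))
    compile-⇓ {B} (case a b c) ι L (case-node d₁ d₂)
      with La , Lbc ← linked-++ bodies (functions a _) L
      with _ , Lc ← linked-++ bodies (functions b _) Lbc
      with c₁ , e₁ , b₁ ← compile-⇓ a _ La d₁
         | c₂ , e₂ , b₂ ← compile-⇓ c _ Lc d₂
      = _ , match-node e₁ e₂ , s≤s (+-mono-≤ b₁ (≤-trans b₂ (m≤n+m _ (costBound B b))))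
    compile-⇓ (app {k = k} f es) ι L (app ds d)
      with Lf , Les ← linked-++ bodies (functions f _) (linked-tail bodies L)
      with c₁ , e₁ , b₁ ← compile-⇓* es _ Les ds
         | c₂ , e₂ , b₂ ← compile-⇓ f _ Lf d
      = _ , call e₁ (subst (λ g → _ ⊢ g ⇓ _ ⟨ c₂ ⟩) (sym (link L k (here refl))) e₂) , s≤s (+-mono-≤ b₁ b₂)
    compile-⇓ {B} {n} {ρ} (rec xs s b p q) ι L (rec {t = t} d₁ d₂ t≤B l)
      with Lxs , L₁ ← linked-++ bodies (functions xs _) (linked-tail bodies L)
      with Ls , L₂ ← linked-++ bodies (functions s _) L₁
      with Lb , L₃ ← linked-++ bodies (functions b _) L₂
      with Lp , Lq ← linked-++ bodies (functions p _) L₃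
      with c₁ , e₁ , b₁ ← compile-⇓ xs _ Lxs d₁
         | c₂ , e₂ , b₂ ← compile-⇓ s _ Ls d₂
         | c₃ , e₃ , b₃ ← loop-⇓ b p q Lb Lp Lq (link L _ (here refl)) l
      = _ , call (e₁ ∷ e₂ ∷ ⇓-tabulate ρ ρ id (λ _ → refl)) e₃ ,
        s≤s (+-mono-≤ (+-mono-≤ b₁ (+-monoˡ-≤ n b₂)) (≤-trans b₃ (*-monoˡ-≤ _ (s≤s t≤B))))

    loop-⇓ : ∀ {B n} {ρ : Vec Tree n} b p q {t u v} →
             {ιb : sig b ⊑ Sg} {ιp : sig p ⊑ Sg} {ιq : sig q ⊑ Sg} →
             Linked bodies ιb (functions b ιb) → Linked bodies ιp (functions p ιp) →
             Linked bodies ιq (functions q ιq) → {self : 2 + n ∈ Sg} →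
             All.lookup bodies self ≡ loopBody self (compile b ιb) (compile p ιp) (compile q ιq) →
             Loop B ρ b p q t u v →
             Eval (t ∷ u ∷ ρ) (All.lookup bodies self) v
                  (suc (spine t) * loopStep n (costBound B b) (costBound B p) (costBound B q))
    loop-⇓ {B} {ρ = ρ} b p q {u = u} Lb Lp Lq eq (stop d)
      with c , e , le ← compile-⇓ b _ Lb d
      = _ , subst (λ g → (leaf ∷ u ∷ ρ) ⊢ g ⇓ _ ⟨ _ ⟩) (sym eq) (match-leaf (var zero) e) ,
        ≤-trans (s≤s (s≤s (≤-trans le (≤-trans (≤-trans (m≤m+n _ _) (m≤m+n _ (costBound B q))) (m≤n+m _ 3))))) (m≤m+n _ 0)
    loop-⇓ {B} {n} {ρ} b p q {u = u} Lb Lp Lq eq (next {h} {t} d₁ l d₂)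
      with c₁ , e₁ , b₁ ← compile-⇓ p _ Lp d₁
         | c₂ , e₂ , b₂ ← compile-⇓ q _ Lq d₂
         | c₃ , e₃ , b₃ ← loop-⇓ b p q Lb Lp Lq eq l
      = _ , subst (λ g → (node h t ∷ u ∷ ρ) ⊢ g ⇓ _ ⟨ _ ⟩) (sym eq)
              (match-node (var zero) (bind (call (var (suc zero) ∷ e₁ ∷ ⇓-tabulate _ ρ _ (λ _ → refl)) e₃) e₂)) ,
        step-cost {spine t} {n} {costBound B b} {costBound B p} {costBound B q} {c₁} {c₃} {c₂} b₁ b₃ b₂

    compile-⇓* : ∀ {B n k} {ρ : Vec Tree n} (es : Vec (Tm n) k) {vs} (ι : sig* es ⊑ Sg) →
                 Linked bodies ι (functions* es ι) → B ∣ ρ ⊢* es ⇓ vs → Eval* ρ (compile* es ι) vs (costBound* B es)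
    compile-⇓* _ ι L []       = _ , [] , z≤n
    compile-⇓* (e ∷ es) ι L (d ∷ ds)
      with Le , Les ← linked-++ bodies (functions e _) L
      with c₁ , e₁ , b₁ ← compile-⇓ e _ Le d
         | c₂ , e₂ , b₂ ← compile-⇓* es _ Les ds
      = _ , e₁ ∷ e₂ , +-mono-≤ b₁ b₂

toProgram : Tm 1 → Program
toProgram e = program (functions e (λ _ → id)) (compile e (λ _ → id))

toProgram-runs : ∀ {B e x v} → B ∣ x ∷ [] ⊢ e ⇓ v → ∃ λ c → Run (toProgram e) x v c × c ≤ costBound B e
toProgram-runs {e = e} = compile-⇓ (functions e (λ _ → id)) e (λ _ → id) (linked λ _ _ → refl)

-- Polynomial growth of the cost

mutual

  -- Degrees are added where a maximum would do, which keeps the estimates uniform; only `rec`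
  -- contributes a new factor `suc B`.
  degree : ∀ {n} → Tm n → ℕ
  degree (var i)      = 0
  degree nil          = 0
  degree (cons a b)   = degree a + degree b
  degree (bind a b)   = degree a + degree b
  degree (case a b c) = degree a + (degree b + degree c)
  degree (app f es)   = degree* es + degree f
  degree (rec xs s b p q) = degree xs + (degree s + suc (degree b + (degree p + degree q)))

  degree* : ∀ {n k} → Vec (Tm n) k → ℕ
  degree* []       = 0
  degree* (e ∷ es) = degree e + degree* es

mutual

  factor : ∀ {n} → Tm n → ℕ
  factor (var i)      = 1
  factor nil          = 1
  factor (cons a b)   = suc (factor a + factor b)
  factor (bind a b)   = suc (factor a + factor b)
  factor (case a b c) = suc (factor a + (factor b + factor c))
  factor (app f es)   = suc (factor* es + factor f)
  factor (rec {n} xs s b p q) = suc (factor xs + (factor s + n) + (5 + (factor b + (factor p + n) + factor q)))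

  factor* : ∀ {n k} → Vec (Tm n) k → ℕ
  factor* []       = 0
  factor* (e ∷ es) = factor e + factor* es

module _ (B : ℕ) where

  private
    -- Positive even for `B = 0`, so that degrees may be raised freely.
    X = suc B

  record Bounded (x c d : ℕ) : Set where
    constructor bounded
    field bound : x ≤ c * X ^ d

  open Bounded

  bounded-const : ∀ x d → Bounded x x d
  bounded-const x d = bounded (m≤m*n x (X ^ d) {{m^n≢0 X d}})

  bounded-mono : ∀ {x c d d′} → d ≤ d′ → Bounded x c d → Bounded x c d′
  bounded-mono {c = c} d≤d′ (bounded x≤) = bounded (≤-trans x≤ (*-monoʳ-≤ c (^-monoʳ-≤ X d≤d′)))

  bounded-+ : ∀ {x y c c′ d} → Bounded x c d → Bounded y c′ d → Bounded (x + y) (c + c′) d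
  bounded-+ {c = c} {c′} {d} (bounded x≤) (bounded y≤) =
    bounded (≤-trans (+-mono-≤ x≤ y≤) (≤-reflexive (sym (*-distribʳ-+ (X ^ d) c c′))))

  bounded-+₂ : ∀ {x y c c′ d d′} → Bounded x c d → Bounded y c′ d′ → Bounded (x + y) (c + c′) (d + d′)
  bounded-+₂ {d = d} {d′} x≤ y≤ = bounded-+ (bounded-mono (m≤m+n d d′) x≤) (bounded-mono (m≤n+m d′ d) y≤)

  bounded-+n : ∀ {x c d} n → Bounded x c d → Bounded (x + n) (c + n) d
  bounded-+n n x≤ = bounded-+ x≤ (bounded-const n _)

  bounded-n+ : ∀ {x c d} n → Bounded x c d → Bounded (n + x) (n + c) d
  bounded-n+ n x≤ = bounded-+ (bounded-const n _) x≤

  bounded-* : ∀ {x c d} → Bounded x c d → Bounded (X * x) c (suc d)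
  bounded-* {x} {c} {d} (bounded x≤) = bounded (begin
    X * x           ≤⟨ *-monoʳ-≤ X x≤ ⟩
    X * (c * X ^ d) ≡⟨ solve 3 (λ X c y → X :* (c :* y) := c :* (X :* y)) refl X c (X ^ d) ⟩
    c * (X * X ^ d) ∎)
    where open ≤-Reasoning
          open +-*-Solver

  mutual

    costBound-bounded : ∀ {n} (e : Tm n) → Bounded (costBound B e) (factor e) (degree e)
    costBound-bounded (var i)      = bounded-const 1 0
    costBound-bounded nil          = bounded-const 1 0
    costBound-bounded (cons a b)   = bounded-n+ 1 (bounded-+₂ (costBound-bounded a) (costBound-bounded b))
    costBound-bounded (bind a b)   = bounded-n+ 1 (bounded-+₂ (costBound-bounded a) (costBound-bounded b))
    costBound-bounded (case a b c) = bounded-n+ 1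
      (bounded-+₂ (costBound-bounded a) (bounded-+₂ (costBound-bounded b) (costBound-bounded c)))
    costBound-bounded (app f es)   = bounded-n+ 1 (bounded-+₂ (costBound-bounded* es) (costBound-bounded f))
    costBound-bounded (rec {n} xs s b p q) = bounded-n+ 1 (subst (Bounded _ _) (+-assoc (degree xs) _ _)
      (bounded-+₂ (bounded-+₂ (costBound-bounded xs) (bounded-+n n (costBound-bounded s)))
        (bounded-* (bounded-n+ 5 (subst (Bounded _ _) (+-assoc (degree b) _ _)
          (bounded-+₂ (bounded-+₂ (costBound-bounded b) (bounded-+n n (costBound-bounded p)))
            (costBound-bounded q)))))))

    costBound-bounded* : ∀ {n k} (es : Vec (Tm n) k) → Bounded (costBound* B es) (factor* es) (degree* es)
    costBound-bounded* []       = bounded-const 0 0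
    costBound-bounded* (e ∷ es) = bounded-+₂ (costBound-bounded e) (costBound-bounded* es)

costBound-polynomial : ∀ B {n} (e : Tm n) → costBound B e ≤ factor e * suc B ^ degree e
costBound-polynomial B e = Bounded.bound (costBound-bounded B e)

-- Determinism of evaluation

module _ {Sg : List ℕ} {bodies : Bodies Sg} where

  open Evaluation bodies

  mutual

    ⇓-deterministic : ∀ {n} {ρ : Vec Tree n} {e v w c d} →
                      ρ ⊢ e ⇓ v ⟨ c ⟩ → ρ ⊢ e ⇓ w ⟨ d ⟩ → v ≡ w × c ≡ d
    ⇓-deterministic (var i) (var .i) = refl , refl
    ⇓-deterministic leaf leaf = refl , refl
    ⇓-deterministic (node a b) (node a′ b′)
      with refl , refl ← ⇓-deterministic a a′ | refl , refl ← ⇓-deterministic b b′ = refl , refl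
    ⇓-deterministic (bind a b) (bind a′ b′)
      with refl , refl ← ⇓-deterministic a a′ with refl , refl ← ⇓-deterministic b b′ = refl , refl
    ⇓-deterministic (match-leaf a b) (match-leaf a′ b′)
      with refl , refl ← ⇓-deterministic a a′ with refl , refl ← ⇓-deterministic b b′ = refl , refl
    ⇓-deterministic (match-leaf a b) (match-node a′ b′) with () , _ ← ⇓-deterministic a a′
    ⇓-deterministic (match-node a b) (match-leaf a′ b′) with () , _ ← ⇓-deterministic a a′
    ⇓-deterministic (match-node a b) (match-node a′ b′)
      with refl , refl ← ⇓-deterministic a a′ with refl , refl ← ⇓-deterministic b b′ = refl , refl
    ⇓-deterministic (call a b) (call a′ b′)
      with refl , refl ← ⇓*-deterministic a a′ with refl , refl ← ⇓-deterministic b b′ = refl , refl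

    ⇓*-deterministic : ∀ {n k} {ρ : Vec Tree n} {es : Vec (Exp Sg n) k} {vs ws c d} →
                       ρ ⊢* es ⇓ vs ⟨ c ⟩ → ρ ⊢* es ⇓ ws ⟨ d ⟩ → vs ≡ ws × c ≡ d
    ⇓*-deterministic [] [] = refl , refl
    ⇓*-deterministic (a ∷ as) (b ∷ bs)
      with refl , refl ← ⇓-deterministic a b | refl , refl ← ⇓*-deterministic as bs = refl , refl

-- Lists and bijective binary numbers

pattern x0 = var zero
pattern x1 = var (suc zero)
pattern x2 = var (suc (suc zero))
pattern x3 = var (suc (suc (suc zero)))
pattern x4 = var (suc (suc (suc (suc zero))))
pattern x5 = var (suc (suc (suc (suc (suc zero)))))
pattern x6 = var (suc (suc (suc (suc (suc (suc zero))))))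
pattern x7 = var (suc (suc (suc (suc (suc (suc (suc zero)))))))
pattern x8 = var (suc (suc (suc (suc (suc (suc (suc (suc zero))))))))
pattern x9 = var (suc (suc (suc (suc (suc (suc (suc (suc (suc zero)))))))))
pattern x10 = var (suc (suc (suc (suc (suc (suc (suc (suc (suc (suc zero))))))))))
pattern x11 = var (suc (suc (suc (suc (suc (suc (suc (suc (suc (suc (suc zero)))))))))))
pattern x12 = var (suc (suc (suc (suc (suc (suc (suc (suc (suc (suc (suc (suc zero))))))))))))
pattern x13 = var (suc (suc (suc (suc (suc (suc (suc (suc (suc (suc (suc (suc (suc zero)))))))))))))
pattern x14 = var (suc (suc (suc (suc (suc (suc (suc (suc (suc (suc (suc (suc (suc (suc zero))))))))))))))

pattern one = cons nil nil

codeBool : Bool → Tree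
codeBool false = leaf
codeBool true  = node leaf leaf

cong-⇓ : ∀ {B n} {ρ : Vec Tree n} {e} {A : Set} (code : A → Tree) {v w} → v ≡ w → B ∣ ρ ⊢ e ⇓ code v → B ∣ ρ ⊢ e ⇓ code w
cong-⇓ code refl d = d

fst snd : ∀ {n} → Tm n → Tm n
fst e = case e nil x0
snd e = case e nil x1

fst-⇓ : ∀ {B n} {ρ : Vec Tree n} {e u v} → B ∣ ρ ⊢ e ⇓ node u v → B ∣ ρ ⊢ fst e ⇓ u
fst-⇓ d = case-node d x0

snd-⇓ : ∀ {B n} {ρ : Vec Tree n} {e u v} → B ∣ ρ ⊢ e ⇓ node u v → B ∣ ρ ⊢ snd e ⇓ v
snd-⇓ d = case-node d x1

codes : ∀ {A : Set} → (A → Tree) → List A → Tree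
codes code xs = codeList (List.map code xs)

spine-codes : ∀ {A : Set} (code : A → Tree) xs → spine (codes code xs) ≡ length xs
spine-codes code []       = refl
spine-codes code (x ∷ xs) = cong suc (spine-codes code xs)

fold : ∀ {n} → Tm n → Tm (2 + n) → Tm (5 + n) → Tm n
fold xs b q = rec xs nil b nil q

-- `P` is an invariant inherited by suffixes and `R` the intended result on each suffix, so that a
-- single induction step remains to be shown for each use.
fold-⇓ : ∀ {B n} {ρ : Vec Tree n} {A : Set} (code : A → Tree) {e b q} (P : List A → Set) (R : List A → Tree) →
         (∀ {x xs} → P (x ∷ xs) → P xs) →
         (∀ x xs → P (x ∷ xs) →
            B ∣ R xs ∷ code x ∷ codes code xs ∷ codes code (x ∷ xs) ∷ leaf ∷ ρ ⊢ q ⇓ R (x ∷ xs)) →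
         ∀ L → P L → length L ≤ B → B ∣ ρ ⊢ e ⇓ codes code L → B ∣ leaf ∷ leaf ∷ ρ ⊢ b ⇓ R [] →
         B ∣ ρ ⊢ fold e b q ⇓ R L
fold-⇓ {B} {ρ = ρ} code {b = b} {q} P R tl step L PL L≤B d db =
  rec d nil (≤-trans (≤-reflexive (spine-codes code L)) L≤B) (loop L PL)
  where
  loop : ∀ L → P L → Loop B ρ b nil q (codes code L) leaf (R L)
  loop []      _ = stop db
  loop (x ∷ L) p = next nil (loop L (tl p)) (step x L p)

mapT : ∀ {n} → Tm n → Tm (5 + n) → Tm n
mapT e f = fold e nil (cons f x0)

filterT : ∀ {n} → Tm n → Tm (5 + n) → Tm n
filterT e c = fold e nil (case c x0 (cons x3 x2))

anyT : ∀ {n} → Tm n → Tm (5 + n) → Tm n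
anyT e c = fold e nil (case c x0 one)

allT : ∀ {n} → Tm n → Tm (5 + n) → Tm n
allT e c = fold e one (case c nil x2)

module _ {B n : ℕ} {ρ : Vec Tree n} {A : Set} (code : A → Tree) where

  Body : Tm (5 + n) → A → Tree → Set
  Body c x v = ∀ {r t u s} → B ∣ r ∷ code x ∷ t ∷ u ∷ s ∷ ρ ⊢ c ⇓ v

  private
    elements-⇓ : ∀ {e b q} (R : List A → Tree) L →
      (∀ x xs → x ∈ L → B ∣ R xs ∷ code x ∷ codes code xs ∷ codes code (x ∷ xs) ∷ leaf ∷ ρ ⊢ q ⇓ R (x ∷ xs)) →
      length L ≤ B → B ∣ ρ ⊢ e ⇓ codes code L → B ∣ leaf ∷ leaf ∷ ρ ⊢ b ⇓ R [] →
      B ∣ ρ ⊢ fold e b q ⇓ R L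
    elements-⇓ R L step = fold-⇓ code (λ xs → ∀ {y} → y ∈ xs → y ∈ L) R (λ p → p ∘ there) (λ x xs p → step x xs (p (here refl))) L id

  map-⇓ : ∀ (code′ : A → Tree) {e f} L → length L ≤ B → B ∣ ρ ⊢ e ⇓ codes code L →
          (∀ {x} → x ∈ L → Body f x (code′ x)) → B ∣ ρ ⊢ mapT e f ⇓ codes code′ L
  map-⇓ code′ L L≤B d h = elements-⇓ (codes code′) L (λ _ _ x∈ → cons (h x∈) x0) L≤B d nil

  filter-⇓ : ∀ (g : A → Bool) {e c} L → length L ≤ B → B ∣ ρ ⊢ e ⇓ codes code L →
             (∀ {x} → x ∈ L → Body c x (codeBool (g x))) → B ∣ ρ ⊢ filterT e c ⇓ codes code (filterᵇ g L)
  filter-⇓ g {c = c} L L≤B d h = elements-⇓ (codes code ∘ filterᵇ g) L (λ _ xs x∈ → step xs (h x∈)) L≤B d nil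
    where
    step : ∀ {x} xs → Body c x (codeBool (g x)) →
           B ∣ codes code (filterᵇ g xs) ∷ code x ∷ codes code xs ∷ codes code (x ∷ xs) ∷ leaf ∷ ρ
             ⊢ case c x0 (cons x3 x2) ⇓ codes code (filterᵇ g (x ∷ xs))
    step {x} _ h with g x
    ... | true  = case-node h (cons x3 x2)
    ... | false = case-leaf h x0

  any-⇓ : ∀ (g : A → Bool) {e c} L → length L ≤ B → B ∣ ρ ⊢ e ⇓ codes code L →
          (∀ {x} → x ∈ L → Body c x (codeBool (g x))) → B ∣ ρ ⊢ anyT e c ⇓ codeBool (any g L)
  any-⇓ g {c = c} L L≤B d h = elements-⇓ (codeBool ∘ any g) L (λ _ xs x∈ → step xs (h x∈)) L≤B d nil
    where
    step : ∀ {x} xs → Body c x (codeBool (g x)) →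
           B ∣ codeBool (any g xs) ∷ code x ∷ codes code xs ∷ codes code (x ∷ xs) ∷ leaf ∷ ρ
             ⊢ case c x0 one ⇓ codeBool (any g (x ∷ xs))
    step {x} _ h with g x
    ... | true  = case-node h one
    ... | false = case-leaf h x0

  all-⇓ : ∀ (g : A → Bool) {e c} L → length L ≤ B → B ∣ ρ ⊢ e ⇓ codes code L →
          (∀ {x} → x ∈ L → Body c x (codeBool (g x))) → B ∣ ρ ⊢ allT e c ⇓ codeBool (all g L)
  all-⇓ g {c = c} L L≤B d h = elements-⇓ (codeBool ∘ all g) L (λ _ xs x∈ → step xs (h x∈)) L≤B d one
    where
    step : ∀ {x} xs → Body c x (codeBool (g x)) →
           B ∣ codeBool (all g xs) ∷ code x ∷ codes code xs ∷ codes code (x ∷ xs) ∷ leaf ∷ ρ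
             ⊢ case c nil x2 ⇓ codeBool (all g (x ∷ xs))
    step {x} _ h with g x
    ... | true  = case-node h x2
    ... | false = case-leaf h nil

and-⇓ : ∀ {B n} {ρ : Vec Tree n} {e₁ e₂} b {c} → B ∣ ρ ⊢ e₁ ⇓ codeBool b →
        (∀ {l r} → b ≡ true → B ∣ l ∷ r ∷ ρ ⊢ e₂ ⇓ codeBool c) → B ∣ ρ ⊢ case e₁ nil e₂ ⇓ codeBool (b ∧ c)
and-⇓ false d₁ d₂ = case-leaf d₁ nil
and-⇓ true  d₁ d₂ = case-node d₁ (d₂ refl)

opaque

  append : Tm 2
  append = fold x0 x3 (cons x1 x0)

  append-⇓ : ∀ {B} {A : Set} (code : A → Tree) xs ys → length xs ≤ B →
             B ∣ codes code xs ∷ codes code ys ∷ [] ⊢ append ⇓ codes code (xs ++ ys)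
  append-⇓ code xs ys le = fold-⇓ code (λ _ → ℕ) (λ xs → codes code (xs ++ ys)) (λ p → p)
    (λ _ _ _ → cons x1 x0) xs 0 le x0 x3

-- Arithmetic on bijective binary codes

spine-codeℕᵇ : ∀ x → 2 ^ spine (codeℕᵇ x) ≤ suc (toℕ x)
spine-codeℕᵇ ℕᵇ.zero  = s≤s z≤n
spine-codeℕᵇ 2[1+ x ] = ≤-trans (*-monoʳ-≤ 2 (spine-codeℕᵇ x)) (n≤1+n _)
spine-codeℕᵇ 1+[2 x ] = ≤-trans (*-monoʳ-≤ 2 (spine-codeℕᵇ x)) (≤-reflexive (*-suc 2 (toℕ x)))

-- The source of the side conditions `< 2 ^ B` on numbers: they keep every loop over binary digits
-- within `B`.
spine-codeℕᵇ-≤ : ∀ {B} x → toℕ x < 2 ^ B → spine (codeℕᵇ x) ≤ B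
spine-codeℕᵇ-≤ {B} x x< = ≮⇒≥ λ B< →
  <⇒≱ (^-monoʳ-< 2 (s≤s (s≤s z≤n)) B<) (≤-trans (spine-codeℕᵇ x) x<)

ev≤ : ∀ x → toℕ x ≤ toℕ 2[1+ x ]
ev≤ x = ≤-trans (n≤1+n (toℕ x)) (m≤m+n _ _)

od≤ : ∀ x → toℕ x ≤ toℕ 1+[2 x ]
od≤ x = ≤-trans (m≤m+n (toℕ x) _) (n≤1+n _)

opaque

  incUp : Tm 6
  incUp = case x1 (cons one x0) (cons nil x4)

  inc : Tm 1
  inc = fold x0 (cons one nil) incUp

  inc-⇓ᵇ : ∀ {B} x → toℕ x < 2 ^ B → B ∣ codeℕᵇ x ∷ [] ⊢ inc ⇓ codeℕᵇ (ℕᵇ.suc x)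
  inc-⇓ᵇ {B} x x< = rec x0 nil (spine-codeℕᵇ-≤ x x<) (loop x)
    where
    loop : ∀ {ρ : Vec Tree 1} x → Loop B ρ (cons one nil) nil incUp (codeℕᵇ x) leaf (codeℕᵇ (ℕᵇ.suc x))
    loop ℕᵇ.zero  = stop (cons one nil)
    loop 2[1+ x ] = next nil (loop x) (case-leaf x1 (cons one x0))
    loop 1+[2 x ] = next nil (loop x) (case-node x1 (cons nil x4))

app₁-⇓ : ∀ {B n} {ρ : Vec Tree n} {f e v w} → B ∣ v ∷ [] ⊢ f ⇓ w → B ∣ ρ ⊢ e ⇓ v → B ∣ ρ ⊢ app f (e ∷ []) ⇓ w
app₁-⇓ f d = app (d ∷ []) f

app₂-⇓ : ∀ {B n} {ρ : Vec Tree n} {f e e′ v v′ w} → B ∣ v ∷ v′ ∷ [] ⊢ f ⇓ w →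
         B ∣ ρ ⊢ e ⇓ v → B ∣ ρ ⊢ e′ ⇓ v′ → B ∣ ρ ⊢ app f (e ∷ e′ ∷ []) ⇓ w
app₂-⇓ f d d′ = app (d ∷ d′ ∷ []) f

fromℕ-suc : ∀ a → ℕᵇ.suc (fromℕ a) ≡ fromℕ (suc a)
fromℕ-suc a = ℕᵇ.toℕ-injective (trans (ℕᵇ.toℕ-suc (fromℕ a))
  (trans (cong suc (ℕᵇ.toℕ-fromℕ a)) (sym (ℕᵇ.toℕ-fromℕ (suc a)))))

opaque

  -- No carry runs through the loop: the low digit of the sum depends on the two low digits alone,
  -- and a carry becomes an `inc` of the sum of the tails.
  addUp : Tm 7
  addUp = case x4 x3
    (case x3
      (case x0 (cons nil (app inc (x2 ∷ []))) (cons one (app inc (x4 ∷ []))))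
      (case x2 (cons one (app inc (x4 ∷ []))) (cons nil x6)))

  add : Tm 2
  add = rec x0 x1 x1 (snd x3) addUp

  add-⇓ᵇ : ∀ {B} x y → toℕ x + toℕ y < 2 ^ B → B ∣ codeℕᵇ x ∷ codeℕᵇ y ∷ [] ⊢ add ⇓ codeℕᵇ (x ℕᵇ.+ y)
  add-⇓ᵇ {B} x y x+y< = rec x0 x1 (spine-codeℕᵇ-≤ x (≤-<-trans (m≤m+n _ _) x+y<)) (loop x y x+y<)
    where
    halves : ∀ {a b c d} → a ≤ c → b ≤ d → c + d < 2 ^ B → a + b < 2 ^ B
    halves a≤ b≤ = ≤-<-trans (+-mono-≤ a≤ b≤)

    inc′ : ∀ {n} {ρ : Vec Tree n} {e} x y → toℕ x + toℕ y < 2 ^ B →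
           B ∣ ρ ⊢ e ⇓ codeℕᵇ (x ℕᵇ.+ y) → B ∣ ρ ⊢ app inc (e ∷ []) ⇓ codeℕᵇ (ℕᵇ.suc (x ℕᵇ.+ y))
    inc′ x y lt = app₁-⇓ (inc-⇓ᵇ (x ℕᵇ.+ y) (subst (_< 2 ^ B) (sym (ℕᵇ.toℕ-homo-+ x y)) lt))

    loop : ∀ {ρ : Vec Tree 2} x y → toℕ x + toℕ y < 2 ^ B →
           Loop B ρ x1 (snd x3) addUp (codeℕᵇ x) (codeℕᵇ y) (codeℕᵇ (x ℕᵇ.+ y))
    loop ℕᵇ.zero y lt = stop x1
    -- After `y` has ended, the loop still runs to the end of `x`; the result of the recursion is
    -- dropped and `x` itself returned.
    loop 2[1+ x ] ℕᵇ.zero lt = next (case-leaf x3 nil) (loop x ℕᵇ.zero (halves (ev≤ x) z≤n lt)) (case-leaf x4 x3)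
    loop 1+[2 x ] ℕᵇ.zero lt = next (case-leaf x3 nil) (loop x ℕᵇ.zero (halves (od≤ x) z≤n lt)) (case-leaf x4 x3)
    loop 2[1+ x ] 2[1+ y ] lt = let lt′ = halves (ev≤ x) (ev≤ y) lt in
      next (case-node x3 x1) (loop x y lt′) (case-node x4 (case-leaf x3 (case-leaf x0 (cons nil (inc′ x y lt′ x2)))))
    loop 2[1+ x ] 1+[2 y ] lt = let lt′ = halves (ev≤ x) (od≤ y) lt in
      next (case-node x3 x1) (loop x y lt′) (case-node x4 (case-leaf x3 (case-node x0 (cons one (inc′ x y lt′ x4)))))
    loop 1+[2 x ] 2[1+ y ] lt = let lt′ = halves (od≤ x) (ev≤ y) lt in
      next (case-node x3 x1) (loop x y lt′) (case-node x4 (case-node x3 (case-leaf x2 (cons one (inc′ x y lt′ x4)))))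
    loop 1+[2 x ] 1+[2 y ] lt = let lt′ = halves (od≤ x) (od≤ y) lt in
      next (case-node x3 x1) (loop x y lt′) (case-node x4 (case-node x3 (case-node x2 (cons nil x6))))

toℕ-fromℕ-< : ∀ {B a} → a < 2 ^ B → toℕ (fromℕ a) < 2 ^ B
toℕ-fromℕ-< {B} {a} = subst (_< 2 ^ B) (sym (ℕᵇ.toℕ-fromℕ a))

inc-⇓ : ∀ {B n} {ρ : Vec Tree n} {e} a → a < 2 ^ B → B ∣ ρ ⊢ e ⇓ codeℕ a → B ∣ ρ ⊢ app inc (e ∷ []) ⇓ codeℕ (suc a)
inc-⇓ {B} a a< = app₁-⇓ (cong-⇓ codeℕᵇ (fromℕ-suc a) (inc-⇓ᵇ (fromℕ a) (toℕ-fromℕ-< {B} a<)))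

add-⇓ : ∀ {B n} {ρ : Vec Tree n} {e e′} a b → a + b < 2 ^ B → B ∣ ρ ⊢ e ⇓ codeℕ a → B ∣ ρ ⊢ e′ ⇓ codeℕ b →
        B ∣ ρ ⊢ app add (e ∷ e′ ∷ []) ⇓ codeℕ (a + b)
add-⇓ {B} a b a+b< = app₂-⇓ (cong-⇓ codeℕᵇ (sym (ℕᵇ.fromℕ-homo-+ a b))
  (add-⇓ᵇ (fromℕ a) (fromℕ b) (subst₂ (λ x y → x + y < 2 ^ B) (sym (ℕᵇ.toℕ-fromℕ a)) (sym (ℕᵇ.toℕ-fromℕ b)) a+b<)))

bit : Bool → ℕ
bit false = 0
bit true  = 1

-- The flag is a borrow: the question is whether `bit b + x ≤ y`. The low digits 2 against 1 create
-- a borrow and 1 against 2 absorb it; equal digits pass it on.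
atMost : Bool → ℕᵇ → ℕᵇ → Bool
atMost b ℕᵇ.zero  ℕᵇ.zero  = not b
atMost b ℕᵇ.zero  2[1+ y ] = true
atMost b ℕᵇ.zero  1+[2 y ] = true
atMost b 2[1+ x ] ℕᵇ.zero  = false
atMost b 1+[2 x ] ℕᵇ.zero  = false
atMost b 2[1+ x ] 2[1+ y ] = atMost b x y
atMost b 2[1+ x ] 1+[2 y ] = atMost true x y
atMost b 1+[2 x ] 2[1+ y ] = atMost false x y
atMost b 1+[2 x ] 1+[2 y ] = atMost b x y

double-≤-odd : ∀ {a b} → 2 * a ≤ suc (2 * b) → a ≤ b
double-≤-odd {a} {b} h = ≮⇒≥ λ b<a → <⇒≱ (≤-trans (≤-reflexive (sym (*-suc 2 b))) (*-monoʳ-≤ 2 b<a)) h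

≤ᵇ-cong : ∀ a b c d → (a ≤ b → c ≤ d) → (c ≤ d → a ≤ b) → (a ≤ᵇ b) ≡ (c ≤ᵇ d)
≤ᵇ-cong a b c d to from = does-⇔ (mk⇔ to from) (a ≤? b) (c ≤? d)

atMost-≤ᵇ : ∀ b x y → atMost b x y ≡ (bit b + toℕ x ≤ᵇ toℕ y)
atMost-≤ᵇ false ℕᵇ.zero ℕᵇ.zero  = refl
atMost-≤ᵇ true  ℕᵇ.zero ℕᵇ.zero  = refl
atMost-≤ᵇ false ℕᵇ.zero 2[1+ y ] = refl
atMost-≤ᵇ true  ℕᵇ.zero 2[1+ y ] = refl
atMost-≤ᵇ false ℕᵇ.zero 1+[2 y ] = refl
atMost-≤ᵇ true  ℕᵇ.zero 1+[2 y ] = refl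
atMost-≤ᵇ false 2[1+ x ] ℕᵇ.zero = refl
atMost-≤ᵇ true  2[1+ x ] ℕᵇ.zero = refl
atMost-≤ᵇ false 1+[2 x ] ℕᵇ.zero = refl
atMost-≤ᵇ true  1+[2 x ] ℕᵇ.zero = refl
atMost-≤ᵇ false 2[1+ x ] 2[1+ y ] = trans (atMost-≤ᵇ false x y) (≤ᵇ-cong (toℕ x) (toℕ y) (toℕ 2[1+ x ]) (toℕ 2[1+ y ])
  (λ h → *-monoʳ-≤ 2 (s≤s h)) (λ h → s≤s⁻¹ (*-cancelˡ-≤ 2 h)))
atMost-≤ᵇ true 2[1+ x ] 2[1+ y ] = trans (atMost-≤ᵇ true x y) (≤ᵇ-cong (suc (toℕ x)) (toℕ y) (suc (toℕ 2[1+ x ])) (toℕ 2[1+ y ])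
  (λ h → *-monoʳ-< 2 (s≤s h)) (λ h → s≤s⁻¹ (*-cancelˡ-< 2 _ _ h)))
atMost-≤ᵇ false 2[1+ x ] 1+[2 y ] = trans (atMost-≤ᵇ true x y) (≤ᵇ-cong (suc (toℕ x)) (toℕ y) (toℕ 2[1+ x ]) (toℕ 1+[2 y ])
  (λ h → ≤-trans (*-monoʳ-≤ 2 h) (n≤1+n _)) double-≤-odd)
atMost-≤ᵇ true 2[1+ x ] 1+[2 y ] = trans (atMost-≤ᵇ true x y) (≤ᵇ-cong (suc (toℕ x)) (toℕ y) (suc (toℕ 2[1+ x ])) (toℕ 1+[2 y ])
  (λ h → s≤s (*-monoʳ-≤ 2 h)) (λ h → *-cancelˡ-≤ 2 (s≤s⁻¹ h)))
atMost-≤ᵇ false 1+[2 x ] 2[1+ y ] = trans (atMost-≤ᵇ false x y) (≤ᵇ-cong (toℕ x) (toℕ y) (toℕ 1+[2 x ]) (toℕ 2[1+ y ])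
  (λ h → ≤-trans (s≤s (*-monoʳ-≤ 2 h)) (≤-trans (n≤1+n _) (≤-reflexive (sym (*-suc 2 (toℕ y))))))
  (λ h → double-≤-odd (s≤s⁻¹ (≤-trans h (≤-reflexive (*-suc 2 (toℕ y)))))))
atMost-≤ᵇ true 1+[2 x ] 2[1+ y ] = trans (atMost-≤ᵇ false x y) (≤ᵇ-cong (toℕ x) (toℕ y) (suc (toℕ 1+[2 x ])) (toℕ 2[1+ y ])
  (λ h → ≤-trans (≤-reflexive (sym (*-suc 2 (toℕ x)))) (*-monoʳ-≤ 2 (s≤s h)))
  (λ h → s≤s⁻¹ (*-cancelˡ-≤ 2 (≤-trans (≤-reflexive (*-suc 2 (toℕ x))) h))))
atMost-≤ᵇ false 1+[2 x ] 1+[2 y ] = trans (atMost-≤ᵇ false x y) (≤ᵇ-cong (toℕ x) (toℕ y) (toℕ 1+[2 x ]) (toℕ 1+[2 y ])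
  (λ h → s≤s (*-monoʳ-≤ 2 h)) (λ h → *-cancelˡ-≤ 2 (s≤s⁻¹ h)))
atMost-≤ᵇ true 1+[2 x ] 1+[2 y ] = trans (atMost-≤ᵇ true x y) (≤ᵇ-cong (suc (toℕ x)) (toℕ y) (suc (toℕ 1+[2 x ])) (toℕ 1+[2 y ])
  (λ h → s≤s (*-monoʳ-< 2 h)) (λ h → *-cancelˡ-< 2 _ _ (s≤s⁻¹ h)))

opaque

  leqBase : Tm 4
  leqBase = case x1 nil (case x0 one (case x3 nil one))

  leqDown : Tm 6
  leqDown = case x3 nil (case x1 one
    (case x4
      (case x0 (cons x2 x1) (cons one x3))
      (case x2 (cons nil x3) (cons x6 x5))))

  leqUp : Tm 7
  leqUp = case x4 nil (case x1 nil x4)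

  leq : Tm 2
  leq = rec x0 (cons nil x1) leqBase leqDown leqUp

  leq-⇓ᵇ : ∀ {B} x y → toℕ x < 2 ^ B → B ∣ codeℕᵇ x ∷ codeℕᵇ y ∷ [] ⊢ leq ⇓ codeBool (atMost false x y)
  leq-⇓ᵇ {B} x y x< = rec x0 (cons nil x1) (spine-codeℕᵇ-≤ x x<) (loop false x y)
    where
    loop : ∀ {ρ : Vec Tree 2} b x y → Loop B ρ leqBase leqDown leqUp (codeℕᵇ x) (node (codeBool b) (codeℕᵇ y)) (codeBool (atMost b x y))
    loop false ℕᵇ.zero ℕᵇ.zero  = stop (case-node x1 (case-leaf x0 one))
    loop true  ℕᵇ.zero ℕᵇ.zero  = stop (case-node x1 (case-node x0 (case-leaf x3 nil)))
    loop false ℕᵇ.zero 2[1+ y ] = stop (case-node x1 (case-leaf x0 one))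
    loop true  ℕᵇ.zero 2[1+ y ] = stop (case-node x1 (case-node x0 (case-node x3 one)))
    loop false ℕᵇ.zero 1+[2 y ] = stop (case-node x1 (case-leaf x0 one))
    loop true  ℕᵇ.zero 1+[2 y ] = stop (case-node x1 (case-node x0 (case-node x3 one)))
    -- Once `y` is used up the verdict is negative, whatever the rest of `x`. The state `one`, read
    -- as no borrow and the number zero, is a dummy for the remaining descent.
    loop b 2[1+ x ] ℕᵇ.zero  = next (case-node x3 (case-leaf x1 one)) (loop false x ℕᵇ.zero) (case-node x4 (case-leaf x1 nil))
    loop b 1+[2 x ] ℕᵇ.zero  = next (case-node x3 (case-leaf x1 one)) (loop false x ℕᵇ.zero) (case-node x4 (case-leaf x1 nil))
    loop b 2[1+ x ] 2[1+ y ] = next (case-node x3 (case-node x1 (case-leaf x4 (case-leaf x0 (cons x2 x1)))))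
      (loop b x y) (case-node x4 (case-node x1 x4))
    loop b 2[1+ x ] 1+[2 y ] = next (case-node x3 (case-node x1 (case-leaf x4 (case-node x0 (cons one x3)))))
      (loop true x y) (case-node x4 (case-node x1 x4))
    loop b 1+[2 x ] 2[1+ y ] = next (case-node x3 (case-node x1 (case-node x4 (case-leaf x2 (cons nil x3)))))
      (loop false x y) (case-node x4 (case-node x1 x4))
    loop b 1+[2 x ] 1+[2 y ] = next (case-node x3 (case-node x1 (case-node x4 (case-node x2 (cons x6 x5)))))
      (loop b x y) (case-node x4 (case-node x1 x4))

leq-⇓ : ∀ {B n} {ρ : Vec Tree n} {e e′} a b → a < 2 ^ B → B ∣ ρ ⊢ e ⇓ codeℕ a → B ∣ ρ ⊢ e′ ⇓ codeℕ b →
        B ∣ ρ ⊢ app leq (e ∷ e′ ∷ []) ⇓ codeBool (a ≤ᵇ b)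
leq-⇓ {B} a b a< = app₂-⇓ (cong-⇓ codeBool
  (trans (atMost-≤ᵇ false (fromℕ a) (fromℕ b)) (cong₂ _≤ᵇ_ (ℕᵇ.toℕ-fromℕ a) (ℕᵇ.toℕ-fromℕ b)))
  (leq-⇓ᵇ (fromℕ a) (fromℕ b) (toℕ-fromℕ-< {B} a<)))

≤ᵇ-antisym : ∀ a b → (a ≤ᵇ b) ∧ (b ≤ᵇ a) ≡ (a ≡ᵇ b)
≤ᵇ-antisym zero    zero    = refl
≤ᵇ-antisym zero    (suc b) = refl
≤ᵇ-antisym (suc a) zero    = refl
≤ᵇ-antisym (suc zero)    (suc zero)    = refl
≤ᵇ-antisym (suc zero)    (suc (suc b)) = refl
≤ᵇ-antisym (suc (suc a)) (suc zero)    = refl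
≤ᵇ-antisym (suc (suc a)) (suc (suc b)) = ≤ᵇ-antisym (suc a) (suc b)

≤ᵇ-⊓ : ∀ a b → (if a ≤ᵇ b then a else b) ≡ a ⊓ b
≤ᵇ-⊓ zero    b       = refl
≤ᵇ-⊓ (suc a) zero    = refl
≤ᵇ-⊓ (suc a) (suc b) = trans (lemma a b) (cong suc (≤ᵇ-⊓ a b))
  where
  lemma : ∀ a b → (if suc a ≤ᵇ suc b then suc a else suc b) ≡ suc (if a ≤ᵇ b then a else b)
  lemma zero    b = refl
  lemma (suc a) b with suc a ≤ᵇ b
  ... | true  = refl
  ... | false = refl

opaque

  equal : Tm 2
  equal = case (app leq (x0 ∷ x1 ∷ [])) nil (app leq (x3 ∷ x2 ∷ []))

  minimum : Tm 2
  minimum = case (app leq (x0 ∷ x1 ∷ [])) x1 x2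

  mulUp : Tm 7
  mulUp = case x1
    (bind (app add (x6 ∷ x0 ∷ [])) (app add (x0 ∷ x0 ∷ [])))
    (app add (x8 ∷ app add (x2 ∷ x2 ∷ []) ∷ []))

  mul : Tm 2
  mul = fold x0 nil mulUp

  equal-⇓ : ∀ {B n} {ρ : Vec Tree n} {e e′} a b → a < 2 ^ B → b < 2 ^ B → B ∣ ρ ⊢ e ⇓ codeℕ a → B ∣ ρ ⊢ e′ ⇓ codeℕ b →
            B ∣ ρ ⊢ app equal (e ∷ e′ ∷ []) ⇓ codeBool (a ≡ᵇ b)
  equal-⇓ a b a< b< = app₂-⇓ (cong-⇓ codeBool (≤ᵇ-antisym a b)
    (and-⇓ (a ≤ᵇ b) (leq-⇓ a b a< x0 x1) (λ _ → leq-⇓ b a b< x3 x2)))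

  minimum-⇓ : ∀ {B n} {ρ : Vec Tree n} {e e′} a b → a < 2 ^ B → B ∣ ρ ⊢ e ⇓ codeℕ a → B ∣ ρ ⊢ e′ ⇓ codeℕ b →
              B ∣ ρ ⊢ app minimum (e ∷ e′ ∷ []) ⇓ codeℕ (a ⊓ b)
  minimum-⇓ {B} a b a< = app₂-⇓ (cong-⇓ codeℕ (≤ᵇ-⊓ a b) (select (a ≤ᵇ b) (leq-⇓ a b a< x0 x1)))
    where
    select : ∀ c → B ∣ codeℕ a ∷ codeℕ b ∷ [] ⊢ app leq (x0 ∷ x1 ∷ []) ⇓ codeBool c →
             B ∣ codeℕ a ∷ codeℕ b ∷ [] ⊢ minimum ⇓ codeℕ (if c then a else b)
    select true  d = case-node d x2
    select false d = case-leaf d x1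

  mul-⇓ᵇ : ∀ {B} x b → toℕ x < 2 ^ B → toℕ x * b + b < 2 ^ B → B ∣ codeℕᵇ x ∷ codeℕ b ∷ [] ⊢ mul ⇓ codeℕ (toℕ x * b)
  mul-⇓ᵇ {B} x b x< lt = rec x0 nil (spine-codeℕᵇ-≤ {B} x x<) (loop x lt)
    where
    ev : ∀ a → b + a * b + (b + a * b) ≡ 2 * suc a * b
    ev a = solve 2 (λ a b → b :+ a :* b :+ (b :+ a :* b) := con 2 :* (con 1 :+ a) :* b) refl a b
      where open +-*-Solver
    od : ∀ a → b + (a * b + a * b) ≡ suc (2 * a) * b
    od a = solve 2 (λ a b → b :+ (a :* b :+ a :* b) := (con 1 :+ con 2 :* a) :* b) refl a b
      where open +-*-Solver
    loop : ∀ {x₀} x → toℕ x * b + b < 2 ^ B → Loop B (x₀ ∷ codeℕ b ∷ []) nil nil mulUp (codeℕᵇ x) leaf (codeℕ (toℕ x * b))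
    loop ℕᵇ.zero  lt = stop nil
    loop 2[1+ x ] lt = next nil (loop x (≤-<-trans (+-monoˡ-≤ b (*-monoˡ-≤ b (ev≤ x))) lt))
      (case-leaf x1 (bind (add-⇓ b (toℕ x * b) (≤-<-trans (m≤m+n _ _) lt′) x6 x0)
        (cong-⇓ codeℕ (ev (toℕ x)) (add-⇓ (b + toℕ x * b) (b + toℕ x * b) lt′ x0 x0))))
      where
      lt′ : b + toℕ x * b + (b + toℕ x * b) < 2 ^ B
      lt′ = subst (_< 2 ^ B) (sym (ev (toℕ x))) (≤-<-trans (m≤m+n _ b) lt)
    loop 1+[2 x ] lt = next nil (loop x (≤-<-trans (+-monoˡ-≤ b (*-monoˡ-≤ b (od≤ x))) lt))
      (case-node x1 (cong-⇓ codeℕ (od (toℕ x))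
        (add-⇓ b (toℕ x * b + toℕ x * b) lt′ x8 (add-⇓ (toℕ x * b) (toℕ x * b) (≤-<-trans (m≤n+m _ b) lt′) x2 x2))))
      where
      lt′ : b + (toℕ x * b + toℕ x * b) < 2 ^ B
      lt′ = subst (_< 2 ^ B) (sym (od (toℕ x))) (≤-<-trans (m≤m+n _ b) lt)

mul-⇓ : ∀ {B n} {ρ : Vec Tree n} {e e′} a b → a < 2 ^ B → a * b + b < 2 ^ B → B ∣ ρ ⊢ e ⇓ codeℕ a → B ∣ ρ ⊢ e′ ⇓ codeℕ b →
        B ∣ ρ ⊢ app mul (e ∷ e′ ∷ []) ⇓ codeℕ (a * b)
mul-⇓ {B} a b a< lt = app₂-⇓ (cong-⇓ (λ z → codeℕ (z * b)) (ℕᵇ.toℕ-fromℕ a)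
  (mul-⇓ᵇ (fromℕ a) b (toℕ-fromℕ-< {B} a<) (subst (λ z → z * b + b < 2 ^ B) (sym (ℕᵇ.toℕ-fromℕ a)) lt)))

opaque

  count : Tm 1
  count = fold x0 nil (app inc (x0 ∷ []))

  count-⇓ : ∀ {B} {A : Set} (code : A → Tree) xs → length xs ≤ B → length xs < 2 ^ B →
            B ∣ codes code xs ∷ [] ⊢ count ⇓ codeℕ (length xs)
  count-⇓ {B} code xs le lt = fold-⇓ code (λ xs → length xs < 2 ^ B) (codeℕ ∘ length) (≤-trans (n≤1+n _))
    (λ _ xs p → inc-⇓ (length xs) (≤-trans (n≤1+n _) p) x0) xs lt le x0 nil

-- Sublists and independent sets

infix 4 _∈?_

_∈?_ : ∀ {m} (x : Fin m) (xs : List (Fin m)) → Dec (x ∈ xs)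
_∈?_ = member? _≟_

unique-⊆⇒length-≤ : ∀ {m} {xs ys : List (Fin m)} → Unique xs → (∀ {x} → x ∈ xs → x ∈ ys) → length xs ≤ length ys
unique-⊆⇒length-≤ {xs = []}          _          _  = z≤n
unique-⊆⇒length-≤ {xs = x ∷ xs} {ys} (x∉ ∷ uxs) xs⊆ys = ≤-trans
  (s≤s (unique-⊆⇒length-≤ uxs (λ {y} y∈ → ∈-filter⁺ (λ z → ¬? (x ≟ z)) (xs⊆ys (there y∈)) (All.lookup x∉ y∈))))
  (filter-notAll (λ z → ¬? (x ≟ z)) ys (Any.map (λ x≡z x≢z → x≢z x≡z) (xs⊆ys (here refl))))

-- The sublists of a suffix stay on as a final segment, so only `map (x ∷_) (subs xs)` is new when
-- `x` is added. The search relies on this order.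
subs : ∀ {A : Set} → List A → List (List A)
subs []       = [] ∷ []
subs (x ∷ xs) = List.map (x ∷_) (subs xs) ++ subs xs

length-subs : ∀ {A : Set} (xs : List A) → length (subs xs) ≡ 2 ^ length xs
length-subs []       = refl
length-subs (x ∷ xs) = begin
  length (List.map (x ∷_) (subs xs) ++ subs xs)     ≡⟨ length-++ (List.map (x ∷_) (subs xs)) ⟩
  length (List.map (x ∷_) (subs xs)) + length (subs xs)
    ≡⟨ cong₂ _+_ (trans (length-map (x ∷_) (subs xs)) (length-subs xs)) (trans (length-subs xs) (sym (+-identityʳ _))) ⟩
  2 * 2 ^ length xs ∎
  where open ≡-Reasoning

filterᵇ∈subs : ∀ {A : Set} (p : A → Bool) xs → filterᵇ p xs ∈ subs xs
filterᵇ∈subs p []       = here refl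
filterᵇ∈subs p (x ∷ xs) with p x
... | true  = ∈-++⁺ˡ (∈-map⁺ (x ∷_) (filterᵇ∈subs p xs))
... | false = ∈-++⁺ʳ (List.map (x ∷_) (subs xs)) (filterᵇ∈subs p xs)

[]∈subs : ∀ {A : Set} (xs : List A) → [] ∈ subs xs
[]∈subs []       = here refl
[]∈subs (x ∷ xs) = ∈-++⁺ʳ (List.map (x ∷_) (subs xs)) ([]∈subs xs)

subs-⊆ : ∀ {A : Set} xs {ys : List A} → ys ∈ subs xs → ∀ {y} → y ∈ ys → y ∈ xs
subs-⊆ [] (here refl) ()
subs-⊆ (x ∷ xs) ys∈ y∈ with ∈-++⁻ (List.map (x ∷_) (subs xs)) ys∈
... | inj₂ ys∈′ = there (subs-⊆ xs ys∈′ y∈)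
... | inj₁ ys∈′ with zs , zs∈ , refl ← ∈-map⁻ (x ∷_) ys∈′ with y∈
...   | here refl = here refl
...   | there y∈′ = there (subs-⊆ xs zs∈ y∈′)

subs-unique : ∀ {A : Set} {xs ys : List A} → Unique xs → ys ∈ subs xs → Unique ys
subs-unique {xs = []} _ (here refl) = []
subs-unique {xs = x ∷ xs} (x∉ ∷ u) ys∈ with ∈-++⁻ (List.map (x ∷_) (subs xs)) ys∈
... | inj₂ ys∈′ = subs-unique u ys∈′
... | inj₁ ys∈′ with zs , zs∈ , refl ← ∈-map⁻ (x ∷_) ys∈′ =
  All.tabulate (λ z∈ → All.lookup x∉ (subs-⊆ xs zs∈ z∈)) ∷ subs-unique u zs∈

subs-length : ∀ {A : Set} (xs : List A) {ys} → ys ∈ subs xs → length ys ≤ length xs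
subs-length [] (here refl) = z≤n
subs-length (x ∷ xs) ys∈ with ∈-++⁻ (List.map (x ∷_) (subs xs)) ys∈
... | inj₂ ys∈′ = ≤-trans (subs-length xs ys∈′) (n≤1+n _)
... | inj₁ ys∈′ with zs , zs∈ , refl ← ∈-map⁻ (x ∷_) ys∈′ = s≤s (subs-length xs zs∈)

fromᵇ : ∀ {m} → (Fin m → Bool) → Subset m
fromᵇ = Vec.tabulate

∈-fromᵇ⁺ : ∀ {m} (p : Fin m → Bool) {x} → p x ≡ true → x Subset.∈ fromᵇ p
∈-fromᵇ⁺ p {x} px = lookup⇒[]= x _ (trans (lookup∘tabulate p x) px)

∈-fromᵇ⁻ : ∀ {m} (p : Fin m → Bool) {x} → x Subset.∈ fromᵇ p → p x ≡ true
∈-fromᵇ⁻ p {x} x∈ = trans (sym (lookup∘tabulate p x)) ([]=⇒lookup x∈)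

private
  length-filter-tabulate : ∀ {m k} {P : Pred (Fin m) 0ℓ} (P? : Decidable P) (f : Fin k → Fin m) (S : Subset k) →
                           (∀ i → does (P? (f i)) ≡ does (i Subset.∈? S)) →
                           length (filter P? (tabulate f)) ≡ Subset.∣ S ∣
  length-filter-tabulate P? f []      eq = refl
  length-filter-tabulate {k = suc k} P? f (b ∷ S) eq with does (P? (f zero)) | eq zero
  length-filter-tabulate {k = suc k} P? f (true ∷ S)  eq | true  | _ = cong suc (length-filter-tabulate P? (f ∘ suc) S (eq ∘ suc))
  length-filter-tabulate {k = suc k} P? f (false ∷ S) eq | false | _ = length-filter-tabulate P? (f ∘ suc) S (eq ∘ suc)

elements : ∀ {m} → Subset m → List (Fin m)
elements S = filter (Subset._∈? S) (allFin _)

length-elements : ∀ {m} (S : Subset m) → length (elements S) ≡ Subset.∣ S ∣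
length-elements S = length-filter-tabulate (Subset._∈? S) id S (λ _ → refl)

∈-elements⁺ : ∀ {m} {S : Subset m} {x} → x Subset.∈ S → x ∈ elements S
∈-elements⁺ {S = S} {x} = ∈-filter⁺ (Subset._∈? S) (∈-allFin x)

∈-elements⁻ : ∀ {m} {S : Subset m} {x} → x ∈ elements S → x Subset.∈ S
∈-elements⁻ {S = S} x∈ = proj₂ (∈-filter⁻ (Subset._∈? S) {xs = allFin _} x∈)

fromList : ∀ {m} → List (Fin m) → Subset m
fromList xs = fromᵇ (λ x → does (x ∈? xs))

∈-fromList⁺ : ∀ {m} {xs : List (Fin m)} {x} → x ∈ xs → x Subset.∈ fromList xs
∈-fromList⁺ {xs = xs} {x} x∈ = ∈-fromᵇ⁺ (λ x → does (x ∈? xs)) (lemma (x ∈? xs))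
  where
  lemma : (d : Dec (x ∈ xs)) → does d ≡ true
  lemma (yes _) = refl
  lemma (no x∉) = contradiction x∈ x∉

∈-fromList⁻ : ∀ {m} {xs : List (Fin m)} {x} → x Subset.∈ fromList xs → x ∈ xs
∈-fromList⁻ {xs = xs} {x} x∈ with x ∈? xs | ∈-fromᵇ⁻ (λ x → does (x ∈? xs)) x∈
... | yes x∈′ | _  = x∈′
... | no _    | ()

-- An independent set in a digraph of out-degree at most τ: some vertex also
-- has in-degree at most τ; take it, and delete its neighbours.

module _ {m : ℕ} (C : Fin m → List (Fin m)) (τ : ℕ) where

  private

    incoming : List (Fin m) → Fin m → List (Fin m)
    incoming L e = filter (λ f → e ∈? C f) L

    outgoing : List (Fin m) → Fin m → List (Fin m)
    outgoing L f = filter (λ e → e ∈? C f) L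

    sum-+ : ∀ {A : Set} (f g : A → ℕ) xs → sum (List.map (λ x → f x + g x) xs) ≡ sum (List.map f xs) + sum (List.map g xs)
    sum-+ f g []       = refl
    sum-+ f g (x ∷ xs) = trans (cong (f x + g x +_) (sum-+ f g xs))
      (solve 4 (λ a b c d → a :+ b :+ (c :+ d) := a :+ c :+ (b :+ d)) refl (f x) (g x) (sum (List.map f xs)) (sum (List.map g xs)))
      where open +-*-Solver

    sum-0 : ∀ {A : Set} (xs : List A) → sum (List.map (λ _ → 0) xs) ≡ 0
    sum-0 []       = refl
    sum-0 (x ∷ xs) = sum-0 xs

    outgoing-∷ : ∀ e xs f → length (outgoing (e ∷ xs) f) ≡ length (outgoing (e ∷ []) f) + length (outgoing xs f)
    outgoing-∷ e xs f with does (e ∈? C f)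
    ... | true  = refl
    ... | false = refl

    incoming-outgoing : ∀ e ys → length (incoming ys e) ≡ sum (List.map (λ f → length (outgoing (e ∷ []) f)) ys)
    incoming-outgoing e []       = refl
    incoming-outgoing e (f ∷ ys) with does (e ∈? C f)
    ... | true  = cong suc (incoming-outgoing e ys)
    ... | false = incoming-outgoing e ys

    -- Both sides count the arcs from `ys` to `xs`, grouped by their heads or by their tails.
    double-count : ∀ xs ys → sum (List.map (length ∘ incoming ys) xs) ≡ sum (List.map (length ∘ outgoing xs) ys)
    double-count []       ys = sym (sum-0 ys)
    double-count (e ∷ xs) ys = begin
      length (incoming ys e) + sum (List.map (length ∘ incoming ys) xs)
        ≡⟨ cong₂ _+_ (incoming-outgoing e ys) (double-count xs ys) ⟩
      sum (List.map (λ f → length (outgoing (e ∷ []) f)) ys) + sum (List.map (length ∘ outgoing xs) ys)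
        ≡⟨ sum-+ (λ f → length (outgoing (e ∷ []) f)) (length ∘ outgoing xs) ys ⟨
      sum (List.map (λ f → length (outgoing (e ∷ []) f) + length (outgoing xs f)) ys)
        ≡⟨ cong sum (List.map-cong (λ f → sym (outgoing-∷ e xs f)) ys) ⟩
      sum (List.map (length ∘ outgoing (e ∷ xs)) ys) ∎
      where open ≡-Reasoning

    sum-≤ : ∀ {A : Set} (f : A → ℕ) b xs → All (λ x → f x ≤ b) xs → sum (List.map f xs) ≤ length xs * b
    sum-≤ f b []       []       = z≤n
    sum-≤ f b (x ∷ xs) (p ∷ ps) = +-mono-≤ p (sum-≤ f b xs ps)

    ≤-sum : ∀ {A : Set} (f : A → ℕ) b xs → All (λ x → b ≤ f x) xs → length xs * b ≤ sum (List.map f xs)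
    ≤-sum f b []       []       = z≤n
    ≤-sum f b (x ∷ xs) (p ∷ ps) = +-mono-≤ p (≤-sum f b xs ps)

  Independent : List (Fin m) → Set
  Independent R = ∀ {e f} → e ∈ R → f ∈ R → f ∉ C e

  private

    -- Otherwise all in-degrees exceed `τ`, although their sum equals that of the out-degrees, which
    -- is at most `length L * τ`.
    low-indegree : ∀ L → Unique L → 0 < length L → (∀ {e} → e ∈ L → length (C e) ≤ τ) →
                   ∃ λ e → e ∈ L × length (incoming L e) ≤ τ
    low-indegree L uL 0<L C≤τ with Any.any? (λ e → length (incoming L e) ≤? τ) L
    ... | yes p = find p
    ... | no ¬p = contradiction (begin-strict
        length L * τ                                  <⟨ *-monoʳ-< (length L) {{>-nonZero 0<L}} (n<1+n τ) ⟩
        length L * suc τ                              ≤⟨ ≤-sum (length ∘ incoming L) (suc τ) L (All.map ≰⇒> (¬Any⇒All¬ L ¬p)) ⟩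
        sum (List.map (length ∘ incoming L) L)        ≡⟨ double-count L L ⟩
        sum (List.map (length ∘ outgoing L) L)        ≤⟨ sum-≤ (length ∘ outgoing L) τ L (All.tabulate λ {f} f∈ → ≤-trans (outgoing-≤ f) (C≤τ f∈)) ⟩
        length L * τ                                  ∎) (<-irrefl refl)
      where
      open ≤-Reasoning
      outgoing-≤ : ∀ f → length (outgoing L f) ≤ length (C f)
      outgoing-≤ f = unique-⊆⇒length-≤ (filter⁺ (λ e → e ∈? C f) uL) (λ x∈ → proj₂ (∈-filter⁻ (λ e → e ∈? C f) {xs = L} x∈))

  independent-set : ∀ ϱ L → Unique L → ϱ * suc (τ + τ) ≤ length L →
                    (∀ {e} → e ∈ L → length (C e) ≤ τ × e ∉ C e) →
                    ∃ λ R → (∀ {e} → e ∈ R → e ∈ L) × Unique R × length R ≡ ϱ × Independent R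
  independent-set zero    L uL le h = [] , (λ ()) , [] , refl , λ ()
  independent-set (suc ϱ) L uL le h
    with e , e∈L , in≤τ ← low-indegree L uL (≤-trans (s≤s z≤n) le) (proj₁ ∘ h)
    = e ∷ R , sub , uR′ , cong suc |R|≡ϱ , ind
    where
    free? : ∀ f → Dec (¬ f ≡ e × f ∉ C e × e ∉ C f)
    free? f = ¬? (f ≟ e) ×-dec ¬? (f ∈? C e) ×-dec ¬? (e ∈? C f)
    L′ : List (Fin m)
    L′ = filter free? L
    -- Whatever does not survive in `L′` is `e`, a successor or a predecessor of `e`; counting this
    -- cover bounds the loss.
    cover : ∀ {f} → f ∈ L → f ∈ L′ ++ (e ∷ C e ++ incoming L e)
    cover {f} f∈ with f ≟ e | f ∈? C e | e ∈? C f
    ... | yes refl | _ | _ = ∈-++⁺ʳ L′ (here refl)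
    ... | no _ | yes f∈C | _ = ∈-++⁺ʳ L′ (there (∈-++⁺ˡ f∈C))
    ... | no _ | no _ | yes e∈C = ∈-++⁺ʳ L′ (there (∈-++⁺ʳ (C e) (∈-filter⁺ (λ f → e ∈? C f) f∈ e∈C)))
    ... | no a | no b | no c = ∈-++⁺ˡ (∈-filter⁺ free? f∈ (a , b , c))
    bound : suc (τ + τ) + ϱ * suc (τ + τ) ≤ suc (τ + τ) + length L′
    bound = begin
      suc (τ + τ) + ϱ * suc (τ + τ)                     ≤⟨ le ⟩
      length L                                          ≤⟨ unique-⊆⇒length-≤ uL cover ⟩
      length (L′ ++ (e ∷ C e ++ incoming L e))          ≡⟨ length-++ L′ ⟩
      length L′ + suc (length (C e ++ incoming L e))    ≡⟨ cong (λ k → length L′ + suc k) (length-++ (C e)) ⟩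
      length L′ + suc (length (C e) + length (incoming L e)) ≤⟨ +-monoʳ-≤ (length L′) (s≤s (+-mono-≤ (proj₁ (h e∈L)) in≤τ)) ⟩
      length L′ + suc (τ + τ)                           ≡⟨ +-comm (length L′) _ ⟩
      suc (τ + τ) + length L′                           ∎
      where open ≤-Reasoning
    L′⊆L : ∀ {f} → f ∈ L′ → f ∈ L × (¬ f ≡ e × f ∉ C e × e ∉ C f)
    L′⊆L = ∈-filter⁻ free? {xs = L}
    rest = independent-set ϱ L′ (filter⁺ free? uL) (+-cancelˡ-≤ (suc (τ + τ)) _ _ bound) (h ∘ proj₁ ∘ L′⊆L)
    R : List (Fin m)
    R = proj₁ rest
    R⊆L′ : ∀ {f} → f ∈ R → f ∈ L′
    R⊆L′ = proj₁ (proj₂ rest)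
    |R|≡ϱ : length R ≡ ϱ
    |R|≡ϱ = proj₁ (proj₂ (proj₂ (proj₂ rest)))
    sub : ∀ {f} → f ∈ e ∷ R → f ∈ L
    sub (here refl) = e∈L
    sub (there f∈)  = proj₁ (L′⊆L (R⊆L′ f∈))
    uR′ : Unique (e ∷ R)
    uR′ = All.tabulate (λ f∈ e≡f → proj₁ (proj₂ (L′⊆L (R⊆L′ f∈))) (sym e≡f)) ∷ proj₁ (proj₂ (proj₂ rest))
    ind : Independent (e ∷ R)
    ind (here refl) (here refl) = proj₂ (h e∈L)
    ind (here refl) (there f∈)  = proj₁ (proj₂ (proj₂ (L′⊆L (R⊆L′ f∈))))
    ind (there e∈)  (here refl) = proj₂ (proj₂ (proj₂ (L′⊆L (R⊆L′ e∈))))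
    ind (there e∈)  (there f∈)  = proj₂ (proj₂ (proj₂ (proj₂ rest))) e∈ f∈

-- Double negation shifts over a finite index type. This allows a conflict list to be fixed for all
-- edges at once without computing any.
¬¬-∀ : ∀ {m} {P : Fin m → Set} → (∀ i → ¬ ¬ P i) → ¬ ¬ (∀ i → P i)
¬¬-∀ {zero}  h k = k λ ()
¬¬-∀ {suc m} h k = h zero λ p₀ → ¬¬-∀ (h ∘ suc) λ ps → k λ { zero → p₀ ; (suc i) → ps i }

-- Distances

module Distances (G : Graph) (far : ℕ) where

  open Graph G

  -- Inserting the edges one by one: a shortest path in e ∷ S uses e at most
  -- once.  The value far stands for infinity.

  dist : List Edge → Vertex → Vertex → ℕ
  dist []      x y = if Fin.toℕ x ≡ᵇ Fin.toℕ y then 0 else far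
  dist (e ∷ S) x y = dist S x y ⊓
    ((dist S x (src e) + (ℓ e + dist S (tgt e) y)) ⊓ (dist S x (tgt e) + (ℓ e + dist S (src e) y)))

  walkLength : ∀ {x y} → Walk x y → ℕ
  walkLength w = sum (List.map ℓ (walkEdges w))

  _inside_ : ∀ {x y} → Walk x y → List Edge → Set
  w inside S = All (_∈ S) (walkEdges w)

  infixr 5 _⊕_

  _⊕_ : ∀ {x y z} → Walk x y → Walk y z → Walk x z
  []         ⊕ w = w
  step e j v ⊕ w = step e j (v ⊕ w)

  ⊕-length : ∀ {x y z} (v : Walk x y) (w : Walk y z) → walkLength (v ⊕ w) ≡ walkLength v + walkLength w
  ⊕-length []           w = refl
  ⊕-length (step e j v) w = trans (cong (_+_ (ℓ e)) (⊕-length v w)) (sym (+-assoc (ℓ e) _ _))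

  ⊕-All : ∀ {x y z} {P : Pred Edge 0ℓ} (v : Walk x y) (w : Walk y z) →
          All P (walkEdges v) → All P (walkEdges w) → All P (walkEdges (v ⊕ w))
  ⊕-All []           w []       ws = ws
  ⊕-All (step e j v) w (p ∷ vs) ws = p ∷ ⊕-All v w vs ws

  dist-≤-far : ∀ S x y → dist S x y ≤ far
  dist-≤-far []      x y with Fin.toℕ x ≡ᵇ Fin.toℕ y
  ... | true  = z≤n
  ... | false = ≤-refl
  dist-≤-far (e ∷ S) x y = ≤-trans (m⊓n≤m _ _) (dist-≤-far S x y)

  dist-refl : ∀ S x → dist S x x ≡ 0
  dist-refl []      x with Fin.toℕ x ≡ᵇ Fin.toℕ x | ≡⇒≡ᵇ (Fin.toℕ x) (Fin.toℕ x) refl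
  ... | true | _ = refl
  dist-refl (e ∷ S) x rewrite dist-refl S x = refl

  dist-sym : ∀ S x y → dist S x y ≡ dist S y x
  dist-sym [] x y = cong (if_then 0 else far) (≡ᵇ-sym (Fin.toℕ x) (Fin.toℕ y))
    where
    ≡ᵇ-sym : ∀ a b → (a ≡ᵇ b) ≡ (b ≡ᵇ a)
    ≡ᵇ-sym zero    zero    = refl
    ≡ᵇ-sym zero    (suc b) = refl
    ≡ᵇ-sym (suc a) zero    = refl
    ≡ᵇ-sym (suc a) (suc b) = ≡ᵇ-sym a b
  dist-sym (e ∷ S) x y = cong₂ _⊓_ (dist-sym S x y)
    (trans (⊓-comm _ _) (cong₂ _⊓_ (swap (tgt e) (src e)) (swap (src e) (tgt e))))
    where
    swap : ∀ a b → dist S x a + (ℓ e + dist S b y) ≡ dist S y b + (ℓ e + dist S a x)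
    swap a b = trans (cong₂ (λ s t → s + (ℓ e + t)) (dist-sym S x a) (dist-sym S b y))
      (solve 3 (λ s l t → s :+ (l :+ t) := t :+ (l :+ s)) refl (dist S a x) (ℓ e) (dist S y b))
      where open +-*-Solver

  dist-joins : ∀ S {e x y} → Joins e x y → dist S x y ≡ dist S (src e) (tgt e)
  dist-joins S (inj₁ refl) = refl
  dist-joins S (inj₂ refl) = dist-sym S _ _

  private
    ≤-+-⊓ : ∀ {x} k {a b} → x ≤ k + a → x ≤ k + b → x ≤ k + a ⊓ b
    ≤-+-⊓ k {a} {b} p q with ⊓-sel a b
    ... | inj₁ eq rewrite eq = p
    ... | inj₂ eq rewrite eq = q

  -- Prefixing one edge at a time is enough to bound `dist` by every walk. For an older edge the
  -- inequality passes through each branch of the minimum; for the newly inserted edge, a route that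
  -- already uses it is cut.
  dist-step : ∀ {S f x z} y → f ∈ S → Joins f x z → dist S x y ≤ ℓ f + dist S z y
  dist-step {e ∷ S} {f} {x} {z} y (there f∈) j = ≤-+-⊓ (ℓ f)
    (≤-trans (m⊓n≤m _ _) (dist-step y f∈ j))
    (≤-+-⊓ (ℓ f)
      (≤-trans (m⊓n≤n (dist S x y) _) (≤-trans (m⊓n≤m _ _) (via (src e) _)))
      (≤-trans (m⊓n≤n (dist S x y) _) (≤-trans (m⊓n≤n (dist S x (src e) + _) _) (via (tgt e) _))))
    where
    via : ∀ c k → dist S x c + k ≤ ℓ f + (dist S z c + k)
    via c k = ≤-trans (+-monoˡ-≤ k (dist-step c f∈ j)) (≤-reflexive (+-assoc (ℓ f) _ _))
  -- A route from `tgt e` may itself use `e`. If it crosses from `src e` to `tgt e`, its last part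
  -- already starts at `tgt e`; if it crosses back, its last part starts at `src e` and no copy of
  -- `e` is required.
  dist-step {e ∷ S} {x = x} y (here refl) (inj₁ refl) = ≤-+-⊓ (ℓ e)
    forward
    (≤-+-⊓ (ℓ e)
      (≤-trans forward (+-monoʳ-≤ (ℓ e) (≤-trans (m≤n+m _ (ℓ e)) (m≤n+m _ (dist S (tgt e) (src e))))))
      (≤-trans (m⊓n≤m _ _) (≤-trans (m≤n+m _ (ℓ e)) (≤-trans (m≤n+m _ (dist S (tgt e) (tgt e))) (m≤n+m _ (ℓ e))))))
    where
    forward : dist (e ∷ S) (src e) y ≤ ℓ e + dist S (tgt e) y
    forward = ≤-trans (m⊓n≤n (dist S (src e) y) _) (≤-trans (m⊓n≤m _ _) (≤-reflexive (cong (_+ (ℓ e + dist S (tgt e) y)) (dist-refl S (src e)))))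
  dist-step {e ∷ S} {x = x} y (here refl) (inj₂ refl) = ≤-+-⊓ (ℓ e)
    backward
    (≤-+-⊓ (ℓ e)
      (≤-trans (m⊓n≤m _ _) (≤-trans (m≤n+m _ (ℓ e)) (≤-trans (m≤n+m _ (dist S (src e) (src e))) (m≤n+m _ (ℓ e)))))
      (≤-trans backward (+-monoʳ-≤ (ℓ e) (≤-trans (m≤n+m _ (ℓ e)) (m≤n+m _ (dist S (src e) (tgt e)))))))
    where
    backward : dist (e ∷ S) (tgt e) y ≤ ℓ e + dist S (src e) y
    backward = ≤-trans (m⊓n≤n (dist S (tgt e) y) _)
      (≤-trans (m⊓n≤n (dist S (tgt e) (src e) + _) _) (≤-reflexive (cong (_+ (ℓ e + dist S (src e) y)) (dist-refl S (tgt e)))))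

  dist-≤ : ∀ {S x y} (w : Walk x y) → w inside S → dist S x y ≤ walkLength w
  dist-≤ {S} {x} []   []         = ≤-reflexive (dist-refl S x)
  dist-≤ (step e j w) (e∈ ∷ w∈) = ≤-trans (dist-step _ e∈ j) (+-monoʳ-≤ (ℓ e) (dist-≤ w w∈))

  Realized : List Edge → Vertex → Vertex → ℕ → Set
  Realized S x y d = ∃ λ (w : Walk x y) → w inside S × walkLength w ≡ d

  -- Sums with an infinite summand may exceed `far`, so inside the recursion infinity means any
  -- value from `far` on.
  dist-realized : ∀ S x y → far ≤ dist S x y ⊎ Realized S x y (dist S x y)
  dist-realized [] x y with Fin.toℕ x ≡ᵇ Fin.toℕ y | ≡ᵇ⇒≡ (Fin.toℕ x) (Fin.toℕ y)
  ... | false | _ = inj₁ ≤-refl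
  ... | true  | h with refl ← Fin.toℕ-injective (h tt) = inj₂ ([] , [] , refl)
  dist-realized (e ∷ S) x y = choose direct (choose (via (inj₁ refl)) (via (inj₂ refl)))
    where
    R : ℕ → Set
    R d = far ≤ d ⊎ Realized (e ∷ S) x y d
    choose : ∀ {a b} → R a → R b → R (a ⊓ b)
    choose {a} {b} ra rb with ⊓-sel a b
    ... | inj₁ eq rewrite eq = ra
    ... | inj₂ eq rewrite eq = rb
    direct : R (dist S x y)
    direct with dist-realized S x y
    ... | inj₁ le            = inj₁ le
    ... | inj₂ (w , w∈ , eq) = inj₂ (w , All.map there w∈ , eq)
    via : ∀ {a b} → Joins e a b → R (dist S x a + (ℓ e + dist S b y))
    via {a} {b} j with dist-realized S x a | dist-realized S b y
    ... | inj₁ le | _ = inj₁ (≤-trans le (m≤m+n _ _))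
    ... | _ | inj₁ le = inj₁ (≤-trans le (≤-trans (m≤n+m _ (ℓ e)) (m≤n+m _ (dist S x a))))
    ... | inj₂ (v , v∈ , eq) | inj₂ (w , w∈ , eq′) = inj₂
      (v ⊕ step e j w , ⊕-All v (step e j w) (All.map there v∈) (here refl ∷ All.map there w∈) ,
       trans (⊕-length v (step e j w)) (cong₂ (λ s t → s + (ℓ e + t)) eq eq′))

  -- Drops the part of a simple walk in front of `x`, which removes the cycle that a new first edge
  -- would close. The quantifier over `Q` records that no other edges are used.
  shortcut : ∀ {x y z} (w : Walk z y) → Unique (vertices w) → x ∈ vertices w →
             ∃ λ (P : Path x y) → (∀ {Q : Pred Edge 0ℓ} → All Q (walkEdges w) → P Within Q) × pathLength P ≤ walkLength w
  shortcut []           u (here refl) = ([] , u) , id , ≤-refl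
  shortcut (step e j w) u (here refl) = (step e j w , u) , id , ≤-refl
  shortcut (step e j w) (_ ∷ u) (there x∈) with P , h , le ← shortcut w u x∈ =
    P , (λ { (_ ∷ ps) → h ps }) , ≤-trans le (m≤n+m _ (ℓ e))

  simplify : ∀ {x y} (w : Walk x y) →
             ∃ λ (P : Path x y) → (∀ {Q : Pred Edge 0ℓ} → All Q (walkEdges w) → P Within Q) × pathLength P ≤ walkLength w
  simplify []           = ([] , [] ∷ []) , id , ≤-refl
  simplify {x} (step e j w) with (w′ , u) , h , le ← simplify w with x ∈? vertices w′
  ... | yes x∈ with P , h′ , le′ ← shortcut w′ u x∈ =
    P , (λ { (_ ∷ ps) → h′ (h ps) }) , ≤-trans le′ (≤-trans le (m≤n+m _ (ℓ e)))
  ... | no x∉ = (step e j w′ , ¬Any⇒All¬ _ x∉ ∷ u) , (λ { (p ∷ ps) → p ∷ h ps }) , +-monoʳ-≤ (ℓ e) le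

  totalLength : ℕ
  totalLength = sum (List.map ℓ (allFin m))

  ℓ-≤-total : ∀ e → ℓ e ≤ totalLength
  ℓ-≤-total e = ≤-sum (∈-allFin e)
    where
    ≤-sum : ∀ {xs} → e ∈ xs → ℓ e ≤ sum (List.map ℓ xs)
    ≤-sum (here refl)         = m≤m+n _ _
    ≤-sum {x ∷ _} (there e∈) = ≤-trans (≤-sum e∈) (m≤n+m _ (ℓ x))

  -- Deliberately crude, charging `totalLength` to each of the distinct vertices: the bound is easy
  -- to compute and has few binary digits.
  path-≤ : ∀ {x y} (P : Path x y) → pathLength P ≤ n * totalLength
  path-≤ (w , u) = ≤-trans (go w) (*-monoˡ-≤ totalLength (≤-trans
    (unique-⊆⇒length-≤ {ys = allFin n} u (λ {v} _ → ∈-allFin v)) (≤-reflexive (length-tabulate {n = n} id))))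
    where
    go : ∀ {x y} (w : Walk x y) → walkLength w ≤ length (vertices w) * totalLength
    go []           = z≤n
    go (step e j w) = +-mono-≤ (ℓ-≤-total e) (go w)

  Distance-unique : ∀ {Q : Pred Edge 0ℓ} {x y c d} → Distance Q x y c → Distance Q x y d → c ≡ d
  Distance-unique ((P , PQ , refl) , c≤) ((P′ , PQ′ , refl) , d≤) = ≤-antisym (c≤ P′ PQ′) (d≤ P PQ)

  Reduced-to : List Edge → Pred Edge 0ℓ → Set
  Reduced-to S Q = ∀ e → Q e ⇔ e ∈ S

  module _ (far-enough : n * totalLength < far) where

    -- Any walk in `S` simplifies to a path shorter than `far`, so the value of `dist` cannot stand
    -- for infinity.
    walk⇒realized : ∀ {S x y} (w : Walk x y) → w inside S → Realized S x y (dist S x y)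
    walk⇒realized {S} {x} {y} w w∈ with dist-realized S x y
    ... | inj₂ r  = r
    ... | inj₁ le with P , h , _ ← simplify w =
      contradiction (≤-trans far-enough (≤-trans le (dist-≤ (proj₁ P) (h w∈)))) (<⇒≱ (s≤s (path-≤ P)))

    walk⇒Distance : ∀ {S Q x y} → Reduced-to S Q → (w : Walk x y) → w inside S → Distance Q x y (dist S x y)
    walk⇒Distance {S} S≡Q w w∈
      with w′ , w′∈ , eq ← walk⇒realized w w∈
      with P , h , le ← simplify w′ =
      (P , All.map (from (S≡Q _)) (h w′∈) , ≤-antisym (≤-trans le (≤-reflexive eq)) (dist-≤ (proj₁ P) (h w′∈))) ,
      (λ P′ P′Q → dist-≤ (proj₁ P′) (All.map (to (S≡Q _)) P′Q))
      where open Equivalence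

  -- Towards a root, the first edge of a shortest walk from a vertex; distinct
  -- vertices yield distinct edges.

  spanning⇒length-≥ : ∀ S → n * totalLength < far → (∀ x y → ∃ λ (w : Walk x y) → w inside S) → n ≤ suc (length S)
  spanning⇒length-≥ S far-enough conn = go n refl
    where
    module _ (r : Vertex) where
      parent : ∀ v → v ≢ r → ∃ λ f → f ∈ S × ∃ λ u → Joins f v u × dist S u r < dist S v r
      parent v v≢r with walk⇒realized far-enough (proj₁ (conn v r)) (proj₂ (conn v r))
      ... | [] , _ , _ = contradiction refl v≢r
      ... | step {v = u} f j w , f∈ ∷ w∈ , eq = f , f∈ , u , j ,
        ≤-trans (s≤s (dist-≤ w w∈)) (≤-trans (+-monoˡ-≤ (walkLength w) (ℓ≥1 f)) (≤-reflexive eq))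
      parent-injective : ∀ {v w} (v≢r : v ≢ r) (w≢r : w ≢ r) → proj₁ (parent v v≢r) ≡ proj₁ (parent w w≢r) → v ≡ w
      parent-injective v≢r w≢r eq with parent _ v≢r | parent _ w≢r
      ... | f , _ , u , j , lt | g , _ , u′ , j′ , lt′ with refl ← eq with j | j′
      ...   | inj₁ refl | inj₁ refl = refl
      ...   | inj₂ refl | inj₂ refl = refl
      -- One edge serving as first edge in both directions would make each of its ends closer to the
      -- root than the other.
      ...   | inj₁ refl | inj₂ refl = contradiction lt (<⇒≯ lt′)
      ...   | inj₂ refl | inj₁ refl = contradiction lt (<⇒≯ lt′)
    index-injective : ∀ {A : Set} {xs : List A} {x y} (p : x ∈ xs) (q : y ∈ xs) → Any.index p ≡ Any.index q → x ≡ y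
    index-injective (here refl) (here refl) _  = refl
    index-injective (there p)   (there q)   eq = index-injective p q (Fin.suc-injective eq)
    go : ∀ k → k ≡ n → n ≤ suc (length S)
    go zero    refl = z≤n
    -- Vertex `zero` serves as the root and `punchIn zero` lists the others; the positions of their
    -- edges in `S` give an injection into `Fin (length S)`.
    go (suc k) refl = s≤s (injective⇒≤ {f = f} λ {i} {j} eq →
      punchIn-injective zero i j (parent-injective zero (≢r i) (≢r j) (index-injective (proj₁ (proj₂ (par i))) (proj₁ (proj₂ (par j))) eq)))
      where
      ≢r : ∀ (i : Fin k) → punchIn zero i ≢ zero
      ≢r i = punchInᵢ≢i zero i
      par : ∀ (i : Fin k) → _
      par i = parent zero (punchIn zero i) (≢r i)
      f : Fin k → Fin (length S)
      f i = Any.index (proj₁ (proj₂ (par i)))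

-- Removable sets of edges

≥1⇒numerator : ∀ {α} → 1ℚ ℚ.≤ α → ↥ α ≡ ℤ.+ ∣ ↥ α ∣ × ↧ₙ α ≤ ∣ ↥ α ∣
≥1⇒numerator {ℚ.mkℚ (ℤ.+ a) d _} (ℚ.*≤* le) = refl , ℤ.drop‿+≤+ (subst₂ ℤ._≤_ (ℤ.*-identityˡ (ℤ.+ suc d)) (ℤ.*-identityʳ (ℤ.+ a)) le)
≥1⇒numerator {ℚ.mkℚ ℤ.-[1+ a ] d _} (ℚ.*≤* le) = contradiction (subst₂ ℤ._≤_ (ℤ.*-identityˡ (ℤ.+ suc d)) (ℤ.*-identityʳ ℤ.-[1+ a ]) le) λ ()

-- Clears denominators, so that the program only has to compare products of natural numbers.
≤α⇔ : ∀ α x y → 1ℚ ℚ.≤ α → (ℤ.+ x ℚ./ 1) ℚ.≤ α ℚ.* (ℤ.+ y ℚ./ 1) ⇔ ↧ₙ α * x ≤ ∣ ↥ α ∣ * y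
≤α⇔ α@(ℚ.mkℚ a d c) x y α≥1 = mk⇔
  (λ le → unᵘ (ℚᵘ.≤-respʳ-≃ rhs (ℚᵘ.≤-respˡ-≃ lhs (ℚ.toℚᵘ-mono-≤ le))))
  (λ le → ℚ.toℚᵘ-cancel-≤ (ℚᵘ.≤-respʳ-≃ (ℚᵘ.≃-sym rhs) (ℚᵘ.≤-respˡ-≃ (ℚᵘ.≃-sym lhs) (onᵘ le))))
  where
  lhs : toℚᵘ (ℤ.+ x ℚ./ 1) ℚᵘ.≃ mkℚᵘ (ℤ.+ x) 0
  lhs = ℚ.toℚᵘ-fromℚᵘ (mkℚᵘ (ℤ.+ x) 0)
  rhs : toℚᵘ (α ℚ.* (ℤ.+ y ℚ./ 1)) ℚᵘ.≃ mkℚᵘ a d ℚᵘ.* mkℚᵘ (ℤ.+ y) 0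
  rhs = ℚᵘ.≃-trans (ℚ.toℚᵘ-homo-* α (ℤ.+ y ℚ./ 1)) (ℚᵘ.*-congˡ {mkℚᵘ a d} (ℚ.toℚᵘ-fromℚᵘ (mkℚᵘ (ℤ.+ y) 0)))
  left : ℤ.+ x ℤ.* ℤ.+ (suc d * 1) ≡ ℤ.+ (suc d * x)
  left = trans (sym (ℤ.pos-* x (suc d * 1))) (cong ℤ.+_ (trans (cong (x *_) (*-identityʳ (suc d))) (*-comm x (suc d))))
  right : a ℤ.* ℤ.+ y ℤ.* ℤ.+ 1 ≡ ℤ.+ (∣ a ∣ * y)
  right = trans (ℤ.*-identityʳ (a ℤ.* ℤ.+ y)) (trans (cong (ℤ._* ℤ.+ y) (proj₁ (≥1⇒numerator α≥1))) (sym (ℤ.pos-* ∣ a ∣ y)))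
  unᵘ : mkℚᵘ (ℤ.+ x) 0 ℚᵘ.≤ mkℚᵘ a d ℚᵘ.* mkℚᵘ (ℤ.+ y) 0 → suc d * x ≤ ∣ a ∣ * y
  unᵘ (*≤* le) = ℤ.drop‿+≤+ (subst₂ ℤ._≤_ left right le)
  onᵘ : suc d * x ≤ ∣ a ∣ * y → mkℚᵘ (ℤ.+ x) 0 ℚᵘ.≤ mkℚᵘ a d ℚᵘ.* mkℚᵘ (ℤ.+ y) 0
  onᵘ le = *≤* (subst₂ ℤ._≤_ (sym left) (sym right) (ℤ.+≤+ le))

∈-filterᵇ⁺ : ∀ {A : Set} (g : A → Bool) {xs x} → x ∈ xs → T (g x) → x ∈ filterᵇ g xs
∈-filterᵇ⁺ g = ∈-filter⁺ (T? ∘ g)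

∈-filterᵇ⁻ : ∀ {A : Set} (g : A → Bool) {xs x} → x ∈ filterᵇ g xs → x ∈ xs × T (g x)
∈-filterᵇ⁻ g {xs} = ∈-filter⁻ (T? ∘ g) {xs = xs}

T-not⁺ : ∀ {b} → ¬ T b → T (not b)
T-not⁺ {false} _ = tt
T-not⁺ {true}  h = h tt

T-not⁻ : ∀ {b} → T (not b) → ¬ T b
T-not⁻ {false} _ ()

length-filterᵇ-not : ∀ {A : Set} (g : A → Bool) xs → length (filterᵇ (not ∘ g) xs) + length (filterᵇ g xs) ≡ length xs
length-filterᵇ-not g []       = refl
length-filterᵇ-not g (x ∷ xs) with g x
... | true  = trans (+-suc _ _) (cong suc (length-filterᵇ-not g xs))
... | false = cong suc (length-filterᵇ-not g xs)

module Removal (I : Instance) where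

  open Instance I

  p q far : ℕ
  p   = ∣ ↥ α ∣
  q   = ↧ₙ α
  far = suc (p * (n * sum (List.map ℓ (allFin m))))

  open Distances graph far public

  -- The stretch factor is p / q.  K and N consist of the kept and of the
  -- nontrivial edges, and feasible R means that removing R from K leaves a
  -- spanner.  As far exceeds p times every distance, vertices at infinite
  -- distance are never within the stretch.

  E K N : List Edge
  δ : Edge → ℕ
  settled : List Edge → Edge → Bool
  kept : Edge → Bool
  same : Edge → Edge → Bool
  without : List Edge → List Edge
  feasible : List Edge → Bool
  good : ℕ → ℕ → List Edge → Bool

  E = allFin m
  δ e = dist E (src e) (tgt e)
  settled S e = q * dist S (src e) (tgt e) ≤ᵇ p * δ e
  kept e = q * ℓ e ≤ᵇ p * δ e
  K = filterᵇ kept E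
  same e f = (Fin.toℕ (src e) ≡ᵇ Fin.toℕ (src f)) ∧ (Fin.toℕ (tgt e) ≡ᵇ Fin.toℕ (tgt f))
  without R = filterᵇ (λ e → not (any (same e) R)) K
  feasible R = all (settled (without R)) R
  N = filterᵇ (λ e → feasible (e ∷ [])) K
  good a b R = (a ≤ᵇ length R + b) ∧ feasible R

  q≤p : q ≤ p
  q≤p = proj₂ (≥1⇒numerator α≥1)

  instance
    q≢0 : NonZero q
    q≢0 = _
    p≢0 : NonZero p
    p≢0 = >-nonZero (≤-trans (>-nonZero⁻¹ q) q≤p)

  far-enough : n * totalLength < far
  far-enough = s≤s (m≤n*m _ p)

  -- The codes of edges carry no index, so edges are compared by their ends; the absence of parallel
  -- edges makes this exact.
  same⇔≡ : ∀ e f → T (same e f) ⇔ e ≡ f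
  same⇔≡ e f = mk⇔
    (λ t → let s , t = Equivalence.to T-∧ t in
      simple (cong₂ _,_ (Fin.toℕ-injective (≡ᵇ⇒≡ _ _ s)) (Fin.toℕ-injective (≡ᵇ⇒≡ _ _ t))))
    (λ { refl → Equivalence.from T-∧ (≡⇒≡ᵇ (Fin.toℕ (src e)) _ refl , ≡⇒≡ᵇ (Fin.toℕ (tgt e)) _ refl) })

  any-same⇔∈ : ∀ e R → T (any (same e) R) ⇔ e ∈ R
  any-same⇔∈ e R = mk⇔
    (λ t → Any.map (Equivalence.to (same⇔≡ e _)) (any⁻ (same e) R t))
    (λ e∈ → any⁺ (same e) (Any.map (Equivalence.from (same⇔≡ e _)) e∈))

  ∈-without⁺ : ∀ {e} R → e ∈ K → e ∉ R → e ∈ without R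
  ∈-without⁺ {e} R e∈ e∉ = ∈-filterᵇ⁺ (λ e → not (any (same e) R)) e∈ (T-not⁺ (e∉ ∘ Equivalence.to (any-same⇔∈ e R)))

  ∈-without⁻ : ∀ {e} R → e ∈ without R → e ∈ K × e ∉ R
  ∈-without⁻ {e} R e∈ with e∈K , t ← ∈-filterᵇ⁻ (λ e → not (any (same e) R)) {K} e∈ =
    e∈K , T-not⁻ t ∘ Equivalence.from (any-same⇔∈ e R)

  ∈-K⁺ : ∀ {e} → q * ℓ e ≤ p * δ e → e ∈ K
  ∈-K⁺ {e} le = ∈-filterᵇ⁺ kept (∈-allFin e) (≤⇒≤ᵇ le)

  ∈-K⁻ : ∀ {e} → e ∈ K → q * ℓ e ≤ p * δ e
  ∈-K⁻ e∈ = ≤ᵇ⇒≤ _ _ (proj₂ (∈-filterᵇ⁻ kept {E} e∈))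

  inside-E : ∀ {x y} (w : Walk x y) → w inside E
  inside-E w = All.universal (λ e → ∈-allFin e) (walkEdges w)

  E-all : Reduced-to E U
  E-all e = mk⇔ (λ _ → ∈-allFin e) (λ _ → tt)

  Distance-E : ∀ x y → Distance U x y (dist E x y)
  Distance-E x y = let w = proj₁ (connected x y) in walk⇒Distance far-enough E-all w (inside-E w)

  Distance-E≡ : ∀ {x y d} → Distance U x y d → d ≡ dist E x y
  Distance-E≡ D = Distance-unique D (Distance-E _ _)

  ≤α⇒ : ∀ {x y} → x ≤α· y → q * x ≤ p * y
  ≤α⇒ {x} {y} = Equivalence.to (≤α⇔ α x y α≥1)

  ⇒≤α : ∀ {x y} → q * x ≤ p * y → x ≤α· y
  ⇒≤α {x} {y} = Equivalence.from (≤α⇔ α x y α≥1)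

  Kept⇔∈K : ∀ e → Kept e ⇔ e ∈ K
  Kept⇔∈K e = mk⇔ (λ { (d , D , le) → ∈-K⁺ (subst (λ d → q * ℓ e ≤ p * d) (Distance-E≡ D) (≤α⇒ le)) })
                  (λ e∈ → δ e , Distance-E _ _ , ⇒≤α (∈-K⁻ e∈))

  δ≤ℓ : ∀ e → δ e ≤ ℓ e
  δ≤ℓ e = ≤-trans (dist-≤ (step e (inj₁ refl) []) (inside-E (step e (inj₁ refl) []))) (≤-reflexive (+-identityʳ (ℓ e)))

  Shortened : List Edge → ∀ {x y} → ℕ → Set
  Shortened S {x} {y} b = ∃ λ (w : Walk x y) → w inside S × q * walkLength w ≤ b

  -- At infinite distance the test fails: `δ e` is at most `ℓ e`, which keeps `p * δ e` below `far`.
  settled⇒walk : ∀ S {e x y} → T (settled S e) → Joins e x y → Shortened S {x} {y} (p * δ e)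
  settled⇒walk S {e} {x} {y} t j with dist-realized S x y
  ... | inj₂ (w , w∈ , eq) = w , w∈ , ≤-trans (≤-reflexive (cong (q *_) (trans eq (dist-joins S j)))) (≤ᵇ⇒≤ _ _ t)
  ... | inj₁ le = contradiction (begin-strict
    p * δ e                       ≤⟨ *-monoʳ-≤ p (≤-trans (δ≤ℓ e) (≤-trans (ℓ-≤-total e) (m≤n*m totalLength n))) ⟩
    p * (n * totalLength)         <⟨ n<1+n _ ⟩
    far                           ≤⟨ m≤n*m far q ⟩
    q * far                       ≤⟨ *-monoʳ-≤ q le ⟩
    q * dist S x y                ≡⟨ cong (q *_) (dist-joins S j) ⟩
    q * dist S (src e) (tgt e)    ≤⟨ ≤ᵇ⇒≤ _ _ t ⟩
    p * δ e                       ∎) (<-irrefl refl)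
    where open ≤-Reasoning

  walk⇒settled : ∀ S {e} (w : Walk (src e) (tgt e)) → w inside S → q * walkLength w ≤ p * δ e → T (settled S e)
  walk⇒settled S w w∈ le = ≤⇒≤ᵇ (≤-trans (*-monoʳ-≤ q (dist-≤ w w∈)) le)

  settled-⊆ : ∀ S S′ {e} → (∀ {f} → f ∈ S → f ∈ S′) → T (settled S e) → T (settled S′ e)
  settled-⊆ S S′ {e} S⊆S′ t with w , w∈ , le ← settled⇒walk S {e} t (inj₁ refl) =
    walk⇒settled S′ w (All.map S⊆S′ w∈) le

  Spans : List Edge → List Edge → Set
  Spans S S′ = ∀ {x y} (w : Walk x y) → w inside S → Shortened S′ {x} {y} (p * walkLength w)

  -- Concatenating the replacements of single edges preserves the factor `p / q`, which is why
  -- spanners may be checked on edges alone.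
  edgewise : ∀ {S S′} → (∀ {e x y} → e ∈ S → Joins e x y → Shortened S′ {x} {y} (p * ℓ e)) → Spans S S′
  edgewise h []           _         = [] , [] , ≤-trans (≤-reflexive (*-zeroʳ q)) z≤n
  edgewise h (step e j w) (e∈ ∷ w∈)
    with v , v∈ , le ← h e∈ j | w′ , w′∈ , le′ ← edgewise h w w∈ =
    v ⊕ w′ , ⊕-All v w′ v∈ w′∈ , (begin
      q * walkLength (v ⊕ w′)                 ≡⟨ cong (q *_) (⊕-length v w′) ⟩
      q * (walkLength v + walkLength w′)      ≡⟨ *-distribˡ-+ q (walkLength v) (walkLength w′) ⟩
      q * walkLength v + q * walkLength w′    ≤⟨ +-mono-≤ le le′ ⟩
      p * ℓ e + p * walkLength w              ≡⟨ *-distribˡ-+ p (ℓ e) (walkLength w) ⟨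
      p * (ℓ e + walkLength w)                ∎)
    where open ≤-Reasoning

  -- An edge outside K is longer than a detour around it.

  bypass : ∀ S → (∀ e → T (settled S e)) → ∀ {x y} (w : Walk x y) → w inside S →
           ∃ λ (w′ : Walk x y) → All (λ e → e ∈ S × e ∈ K) (walkEdges w′) × walkLength w′ ≤ walkLength w
  -- A detour may again contain edges outside `K`. Since each replacement makes the whole walk
  -- strictly shorter, induction runs on the length and not on the walk.
  bypass S h {x} {y} w w∈ = <-rec P go (walkLength w) w w∈ refl
    where
    P : ℕ → Set
    P k = ∀ {x y} (w : Walk x y) → w inside S → walkLength w ≡ k →
          ∃ λ (w′ : Walk x y) → All (λ e → e ∈ S × e ∈ K) (walkEdges w′) × walkLength w′ ≤ walkLength w
    shorter : ∀ {e x y z} (v : Walk x y) (w : Walk y z) → e ∉ K → q * walkLength v ≤ p * δ e →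
              walkLength (v ⊕ w) < ℓ e + walkLength w
    shorter v w e∉K le = ≤-trans (s≤s (≤-reflexive (⊕-length v w)))
      (+-monoˡ-≤ (walkLength w) (*-cancelˡ-< q _ _ (≤-<-trans le (≰⇒> (e∉K ∘ ∈-K⁺)))))
    go : ∀ k → (∀ {j} → j < k → P j) → P k
    go k ih []           []        eq = [] , [] , z≤n
    go k ih (step e j w) (e∈ ∷ w∈) refl with e ∈? K
    ... | yes e∈K with w′ , w′∈ , le ← ih (+-monoˡ-≤ (walkLength w) (ℓ≥1 e)) w w∈ refl =
      step e j w′ , (e∈ , e∈K) ∷ w′∈ , +-monoʳ-≤ (ℓ e) le
    ... | no e∉K with v , v∈ , le ← settled⇒walk S {e} (h e) j
      with w′ , w′∈ , le′ ← ih (shorter v w e∉K le) (v ⊕ w) (⊕-All v w v∈ w∈) refl =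
      w′ , w′∈ , ≤-trans le′ (<⇒≤ (shorter v w e∉K le))

  settled-E : ∀ e → T (settled E e)
  settled-E e = ≤⇒≤ᵇ (*-monoˡ-≤ (δ e) q≤p)

  feasible⇒settled : ∀ {R e} → T (feasible R) → e ∈ R → T (settled (without R) e)
  feasible⇒settled {R} t e∈ = All.lookup (all⁺ (settled (without R)) R t) e∈

  settled⇒feasible : ∀ {R} → (∀ {e} → e ∈ R → T (settled (without R) e)) → T (feasible R)
  settled⇒feasible {R} h = all⁻ (settled (without R)) (All.tabulate h)

  -- Edges that do not settle themselves are first avoided by `bypass`, at no extra length. Only
  -- edges of `K` are left, and of these only the ones in `R` need a replacement, so the stretch is
  -- paid once.
  feasible⇒spans : ∀ {R} → T (feasible R) → Spans E (without R)
  feasible⇒spans {R} t w w∈ =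
    let v , v∈ , le    = bypass E settled-E w w∈
        w′ , w′∈ , le′ = edgewise {K} {without R} replace v (All.map proj₂ v∈)
    in w′ , w′∈ , ≤-trans le′ (*-monoʳ-≤ p le)
    where
    replace : ∀ {e x y} → e ∈ K → Joins e x y → Shortened (without R) {x} {y} (p * ℓ e)
    replace {e} e∈K j with e ∈? R
    ... | no e∉R  = step e j [] , ∈-without⁺ R e∈K e∉R ∷ [] , *-mono-≤ q≤p (≤-reflexive (+-identityʳ (ℓ e)))
    ... | yes e∈R with w , w∈ , le ← settled⇒walk (without R) {e} (feasible⇒settled {R} t e∈R) j =
      w , w∈ , ≤-trans le (*-monoʳ-≤ p (δ≤ℓ e))

  spans⇒IsSpanner : ∀ {S Q} → Reduced-to S Q → Spans E S → IsSpanner Q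
  spans⇒IsSpanner {S} S≡Q sp u v
    with w , w∈ , eq ← walk⇒realized far-enough (proj₁ (connected u v)) (inside-E _)
    with w′ , w′∈ , le ← sp w w∈ =
    dist S u v , dist E u v , walk⇒Distance far-enough S≡Q w′ w′∈ , Distance-E u v ,
    ⇒≤α (≤-trans (*-monoʳ-≤ q (dist-≤ w′ w′∈)) (≤-trans le (≤-reflexive (cong (p *_) eq))))

  IsSpanner⇒settled : ∀ {S Q} → Reduced-to S Q → IsSpanner Q → ∀ e → T (settled S e)
  IsSpanner⇒settled {S} S≡Q sp e
    with d , d′ , ((P , PQ , refl) , _) , D , le ← sp (src e) (tgt e) =
    walk⇒settled S (proj₁ P) (All.map (Equivalence.to (S≡Q _)) PQ)
      (subst (λ d → q * pathLength P ≤ p * d) (Distance-E≡ D) (≤α⇒ le))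

-- Solutions of the two problems and the effect of tightness

module Solutions (I : Instance) where

  open Instance I
  open Removal I

  K-unique : Unique K
  K-unique = filter⁺ (T? ∘ kept) (allFin⁺ m)

  N-unique : Unique N
  N-unique = filter⁺ (λ e → T? (feasible (e ∷ []))) K-unique

  Suitable : List Edge → Set
  Suitable xs = Unique xs × (∀ {e} → e ∈ xs → e ∈ N)

  suitable-tail : ∀ {x xs} → Suitable (x ∷ xs) → Suitable xs
  suitable-tail (_ ∷ u , xs⊆N) = u , xs⊆N ∘ there

  suitable⇒length-≤ : ∀ {xs} → Suitable xs → length xs ≤ m
  suitable⇒length-≤ (u , _) = ≤-trans (unique-⊆⇒length-≤ {ys = E} u (λ {e} _ → ∈-allFin e))
    (≤-reflexive (length-tabulate {n = m} id))

  ∈-N⁺ : ∀ {e} → e ∈ K → T (settled (without (e ∷ [])) e) → e ∈ N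
  ∈-N⁺ {e} e∈K t = ∈-filterᵇ⁺ (λ e → feasible (e ∷ [])) e∈K (settled⇒feasible {e ∷ []} λ { (here refl) → t })

  ∈-N⁻ : ∀ {e} → e ∈ N → e ∈ K × T (settled (without (e ∷ [])) e)
  ∈-N⁻ {e} e∈ with e∈K , t ← ∈-filterᵇ⁻ (λ e → feasible (e ∷ [])) {K} e∈ = e∈K , feasible⇒settled {e ∷ []} t (here refl)

  N⊆K : ∀ {e} → e ∈ N → e ∈ K
  N⊆K = proj₁ ∘ ∈-N⁻

  settling⇒settled : ∀ {e R} (P : Path (src e) (tgt e)) → Settling P → P Within (_∉ R) → T (settled (without R) e)
  settling⇒settled {e} {R} P (PK , d , D , le) P∉R = walk⇒settled (without R) (proj₁ P)
    (All.zipWith (λ (k , f∉R) → ∈-without⁺ R (Equivalence.to (Kept⇔∈K _) k) f∉R) (PK , P∉R))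
    (subst (λ d → q * pathLength P ≤ p * d) (Distance-E≡ D) (≤α⇒ le))

  settled⇒settling : ∀ {e R} → T (settled (without R) e) →
                     ∃ λ (P : Path (src e) (tgt e)) → Settling P × P Within (_∉ R)
  settled⇒settling {e} {R} t =
    let w , w∈ , le = settled⇒walk (without R) {e} t (inj₁ refl)
        P , h , le′ = simplify w
    in P , (h (All.map (λ {f} f∈ → Equivalence.from (Kept⇔∈K f) (proj₁ (∈-without⁻ R f∈))) w∈) ,
            δ e , Distance-E (src e) (tgt e) , ⇒≤α (≤-trans (*-monoʳ-≤ q le′) le)) ,
       h (All.map (λ f∈ → proj₂ (∈-without⁻ R f∈)) w∈)

  alternative⇔ : ∀ {e} (P : Path (src e) (tgt e)) → Alternative e P ⇔ P Within (_∉ (e ∷ []))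
  alternative⇔ {e} P = mk⇔
    (λ e∉ → All.tabulate λ { f∈ (here refl) → e∉ f∈ })
    (λ h e∈ → All.lookup h e∈ (here refl))

  -- An alternative settling path is a short enough path in `K` without `e`, and its existence is
  -- what `feasible (e ∷ [])` tests.
  Nontrivial⇔∈N : ∀ e → Nontrivial e ⇔ e ∈ N
  Nontrivial⇔∈N e = mk⇔ to from
    where
    to : Nontrivial e → e ∈ N
    -- Being nontrivial only refutes that no alternative path exists. The test is decidable, so the
    -- double negation can be removed.
    to (k , ¬triv) = ∈-N⁺ (Equivalence.to (Kept⇔∈K e) k) (decidable-stable (T? _) λ ¬t →
      ¬triv (k , λ (P , s , a) → ¬t (settling⇒settled {e} {e ∷ []} P s (Equivalence.to (alternative⇔ P) a))))
    from : e ∈ N → Nontrivial e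
    from e∈ =
      let e∈K , t   = ∈-N⁻ e∈
          P , s , a = settled⇒settling {e} {e ∷ []} t
      in Equivalence.from (Kept⇔∈K e) e∈K , λ (_ , mandatory) → mandatory (P , s , Equivalence.from (alternative⇔ P) a)

  -- Repeated or foreign edges in `R` only enlarge the right-hand side, so this direction holds for
  -- every list; the reverse one requires a set of kept edges.
  length-K-≤ : ∀ R → length K ≤ length (without R) + length R
  length-K-≤ R = ≤-trans (≤-reflexive (sym (length-filterᵇ-not (λ e → any (same e) R) K)))
    (+-monoʳ-≤ (length (without R)) (unique-⊆⇒length-≤ (filter⁺ (λ e → T? (any (same e) R)) K-unique)
      (λ e∈ → Equivalence.to (any-same⇔∈ _ R) (proj₂ (∈-filterᵇ⁻ (λ e → any (same e) R) {K} e∈)))))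

  length-K-≥ : ∀ R → Unique R → (∀ {e} → e ∈ R → e ∈ K) → length (without R) + length R ≤ length K
  length-K-≥ R u R⊆K = ≤-trans
    (+-monoʳ-≤ (length (without R)) (unique-⊆⇒length-≤ u
      (λ e∈ → ∈-filterᵇ⁺ (λ e → any (same e) R) (R⊆K e∈) (Equivalence.from (any-same⇔∈ _ R) e∈))))
    (≤-reflexive (length-filterᵇ-not (λ e → any (same e) R) K))

  -- A kept edge outside a spanner S ⊆ K is nontrivial, so S arises from K by
  -- removing nontrivial edges.

  module Complement (S : List Edge) (S⊆K : ∀ {e} → e ∈ S → e ∈ K) (S-settled : ∀ e → T (settled S e)) where

    removed : List Edge
    removed = filterᵇ (λ e → not (any (same e) S)) N

    ∉S⇒∈N : ∀ {e} → e ∈ K → e ∉ S → e ∈ N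
    ∉S⇒∈N {e} e∈K e∉S = ∈-N⁺ e∈K (settled-⊆ S (without (e ∷ [])) {e}
      (λ f∈ → ∈-without⁺ (e ∷ []) (S⊆K f∈) λ { (here refl) → e∉S f∈ }) (S-settled e))

    ∈-removed⁺ : ∀ {e} → e ∈ N → e ∉ S → e ∈ removed
    ∈-removed⁺ {e} e∈ e∉ = ∈-filterᵇ⁺ (λ e → not (any (same e) S)) e∈ (T-not⁺ (e∉ ∘ Equivalence.to (any-same⇔∈ e S)))

    ∈-removed⁻ : ∀ {e} → e ∈ removed → e ∉ S
    ∈-removed⁻ {e} e∈ = T-not⁻ (proj₂ (∈-filterᵇ⁻ (λ e → not (any (same e) S)) {N} e∈)) ∘ Equivalence.from (any-same⇔∈ e S)

    removed-feasible : T (feasible removed)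
    removed-feasible = settled⇒feasible {removed} λ {e} _ →
      settled-⊆ S (without removed) {e} (λ f∈ → ∈-without⁺ removed (S⊆K f∈) (λ f∈R → ∈-removed⁻ f∈R f∈)) (S-settled e)

    without-removed⊆S : ∀ {e} → e ∈ without removed → e ∈ S
    without-removed⊆S {e} e∈ with e∈K , e∉R ← ∈-without⁻ removed e∈ with e ∈? S
    ... | yes e∈S = e∈S
    ... | no e∉S  = contradiction (∈-removed⁺ (∉S⇒∈N e∈K e∉S) e∉S) e∉R

    removed∈subs : removed ∈ subs N
    removed∈subs = filterᵇ∈subs (λ e → not (any (same e) S)) N

  feasible⇒IsSpanner : ∀ {R Q} → T (feasible R) → Reduced-to (without R) Q → IsSpanner Q
  feasible⇒IsSpanner {R} t red = spans⇒IsSpanner red (feasible⇒spans {R} t)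

  -- One condition without subtraction for both problems: `a = ϱ` and `b = 0` for a removal,
  -- `a = length K` and `b = W` for a spanner.
  Solvable : ℕ → ℕ → Set
  Solvable a b = ∃ λ R → R ∈ subs N × a ≤ length R + b × T (feasible R)

  solvable⇔ : ∀ a b → T (any (good a b) (subs N)) ⇔ Solvable a b
  solvable⇔ a b = mk⇔
    (λ t → let R , R∈ , g = find (any⁻ (good a b) (subs N) t) ; le , f = Equivalence.to T-∧ g in R , R∈ , ≤ᵇ⇒≤ _ _ le , f)
    (λ (R , R∈ , le , f) → any⁺ (good a b) (Any.map (λ { refl → Equivalence.from T-∧ (≤⇒≤ᵇ le , f) }) R∈))

  solvable⇒spanner : Solvable (length K) W → ParameterizedProblem.Yes Spanner I
  solvable⇒spanner (R , R∈ , le , f) = F , feasible⇒IsSpanner {R} f F-red , ≤-trans F≤ (+-cancelʳ-≤ (length R) _ _ (begin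
      length (without R) + length R ≤⟨ length-K-≥ R (subs-unique N-unique R∈) (N⊆K ∘ subs-⊆ N R∈) ⟩
      length K                      ≤⟨ le ⟩
      length R + W                  ≡⟨ +-comm (length R) W ⟩
      W + length R                  ∎))
    where
    open ≤-Reasoning
    F : Subset m
    F = fromList (without R)
    F-red : Reduced-to (without R) (Subset._∈ F)
    F-red e = mk⇔ ∈-fromList⁻ ∈-fromList⁺
    F≤ : Subset.∣ F ∣ ≤ length (without R)
    F≤ = ≤-trans (≤-reflexive (sym (length-elements F)))
      (unique-⊆⇒length-≤ {ys = without R} (filter⁺ (Subset._∈? F) (allFin⁺ m)) (∈-fromList⁻ ∘ ∈-elements⁻))

  -- `F` may contain edges outside `K`. By `bypass` its part inside `K` still settles every edge,
  -- and the complement of that part is a removal.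
  spanner⇒solvable : ParameterizedProblem.Yes Spanner I → Solvable (length K) W
  spanner⇒solvable (F , sp , F≤W) = removed , removed∈subs , le , removed-feasible
    where
    F-settled : ∀ e → T (settled (elements F) e)
    F-settled = IsSpanner⇒settled (λ e → mk⇔ ∈-elements⁺ ∈-elements⁻) sp
    S : List Edge
    S = filterᵇ kept (elements F)
    S-settled : ∀ e → T (settled S e)
    S-settled e =
      let w , w∈ , le = settled⇒walk (elements F) {e} (F-settled e) (inj₁ refl)
          v , v∈ , le′ = bypass (elements F) F-settled w w∈
      in walk⇒settled S v (All.map (λ (f∈F , f∈K) → ∈-filterᵇ⁺ kept f∈F (proj₂ (∈-filterᵇ⁻ kept {E} f∈K))) v∈)
           (≤-trans (*-monoʳ-≤ q le′) le)
    S⊆K : ∀ {e} → e ∈ S → e ∈ K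
    S⊆K {e} e∈ = ∈-filterᵇ⁺ kept (∈-allFin e) (proj₂ (∈-filterᵇ⁻ kept {elements F} e∈))
    open Complement S S⊆K S-settled
    le : length K ≤ length removed + W
    le = begin
      length K                                 ≤⟨ length-K-≤ removed ⟩
      length (without removed) + length removed ≤⟨ +-monoˡ-≤ _ (unique-⊆⇒length-≤ (filter⁺ (λ e → T? (not (any (same e) removed))) K-unique)
                                                    (λ e∈ → proj₁ (∈-filterᵇ⁻ kept {elements F} (without-removed⊆S e∈)))) ⟩
      length (elements F) + length removed     ≡⟨ cong (_+ length removed) (length-elements F) ⟩
      Subset.∣ F ∣ + length removed            ≤⟨ +-monoˡ-≤ _ F≤W ⟩
      W + length removed                       ≡⟨ +-comm W _ ⟩
      length removed + W                       ∎
      where open ≤-Reasoning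

  solvable⇒removal : ∀ {ϱ} → Solvable ϱ 0 → ParameterizedProblem.Yes NontrivialRemoval (I , ϱ)
  solvable⇒removal {ϱ} (R , R∈ , le , f) =
    fromList R ,
    (λ e e∈ → Equivalence.from (Nontrivial⇔∈N e) (subs-⊆ N R∈ (∈-fromList⁻ e∈))) ,
    ≤-trans le (≤-trans (≤-reflexive (+-identityʳ _)) (≤-trans
      (unique-⊆⇒length-≤ {ys = elements (fromList R)} (subs-unique N-unique R∈) (∈-elements⁺ ∘ ∈-fromList⁺))
      (≤-reflexive (length-elements (fromList R))))) ,
    feasible⇒IsSpanner {R} f (λ e → mk⇔
      (λ (k , e∉) → ∈-without⁺ R (Equivalence.to (Kept⇔∈K e) k) (e∉ ∘ ∈-fromList⁺))
      (λ e∈ → let e∈K , e∉R = ∈-without⁻ R e∈ in Equivalence.from (Kept⇔∈K e) e∈K , e∉R ∘ ∈-fromList⁻))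

  -- `R` is replaced by the complement of what it leaves behind. This contains `R` and, being a
  -- filter of `N`, belongs to `subs N`.
  removal⇒solvable : ∀ {ϱ} → ParameterizedProblem.Yes NontrivialRemoval (I , ϱ) → Solvable ϱ 0
  removal⇒solvable {ϱ} (R , nontrivial , ϱ≤ , sp) = removed , removed∈subs , le , removed-feasible
    where
    S : List Edge
    S = without (elements R)
    S⊆K : ∀ {e} → e ∈ S → e ∈ K
    S⊆K e∈ = proj₁ (∈-without⁻ (elements R) e∈)
    S-settled : ∀ e → T (settled S e)
    S-settled = IsSpanner⇒settled (λ e → mk⇔
      (λ (k , e∉) → ∈-without⁺ (elements R) (Equivalence.to (Kept⇔∈K e) k) (e∉ ∘ ∈-elements⁻))
      (λ e∈ → let e∈K , e∉R = ∈-without⁻ (elements R) e∈ in Equivalence.from (Kept⇔∈K e) e∈K , e∉R ∘ ∈-elements⁺)) sp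
    open Complement S S⊆K S-settled
    le : ϱ ≤ length removed + 0
    le = begin
      ϱ                   ≤⟨ ϱ≤ ⟩
      Subset.∣ R ∣        ≡⟨ length-elements R ⟨
      length (elements R) ≤⟨ unique-⊆⇒length-≤ (filter⁺ (Subset._∈? R) (allFin⁺ m)) (λ e∈ →
                              ∈-removed⁺ (Equivalence.to (Nontrivial⇔∈N _) (nontrivial _ (∈-elements⁻ e∈)))
                                         (λ e∈S → proj₂ (∈-without⁻ (elements R) e∈S) e∈)) ⟩
      length removed      ≡⟨ +-identityʳ _ ⟨
      length removed + 0  ∎
      where open ≤-Reasoning

  feasible⇒length-≤-φ : ∀ {R} → Unique R → (∀ {e} → e ∈ R → e ∈ N) → T (feasible R) → length R ≤ φ
  feasible⇒length-≤-φ {R} uR R⊆N f = ≤-trans (≤-reflexive (sym (m+n∸n≡m (length R) n))) (∸-monoˡ-≤ n (begin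
      length R + n                        ≤⟨ +-monoʳ-≤ (length R) (spanning⇒length-≥ (without R) far-enough conn) ⟩
      length R + suc (length (without R)) ≡⟨ trans (+-suc (length R) _) (cong suc (+-comm (length R) _)) ⟩
      suc (length (without R) + length R) ≤⟨ s≤s (length-K-≥ R uR (N⊆K ∘ R⊆N)) ⟩
      suc (length K)                      ≤⟨ s≤s (unique-⊆⇒length-≤ {ys = E} K-unique (λ {e} _ → ∈-allFin e)) ⟩
      suc (length E)                      ≡⟨ cong suc (length-tabulate {n = m} id) ⟩
      suc m                               ∎))
    where
    open ≤-Reasoning
    conn : ∀ x y → ∃ λ (w : Walk x y) → w inside without R
    conn x y with w , w∈ , _ ← feasible⇒spans {R} f (proj₁ (connected x y)) (inside-E _) = w , w∈

  module _ {τ : ℕ} (tight : Tightness τ) where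

    private
      Nₛ : Subset m
      Nₛ = proj₁ tight
      Nₛ-Nontrivial : ∀ e → e Subset.∈ Nₛ ⇔ Nontrivial e
      Nₛ-Nontrivial = proj₁ (proj₂ tight)
      ≤τ : ∀ e A → Critical e → TightestAlternative Nₛ e A → ∣ A ∩ Nₛ ∣ ≤ τ
      ≤τ = proj₁ (proj₂ (proj₂ tight))

    -- If there were no such path, `e` would be critical. A shortest descent would then end in a
    -- tightest alternative path, which tightness bounds by `τ`.
    tight-alternative : ∀ {e} → e ∈ N →
                        ¬ ¬ ∃ λ (P : Path (src e) (tgt e)) → Settling P × Alternative e P × ∣ P ∩ Nₛ ∣ ≤ τ
    tight-alternative {e} e∈N none = ¬below _ P₀ s₀ (Equivalence.from (alternative⇔ P₀) a₀) refl
      where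
      nontrivial : Nontrivial e
      nontrivial = Equivalence.from (Nontrivial⇔∈N e) e∈N
      trivial⇒0 : ∀ (P : Path (src e) (tgt e)) → P Within Trivial → ∣ P ∩ Nₛ ∣ ≡ 0
      trivial⇒0 P t = cong length (filter-none (Subset._∈? Nₛ) (All.map (λ t f∈ → proj₂ (Equivalence.to (Nₛ-Nontrivial _) f∈) t) t))
      -- A path of trivial edges avoids the nontrivial `e` and meets no nontrivial edge at all, so
      -- it would refute `none`.
      critical : Critical e
      critical = proj₁ nontrivial , λ (P , s , t) →
        none (P , s , (λ e∈ → proj₂ nontrivial (All.lookup t e∈)) , ≤-trans (≤-reflexive (trivial⇒0 P t)) z≤n)
      -- Induction on the number of nontrivial edges: if all smaller numbers are excluded, `P` is a
      -- tightest alternative, and `≤τ` contradicts `none`. The path `P₀`, which exists because `e`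
      -- is nontrivial, then gives the contradiction.
      ¬below : ∀ k (P : Path (src e) (tgt e)) → Settling P → Alternative e P → ¬ ∣ P ∩ Nₛ ∣ ≡ k
      ¬below = <-rec (λ k → ∀ (P : Path (src e) (tgt e)) → Settling P → Alternative e P → ¬ ∣ P ∩ Nₛ ∣ ≡ k)
        λ { k ih P s a refl → none (P , s , a , ≤τ e P critical (s , a , λ P′ s′ a′ →
          ≮⇒≥ λ lt → ih lt P′ s′ a′ refl)) }
      base = settled⇒settling {e} {e ∷ []} (proj₂ (∈-N⁻ e∈N))
      P₀ : Path (src e) (tgt e)
      P₀ = proj₁ base
      s₀ : Settling P₀
      s₀ = proj₁ (proj₂ base)
      a₀ : P₀ Within (_∉ (e ∷ []))
      a₀ = proj₂ (proj₂ base)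

    -- Removing e together with edges outside C keeps e settled.

    Conflicts : Edge → List Edge → Set
    Conflicts e C = length C ≤ τ × e ∉ C ×
      (∀ R → (∀ {f} → f ∈ R → f ∈ N) → (∀ {f} → f ∈ R → f ∉ C) → T (settled (without R) e))

    -- The premise `e ∈ N` stands inside the existential so that a list is assigned to every edge,
    -- as the finite double-negation shift requires.
    conflicts : ∀ e → ¬ ¬ ∃ λ C → e ∈ N → Conflicts e C
    -- The empty list is offered first. It can only be used by supplying `e ∈ N`, and at that moment
    -- the list of the nontrivial edges on a path is offered instead.
    conflicts e k = k ([] , λ e∈N → contradiction (λ (P , s , a , le) → k (filter (Subset._∈? Nₛ) (edges P) , λ _ →
      le , (λ e∈ → a (proj₁ (∈-filter⁻ (Subset._∈? Nₛ) {xs = edges P} e∈))) , settled-outside P s))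
      (tight-alternative e∈N))
      where
      settled-outside : ∀ (P : Path (src e) (tgt e)) → Settling P → ∀ R → (∀ {f} → f ∈ R → f ∈ N) →
                        (∀ {f} → f ∈ R → f ∉ filter (Subset._∈? Nₛ) (edges P)) → T (settled (without R) e)
      -- An edge of `P` that lies in `R` is nontrivial, hence among the filtered edges, which `R`
      -- avoids; so `P` survives the removal.
      settled-outside P s R R⊆N R∩C = settling⇒settled {e} {R} P s (All.tabulate λ {f} f∈P f∈R → R∩C f∈R
        (∈-filter⁺ (Subset._∈? Nₛ) {xs = edges P} f∈P
          (Equivalence.from (Nₛ-Nontrivial f) (Equivalence.from (Nontrivial⇔∈N f) (R⊆N f∈R)))))

    many⇒feasible : ∀ k L → Unique L → (∀ {e} → e ∈ L → e ∈ N) → k * suc (τ + τ) ≤ length L →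
                    ¬ ¬ ∃ λ R → R ∈ subs L × k ≤ length R × T (feasible R)
    many⇒feasible k L uL L⊆N le none = ¬¬-∀ conflicts λ h →
      let C = λ e → proj₁ (h e)
          R , R⊆L , uR , |R| , ind = independent-set C τ k L uL le
            (λ {e} e∈ → let c≤ , e∉ , _ = proj₂ (h e) (L⊆N e∈) in c≤ , e∉)
          -- The independent set comes in an order of its own; as a filter of `L` it becomes a
          -- member of `subs L`.
          R′ = filterᵇ (λ e → any (same e) R) L
          R′⊆R : ∀ {e} → e ∈ R′ → e ∈ R
          R′⊆R = λ {e} e∈ → Equivalence.to (any-same⇔∈ e R) (proj₂ (∈-filterᵇ⁻ (λ e → any (same e) R) {L} e∈))
          R⊆R′ : ∀ {e} → e ∈ R → e ∈ R′
          R⊆R′ = λ {e} e∈ → ∈-filterᵇ⁺ (λ e → any (same e) R) (R⊆L e∈) (Equivalence.from (any-same⇔∈ e R) e∈)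
      in none (R′ , filterᵇ∈subs (λ e → any (same e) R) L ,
               ≤-trans (≤-reflexive (sym |R|)) (unique-⊆⇒length-≤ uR R⊆R′) ,
               settled⇒feasible {R′} λ {e} e∈ → proj₂ (proj₂ (proj₂ (h e) (L⊆N (R⊆L (R′⊆R e∈))))) R′
                 (λ f∈ → L⊆N (R⊆L (R′⊆R f∈))) (λ f∈ → ind (R′⊆R e∈) (R′⊆R f∈)))

-- The search as a term

module _ {n : ℕ} where

  srcT tgtT lenT : Tm n → Tm n
  srcT e = fst e
  tgtT e = fst (snd e)
  lenT e = snd (snd e)

  keptT keysT farT distT ratioT : Tm n → Tm n
  keptT g  = fst g
  keysT g  = fst (snd g)
  farT g   = fst (snd (snd g))
  distT g  = fst (snd (snd (snd g)))
  ratioT g = snd (snd (snd (snd g)))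

  orderT edgesT numeratorT denominatorT weightT : Tm n → Tm n
  orderT i       = fst i
  edgesT i       = fst (snd i)
  numeratorT i   = fst (snd (snd i))
  denominatorT i = fst (snd (snd (snd i)))
  weightT i      = fst (snd (snd (snd (snd i))))

opaque

  -- Distance tables are indexed by the ends of edges and not by all vertices, so the binary number
  -- `n` is never counted up to. Repeated keys hold equal entries.
  endpoints : Tm 1
  endpoints = fold x0 nil (cons (srcT x1) (cons (tgtT x1) x0))

  pairs : Tm 1
  pairs = fold x0 nil (app append (mapT x5 (cons x6 x1) ∷ x0 ∷ []))

  initial : Tm 2
  initial = mapT x0 (cons x1 (case (app equal (fst x1 ∷ snd x1 ∷ [])) x6 nil))

  lookupT : Tm 3
  lookupT = fold x2 nil
    (case (case (app equal (x5 ∷ fst (fst x1) ∷ [])) nil (app equal (x8 ∷ snd (fst x3) ∷ []))) x0 (snd x3))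

  via : Tm 3 → Tm 3 → Tm 3
  via a b = app add (app lookupT (fst (fst x0) ∷ a ∷ x2 ∷ []) ∷
                     app add (lenT x1 ∷ app lookupT (b ∷ snd (fst x0) ∷ x2 ∷ []) ∷ []) ∷ [])

  update : Tm 3
  update = app minimum (snd x0 ∷ app minimum (via (srcT x1) (tgtT x1) ∷ via (tgtT x1) (srcT x1) ∷ []) ∷ [])

  relax : Tm 2
  relax = mapT x1 (cons (fst x1) (app update (x1 ∷ x5 ∷ x6 ∷ [])))

  distances : Tm 3
  distances = fold x0 (app initial (x3 ∷ x4 ∷ [])) (app relax (x1 ∷ x0 ∷ []))

  settledT : Tm 4
  settledT = app leq (app mul (snd x3 ∷ x1 ∷ []) ∷
                      app mul (fst x3 ∷ app lookupT (srcT x0 ∷ tgtT x0 ∷ x2 ∷ []) ∷ []) ∷ [])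

  sameEdge : Tm 2
  sameEdge = case (app equal (srcT x0 ∷ srcT x1 ∷ [])) nil (app equal (tgtT x2 ∷ tgtT x3 ∷ []))

  withoutT : Tm 2
  withoutT = filterT x1 (case (anyT x5 (app sameEdge (x6 ∷ x1 ∷ []))) one nil)

  feasibleT : Tm 2
  feasibleT = bind
    (app distances (app withoutT (x0 ∷ keptT x1 ∷ []) ∷ keysT x1 ∷ farT x1 ∷ []))
    (allT x1 (app settledT (x1 ∷ app lookupT (srcT x1 ∷ tgtT x1 ∷ x5 ∷ []) ∷ distT x7 ∷ ratioT x7 ∷ [])))

  goodT : Tm 4
  goodT = case (app leq (x2 ∷ app add (app count (x0 ∷ []) ∷ x3 ∷ []) ∷ [])) nil (app feasibleT (x2 ∷ x3 ∷ []))

  -- A pair of a flag, set once a good set is found, and the list of the sets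
  -- examined so far.

  searchBase : Tm 6
  searchBase = case (app goodT (nil ∷ x3 ∷ x4 ∷ x5 ∷ [])) (cons nil (cons nil nil)) (cons one nil)

  -- Only sets containing the new edge are examined, as the others have failed before. Success
  -- discards the list, so later edges cannot make it grow.
  searchStep : Tm 9
  searchStep = case (fst x0)
    (bind (mapT (snd x0) (cons x6 x1))
      (case (anyT x0 (app goodT (x1 ∷ x12 ∷ x13 ∷ x14 ∷ [])))
        (cons nil (app append (x0 ∷ snd x1 ∷ [])))
        (cons one nil)))
    x2

  search : Tm 4
  search = fold x0 searchBase searchStep

  solveT : Tm 3
  solveT = fst (app search (filterT (keptT x0) (app feasibleT (cons x1 nil ∷ x5 ∷ [])) ∷ x0 ∷ x1 ∷ x2 ∷ []))

  lengthSum : Tm 1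
  lengthSum = fold x0 nil (app add (lenT x1 ∷ x0 ∷ []))

  infinity : Tm 1
  infinity = app inc (app mul (numeratorT x0 ∷
    app mul (orderT x0 ∷ app lengthSum (edgesT x0 ∷ []) ∷ []) ∷ []) ∷ [])

  setup : Tm 1
  setup = bind (app infinity (x0 ∷ []))
    (bind (app pairs (app endpoints (edgesT x1 ∷ []) ∷ []))
      (bind (app distances (edgesT x2 ∷ x0 ∷ x1 ∷ []))
        (cons
          (filterT (edgesT x3) (app settledT (x1 ∷ lenT x1 ∷ x5 ∷ cons (numeratorT x8) (denominatorT x8) ∷ [])))
          (cons x1 (cons x2 (cons x0 (cons (numeratorT x3) (denominatorT x3))))))))

  removalT : Tm 1
  removalT = app solveT (app setup (fst x0 ∷ []) ∷ snd x0 ∷ nil ∷ [])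

  spannerT : Tm 1
  spannerT = bind (app setup (x0 ∷ [])) (app solveT (x0 ∷ app count (keptT x0 ∷ []) ∷ weightT x1 ∷ []))

n<2^n : ∀ n → n < 2 ^ n
n<2^n zero    = s≤s z≤n
n<2^n (suc n) = ≤-trans (+-mono-≤ (>-nonZero⁻¹ (2 ^ n) {{m^n≢0 2 n}}) (n<2^n n)) (≤-reflexive (cong (_+_ (2 ^ n)) (sym (+-identityʳ (2 ^ n)))))

length-cartesianProduct : ∀ {A B : Set} (xs : List A) (ys : List B) → length (cartesianProduct xs ys) ≡ length xs * length ys
length-cartesianProduct []       ys = refl
length-cartesianProduct (x ∷ xs) ys = trans (List.length-++ (List.map (x ,_) ys))
  (cong₂ _+_ (List.length-map (x ,_) ys) (length-cartesianProduct xs ys))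

n≤n*n : ∀ n → n ≤ n * n
n≤n*n zero    = z≤n
n≤n*n (suc n) = m≤m*n (suc n) (suc n)

-- Correctness of the terms for distances and feasibility

module Correctness (I : Instance) (B : ℕ)
  (far< : (3 + Removal.p I) * Removal.far I < 2 ^ B) (n< : Instance.n I < 2 ^ B)
  (pairs≤ : (Instance.m I + Instance.m I) * (Instance.m I + Instance.m I) ≤ B) where

  open Instance I
  open Removal I
  open Solutions I

  codeV : Vertex → Tree
  codeV v = codeℕ (Fin.toℕ v)

  Key : Set
  Key = Vertex × Vertex

  codeKey : Key → Tree
  codeKey (x , y) = node (codeV x) (codeV y)

  Matrix : Set
  Matrix = Vertex → Vertex → ℕ

  entry : Matrix → Key → Tree
  entry d k = node (codeKey k) (codeℕ (d (proj₁ k) (proj₂ k)))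

  verts : List Edge → List Vertex
  verts []       = []
  verts (e ∷ es) = src e ∷ tgt e ∷ verts es

  length-verts : ∀ es → length (verts es) ≡ length es + length es
  length-verts []       = refl
  length-verts (e ∷ es) = cong suc (trans (cong suc (length-verts es)) (sym (+-suc _ _)))

  src∈verts : ∀ {e es} → e ∈ es → src e ∈ verts es
  src∈verts (here refl) = here refl
  src∈verts (there e∈)  = there (there (src∈verts e∈))

  tgt∈verts : ∀ {e es} → e ∈ es → tgt e ∈ verts es
  tgt∈verts (here refl) = there (here refl)
  tgt∈verts (there e∈)  = there (there (tgt∈verts e∈))

  V : List Vertex
  V = verts E

  keys : List Key
  keys = cartesianProduct V V

  ends-key : ∀ e → (src e , tgt e) ∈ keys
  ends-key e = ∈-cartesianProduct⁺ (src∈verts (∈-allFin e)) (tgt∈verts (∈-allFin e))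

  γ : Tree
  γ = node (codes codeEdge K) (node (codes codeKey keys) (node (codeℕ far)
        (node (codes (entry (dist E)) keys) (node (codeℕ p) (codeℕ q)))))

  V≤B : length V ≤ B
  V≤B = ≤-trans (≤-reflexive (trans (length-verts E) (cong (λ k → k + k) (length-tabulate {n = m} id))))
    (≤-trans (n≤n*n (m + m)) pairs≤)

  m≤B : m ≤ B
  m≤B = ≤-trans (m≤m+n m m) (≤-trans (n≤n*n (m + m)) pairs≤)

  E≤B : length E ≤ B
  E≤B = ≤-trans (≤-reflexive (length-tabulate {n = m} id)) m≤B

  keys≤B : length keys ≤ B
  keys≤B = ≤-trans (≤-reflexive (trans (length-cartesianProduct V V)
    (cong (λ k → k * k) (trans (length-verts E) (cong (λ k → k + k) (length-tabulate {n = m} id)))))) pairs≤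

  K≤E : length K ≤ length E
  K≤E = List.length-filter (T? ∘ kept) E

  K≤B : length K ≤ B
  K≤B = ≤-trans K≤E E≤B

  vertex< : ∀ v → Fin.toℕ v < 2 ^ B
  vertex< v = ≤-<-trans (<⇒≤ (toℕ<n v)) n<

  -- The factor `3 + p` covers both kinds of intermediate values: sums of three terms up to `far`
  -- when an edge is inserted, and products with `p` or `q`, including their slack, in the stretch
  -- test.
  small : ∀ {a} → a ≤ (3 + p) * far → a < 2 ^ B
  small a≤ = ≤-<-trans a≤ far<

  ≤far⇒small : ∀ {a} → a ≤ far → a < 2 ^ B
  ≤far⇒small a≤ = small (≤-trans a≤ (m≤m+n far _))

  opaque
    unfolding endpoints

    endpoints-⇓ : B ∣ codes codeEdge E ∷ [] ⊢ endpoints ⇓ codes codeV V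
    endpoints-⇓ = fold-⇓ codeEdge (λ _ → ℕ) (codes codeV ∘ verts) id
      (λ e es _ → cons (fst-⇓ x1) (cons (fst-⇓ (snd-⇓ x1)) x0)) E 0 E≤B x0 nil

    pairs-⇓ : B ∣ codes codeV V ∷ [] ⊢ pairs ⇓ codes codeKey keys
    pairs-⇓ = fold-⇓ codeV (λ _ → ℕ) (λ xs → codes codeKey (cartesianProduct xs V)) id
      (λ x xs _ → app (row x ∷ x0 ∷ []) (append-⇓ codeKey (List.map (x ,_) V) (cartesianProduct xs V)
        (≤-trans (≤-reflexive (List.length-map (x ,_) V)) V≤B))) V 0 V≤B x0 nil
      where
      row : ∀ x {r t u s} → B ∣ r ∷ codeV x ∷ t ∷ u ∷ s ∷ codes codeV V ∷ [] ⊢ mapT x5 (cons x6 x1) ⇓ codes codeKey (List.map (x ,_) V)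
      row x = cong-⇓ codeList (map-∘ V) (map-⇓ codeV (λ y → codeKey (x , y)) V V≤B x5 (λ _ → cons x6 x1))

    initial-⇓ : B ∣ codes codeKey keys ∷ codeℕ far ∷ [] ⊢ initial ⇓ codes (entry (dist [])) keys
    initial-⇓ = map-⇓ codeKey (entry (dist [])) keys keys≤B x0 λ {k} _ → cons x1 (cell k)
      where
      cell : ∀ k {r t u s} → B ∣ r ∷ codeKey k ∷ t ∷ u ∷ s ∷ codes codeKey keys ∷ codeℕ far ∷ []
               ⊢ case (app equal (fst x1 ∷ snd x1 ∷ [])) x6 nil ⇓ codeℕ (dist [] (proj₁ k) (proj₂ k))
      cell (x , y) {r} {t} {u} {s} = select (Fin.toℕ x ≡ᵇ Fin.toℕ y) (equal-⇓ (Fin.toℕ x) (Fin.toℕ y) (vertex< x) (vertex< y) (fst-⇓ x1) (snd-⇓ x1))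
        where
        select : ∀ b → B ∣ r ∷ codeKey (x , y) ∷ t ∷ u ∷ s ∷ codes codeKey keys ∷ codeℕ far ∷ [] ⊢ app equal (fst x1 ∷ snd x1 ∷ []) ⇓ codeBool b →
                 B ∣ r ∷ codeKey (x , y) ∷ t ∷ u ∷ s ∷ codes codeKey keys ∷ codeℕ far ∷ []
                   ⊢ case (app equal (fst x1 ∷ snd x1 ∷ [])) x6 nil ⇓ codeℕ (if b then 0 else far)
        select true  d = case-node d nil
        select false d = case-leaf d x6

    lookup-⇓ : ∀ d {x y} → (x , y) ∈ keys → B ∣ codeV x ∷ codeV y ∷ codes (entry d) keys ∷ [] ⊢ lookupT ⇓ codeℕ (d x y)
    lookup-⇓ d {x} {y} xy∈ = cong-⇓ id (found-∈ xy∈)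
      (fold-⇓ (entry d) (λ _ → ℕ) found id (λ k ks _ → found-⇓ k ks) keys 0 keys≤B x2 nil)
      where
      hit : Key → Bool
      hit k = (Fin.toℕ x ≡ᵇ Fin.toℕ (proj₁ k)) ∧ (Fin.toℕ y ≡ᵇ Fin.toℕ (proj₂ k))
      hit⇔ : ∀ k → T (hit k) ⇔ (x , y) ≡ k
      hit⇔ k = mk⇔
        (λ t → let s , t = Equivalence.to T-∧ t in cong₂ _,_ (Fin.toℕ-injective (≡ᵇ⇒≡ _ _ s)) (Fin.toℕ-injective (≡ᵇ⇒≡ _ _ t)))
        (λ { refl → Equivalence.from T-∧ (≡⇒≡ᵇ (Fin.toℕ x) _ refl , ≡⇒≡ᵇ (Fin.toℕ y) _ refl) })
      found : List Key → Tree
      found []       = leaf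
      found (k ∷ ks) = if hit k then codeℕ (d (proj₁ k) (proj₂ k)) else found ks
      found-∈ : ∀ {ks} → (x , y) ∈ ks → found ks ≡ codeℕ (d x y)
      found-∈ {k ∷ ks} k∈ with hit k | hit⇔ k | k∈
      ... | true  | h | _          = cong (λ (x , y) → codeℕ (d x y)) (sym (Equivalence.to h tt))
      ... | false | h | there k∈ks = found-∈ k∈ks
      ... | false | h | here eq    = ⊥-elim (Equivalence.from h eq)
      found-⇓ : ∀ k ks {t u s} → B ∣ found ks ∷ entry d k ∷ t ∷ u ∷ s ∷ codeV x ∷ codeV y ∷ codes (entry d) keys ∷ []
               ⊢ case (case (app equal (x5 ∷ fst (fst x1) ∷ [])) nil (app equal (x8 ∷ snd (fst x3) ∷ []))) x0 (snd x3) ⇓ found (k ∷ ks)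
      found-⇓ k ks {t} {u} {s} = select (hit k) (and-⇓ (Fin.toℕ x ≡ᵇ Fin.toℕ (proj₁ k))
          (equal-⇓ (Fin.toℕ x) (Fin.toℕ (proj₁ k)) (vertex< x) (vertex< (proj₁ k)) x5 (fst-⇓ (fst-⇓ x1)))
          (λ _ → equal-⇓ (Fin.toℕ y) (Fin.toℕ (proj₂ k)) (vertex< y) (vertex< (proj₂ k)) x8 (snd-⇓ (fst-⇓ x3))))
        where
        ρ : Vec Tree 8
        ρ = found ks ∷ entry d k ∷ t ∷ u ∷ s ∷ codeV x ∷ codeV y ∷ codes (entry d) keys ∷ []
        select : ∀ b {c} → B ∣ ρ ⊢ c ⇓ codeBool b →
                 B ∣ ρ ⊢ case c x0 (snd x3) ⇓ (if b then codeℕ (d (proj₁ k) (proj₂ k)) else found ks)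
        select true  d = case-node d (snd-⇓ x3)
        select false d = case-leaf d x0

    update-⇓ : ∀ S {e x y} → (x , y) ∈ keys →
               B ∣ entry (dist S) (x , y) ∷ codeEdge e ∷ codes (entry (dist S)) keys ∷ [] ⊢ update ⇓ codeℕ (dist (e ∷ S) x y)
    update-⇓ S {e} {x} {y} xy∈ = minimum-⇓ (dist S x y) _ (≤far⇒small (dist-≤-far S x y)) (snd-⇓ x0)
        (minimum-⇓ _ _ (via< _ _) (via-⇓ (src∈verts (∈-allFin e)) (tgt∈verts (∈-allFin e)) (fst-⇓ x1) (fst-⇓ (snd-⇓ x1)))
                                  (via-⇓ (tgt∈verts (∈-allFin e)) (src∈verts (∈-allFin e)) (fst-⇓ (snd-⇓ x1)) (fst-⇓ x1)))
      where
      x∈ : x ∈ V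
      x∈ = proj₁ (∈-cartesianProduct⁻ V V xy∈)
      y∈ : y ∈ V
      y∈ = proj₂ (∈-cartesianProduct⁻ V V xy∈)
      ℓ≤far : ℓ e ≤ far
      ℓ≤far = ≤-trans (ℓ-≤-total e) (≤-trans (m≤n*m totalLength n) (<⇒≤ far-enough))
      right≤ : ∀ b → ℓ e + dist S b y ≤ far + far
      right≤ b = +-mono-≤ ℓ≤far (dist-≤-far S b y)
      3far : far + (far + far) ≤ (3 + p) * far
      3far = ≤-trans (≤-reflexive (cong (λ k → far + (far + k)) (sym (+-identityʳ far)))) (*-monoˡ-≤ far (m≤m+n 3 p))
      via< : ∀ a b → dist S x a + (ℓ e + dist S b y) < 2 ^ B
      via< a b = small (≤-trans (+-mono-≤ (dist-≤-far S x a) (right≤ b)) 3far)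
      via-⇓ : ∀ {a b ta tb} → a ∈ V → b ∈ V →
              B ∣ entry (dist S) (x , y) ∷ codeEdge e ∷ codes (entry (dist S)) keys ∷ [] ⊢ ta ⇓ codeV a →
              B ∣ entry (dist S) (x , y) ∷ codeEdge e ∷ codes (entry (dist S)) keys ∷ [] ⊢ tb ⇓ codeV b →
              B ∣ entry (dist S) (x , y) ∷ codeEdge e ∷ codes (entry (dist S)) keys ∷ [] ⊢ via ta tb ⇓ codeℕ (dist S x a + (ℓ e + dist S b y))
      via-⇓ {a} {b} a∈ b∈ da db = add-⇓ (dist S x a) (ℓ e + dist S b y) (via< a b)
        (app (fst-⇓ (fst-⇓ x0) ∷ da ∷ x2 ∷ []) (lookup-⇓ (dist S) (∈-cartesianProduct⁺ x∈ a∈)))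
        (add-⇓ (ℓ e) (dist S b y) (small (≤-trans (right≤ b) (≤-trans (m≤n+m _ far) 3far))) (snd-⇓ (snd-⇓ x1))
          (app (db ∷ snd-⇓ (fst-⇓ x0) ∷ x2 ∷ []) (lookup-⇓ (dist S) (∈-cartesianProduct⁺ b∈ y∈))))

    relax-⇓ : ∀ S e → B ∣ codeEdge e ∷ codes (entry (dist S)) keys ∷ [] ⊢ relax ⇓ codes (entry (dist (e ∷ S))) keys
    relax-⇓ S e = map-⇓ (entry (dist S)) (entry (dist (e ∷ S))) keys keys≤B x1
      (λ k∈ → cons (fst-⇓ x1) (app (x1 ∷ x5 ∷ x6 ∷ []) (update-⇓ S k∈)))

    distances-⇓ : ∀ S → length S ≤ B → B ∣ codes codeEdge S ∷ codes codeKey keys ∷ codeℕ far ∷ [] ⊢ distances ⇓ codes (entry (dist S)) keys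
    distances-⇓ S S≤B = fold-⇓ codeEdge (λ _ → ℕ) (λ S → codes (entry (dist S)) keys) id
      (λ e S _ → app (x1 ∷ x0 ∷ []) (relax-⇓ S e)) S 0 S≤B x0 (app (x3 ∷ x4 ∷ []) initial-⇓)

    settled-⇓ : ∀ e d → d ≤ far →
                B ∣ codeEdge e ∷ codeℕ d ∷ codes (entry (dist E)) keys ∷ node (codeℕ p) (codeℕ q) ∷ [] ⊢ settledT
                  ⇓ codeBool (q * d ≤ᵇ p * δ e)
    settled-⇓ e d d≤ = leq-⇓ (q * d) (p * δ e)
        (≤-<-trans (m≤m+n _ d) (product q d q≤p d≤))
        (mul-⇓ q d (factor< q≤p) (product q d q≤p d≤) (snd-⇓ x3) x1)
        (mul-⇓ p (δ e) (factor< ≤-refl) (product p (δ e) ≤-refl (dist-≤-far E _ _)) (fst-⇓ x3)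
          (app (fst-⇓ x0 ∷ fst-⇓ (snd-⇓ x0) ∷ x2 ∷ []) (lookup-⇓ (dist E) (ends-key e))))
      where
      factor< : ∀ {c} → c ≤ p → c < 2 ^ B
      factor< c≤ = small (≤-trans c≤ (≤-trans (m≤n+m p 3) (m≤m*n (3 + p) far)))
      product : ∀ c d → c ≤ p → d ≤ far → c * d + d < 2 ^ B
      product c d c≤ d≤ = small (≤-trans (+-mono-≤ (*-mono-≤ c≤ d≤) d≤)
        (≤-trans (≤-reflexive (+-comm (p * far) far)) (*-monoˡ-≤ far (m≤n+m (suc p) 2))))

    sameEdge-⇓ : ∀ e f → B ∣ codeEdge e ∷ codeEdge f ∷ [] ⊢ sameEdge ⇓ codeBool (same e f)
    sameEdge-⇓ e f = and-⇓ (Fin.toℕ (src e) ≡ᵇ Fin.toℕ (src f))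
      (equal-⇓ _ _ (vertex< (src e)) (vertex< (src f)) (fst-⇓ x0) (fst-⇓ x1))
      (λ _ → equal-⇓ _ _ (vertex< (tgt e)) (vertex< (tgt f)) (fst-⇓ (snd-⇓ x2)) (fst-⇓ (snd-⇓ x3)))

    without-⇓ : ∀ R → length R ≤ B → B ∣ codes codeEdge R ∷ codes codeEdge K ∷ [] ⊢ withoutT ⇓ codes codeEdge (without R)
    without-⇓ R R≤B = filter-⇓ codeEdge (λ e → not (any (same e) R)) K K≤B x1
      (λ {e} _ → negate (any (same e) R) (any-⇓ codeEdge (same e) R R≤B x5 (λ {f} _ → app (x6 ∷ x1 ∷ []) (sameEdge-⇓ e f))))
      where
      negate : ∀ {n} {ρ : Vec Tree n} {c} b → B ∣ ρ ⊢ c ⇓ codeBool b → B ∣ ρ ⊢ case c one nil ⇓ codeBool (not b)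
      negate true  d = case-node d nil
      negate false d = case-leaf d one

    feasible-⇓ : ∀ R → length R ≤ B → B ∣ codes codeEdge R ∷ γ ∷ [] ⊢ feasibleT ⇓ codeBool (feasible R)
    feasible-⇓ R R≤B = bind
      (app (app (x0 ∷ fst-⇓ x1 ∷ []) (without-⇓ R R≤B) ∷ fst-⇓ (snd-⇓ x1) ∷ fst-⇓ (snd-⇓ (snd-⇓ x1)) ∷ [])
        (distances-⇓ (without R) (≤-trans (List.length-filter (T? ∘ _) K) K≤B)))
      (all-⇓ codeEdge (settled (without R)) R R≤B x1 λ {e} _ →
        app (x1 ∷ app (fst-⇓ x1 ∷ fst-⇓ (snd-⇓ x1) ∷ x5 ∷ []) (lookup-⇓ (dist (without R)) (ends-key e)) ∷
             fst-⇓ (snd-⇓ (snd-⇓ (snd-⇓ x7))) ∷ snd-⇓ (snd-⇓ (snd-⇓ (snd-⇓ x7))) ∷ [])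
          (settled-⇓ e _ (dist-≤-far (without R) _ _)))

any-++ : ∀ {A : Set} (g : A → Bool) xs ys → any g (xs ++ ys) ≡ any g xs ∨ any g ys
any-++ g []       ys = refl
any-++ g (x ∷ xs) ys with g x
... | true  = refl
... | false = any-++ g xs ys

-- Derivation of the search

module Algorithm (I : Instance) (B : ℕ)
  (far< : (3 + Removal.p I) * Removal.far I < 2 ^ B) (n< : Instance.n I < 2 ^ B)
  (pairs≤ : (Instance.m I + Instance.m I) * (Instance.m I + Instance.m I) ≤ B) where

  open Instance I
  open Removal I
  open Solutions I
  open Correctness I B far< n< pairs≤

  opaque
    unfolding endpoints

    good-⇓ : ∀ a b R → length R ≤ m → a < 2 ^ B → m + b < 2 ^ B →
             B ∣ codes codeEdge R ∷ γ ∷ codeℕ a ∷ codeℕ b ∷ [] ⊢ goodT ⇓ codeBool (good a b R)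
    good-⇓ a b R R≤m a< b< = and-⇓ (a ≤ᵇ length R + b)
      (leq-⇓ a (length R + b) a< x2 (add-⇓ (length R) b (≤-<-trans (+-monoˡ-≤ b R≤m) b<)
        (app (x0 ∷ []) (count-⇓ codeEdge R R≤B (≤-<-trans R≤B (n<2^n B)))) x3))
      (λ _ → app (x2 ∷ x3 ∷ []) (feasible-⇓ R R≤B))
      where
      R≤B : length R ≤ B
      R≤B = ≤-trans R≤m m≤B

  -- `H` restricts only lists whose sublists have all failed, since only then does the state hold
  -- all of these sublists.
  module _ (a b : ℕ) (a< : a < 2 ^ B) (b< : m + b < 2 ^ B)
           (H : ∀ xs → Suitable xs → any (good a b) (subs xs) ≡ false → 2 ^ length xs ≤ B) where

    private
      state : Bool → List Edge → Tree
      state true  xs = node (node leaf leaf) leaf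
      state false xs = node leaf (codes (codes codeEdge) (subs xs))

      R : List Edge → Tree
      R xs = state (any (good a b) (subs xs)) xs

    opaque
      unfolding endpoints

      searchBase-⇓ : ∀ {t} → B ∣ leaf ∷ leaf ∷ t ∷ γ ∷ codeℕ a ∷ codeℕ b ∷ [] ⊢ searchBase ⇓ R []
      searchBase-⇓ {t} with good a b [] | good-⇓ a b [] z≤n a< b<
      ... | true  | d = case-node (app (nil ∷ x3 ∷ x4 ∷ x5 ∷ []) d) (cons one nil)
      ... | false | d = case-leaf (app (nil ∷ x3 ∷ x4 ∷ x5 ∷ []) d) (cons nil (cons nil nil))

      searchStep-⇓ : ∀ x xs {t u s v} → Suitable (x ∷ xs) →
        B ∣ R xs ∷ codeEdge x ∷ t ∷ u ∷ s ∷ v ∷ γ ∷ codeℕ a ∷ codeℕ b ∷ [] ⊢ searchStep ⇓ R (x ∷ xs)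
      searchStep-⇓ x xs {t} {u} {s} {v} suit = split (any (good a b) (subs xs)) refl
        where
        new : List (List Edge)
        new = List.map (x ∷_) (subs xs)
        any-step : any (good a b) (subs (x ∷ xs)) ≡ any (good a b) new ∨ any (good a b) (subs xs)
        any-step = any-++ (good a b) new (subs xs)
        ρ : Tree → Vec Tree 9
        ρ r = r ∷ codeEdge x ∷ t ∷ u ∷ s ∷ v ∷ γ ∷ codeℕ a ∷ codeℕ b ∷ []
        new≤m : ∀ {L} → L ∈ new → length L ≤ m
        new≤m L∈ with L′ , L′∈ , refl ← ∈-map⁻ (x ∷_) L∈ = ≤-trans (s≤s (subs-length xs L′∈)) (suitable⇒length-≤ suit)
        found⇒ : any (good a b) (subs xs) ≡ true → state true xs ≡ R (x ∷ xs)
        found⇒ eq = cong (λ c → state c (x ∷ xs)) (sym (trans any-step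
          (trans (cong (any (good a b) new ∨_) eq) (∨-zeroʳ (any (good a b) new)))))
        split : ∀ c → any (good a b) (subs xs) ≡ c → B ∣ ρ (state (any (good a b) (subs xs)) xs) ⊢ searchStep ⇓ R (x ∷ xs)
        split true eq = subst (λ c → B ∣ ρ (state c xs) ⊢ searchStep ⇓ R (x ∷ xs)) (sym eq)
          (cong-⇓ id (found⇒ eq) (case-node (fst-⇓ x0) x2))
        split false eq = subst (λ c → B ∣ ρ (state c xs) ⊢ searchStep ⇓ R (x ∷ xs)) (sym eq)
          (case-leaf (fst-⇓ x0) (bind
            (cong-⇓ codeList (map-∘ (subs xs)) (map-⇓ (codes codeEdge) (λ L → codes codeEdge (x ∷ L)) (subs xs) subs≤B (snd-⇓ x0) (λ _ → cons x6 x1)))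
            (test (any (good a b) new) refl
              (any-⇓ (codes codeEdge) (good a b) new new≤B x0 (λ {L} L∈ → app (x1 ∷ x12 ∷ x13 ∷ x14 ∷ []) (good-⇓ a b L (new≤m L∈) a< b<))))))
          where
          subs≤B : length (subs xs) ≤ B
          subs≤B = ≤-trans (≤-reflexive (length-subs xs)) (H xs (suitable-tail suit) eq)
          new≤B : length new ≤ B
          new≤B = ≤-trans (≤-reflexive (List.length-map (x ∷_) (subs xs))) subs≤B
          test : ∀ c {e} → any (good a b) new ≡ c → B ∣ codes (codes codeEdge) new ∷ ρ (state false xs) ⊢ e ⇓ codeBool c →
                 B ∣ codes (codes codeEdge) new ∷ ρ (state false xs) ⊢ case e (cons nil (app append (x0 ∷ snd x1 ∷ []))) (cons one nil) ⇓ R (x ∷ xs)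
          test true eq′ d = cong-⇓ (λ c → state c (x ∷ xs)) (sym (trans any-step (cong (_∨ any (good a b) (subs xs)) eq′)))
            (case-node d (cons one nil))
          test false eq′ d = cong-⇓ (λ c → state c (x ∷ xs)) (sym (trans any-step (trans (cong (_∨ any (good a b) (subs xs)) eq′) eq)))
            (case-leaf d (cons nil (app (x0 ∷ snd-⇓ x1 ∷ []) (append-⇓ (codes codeEdge) new (subs xs) new≤B))))

      solveT-⇓ : B ∣ γ ∷ codeℕ a ∷ codeℕ b ∷ [] ⊢ solveT ⇓ codeBool (any (good a b) (subs N))
      solveT-⇓ = verdict (any (good a b) (subs N)) refl (app (filter-⇓ codeEdge (λ e → feasible (e ∷ [])) K K≤B (fst-⇓ x0)
            (λ {e} _ → app (cons x1 nil ∷ x5 ∷ []) (feasible-⇓ (e ∷ []) (≤-trans (≤-trans (s≤s z≤n) (toℕ<n e)) m≤B))) ∷ x0 ∷ x1 ∷ x2 ∷ [])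
          (fold-⇓ codeEdge Suitable R suitable-tail (λ x xs → searchStep-⇓ x xs) N (N-unique , id)
            (≤-trans (suitable⇒length-≤ {N} (N-unique , id)) m≤B) x0 searchBase-⇓))
        where
        verdict : ∀ c {e} → any (good a b) (subs N) ≡ c → B ∣ γ ∷ codeℕ a ∷ codeℕ b ∷ [] ⊢ e ⇓ R N →
                  B ∣ γ ∷ codeℕ a ∷ codeℕ b ∷ [] ⊢ fst e ⇓ codeBool c
        verdict c eq d with any (good a b) (subs N)
        verdict true  refl d | true  = fst-⇓ d
        verdict false refl d | false = fst-⇓ d

  opaque
    unfolding endpoints

    lengthSum-⇓ : B ∣ codes codeEdge E ∷ [] ⊢ lengthSum ⇓ codeℕ totalLength
    lengthSum-⇓ = fold-⇓ codeEdge (λ xs → sum (List.map ℓ xs) < 2 ^ B) (λ xs → codeℕ (sum (List.map ℓ xs)))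
      (λ {x} → ≤-<-trans (m≤n+m _ (ℓ x))) (λ x xs lt → add-⇓ (ℓ x) (sum (List.map ℓ xs)) lt (snd-⇓ (snd-⇓ x1)) x0)
      E total< E≤B x0 nil
      where
      total< : totalLength < 2 ^ B
      total< = ≤far⇒small (≤-trans (m≤n*m totalLength n) (<⇒≤ far-enough))

    infinity-⇓ : B ∣ codeInstance ∷ [] ⊢ infinity ⇓ codeℕ far
    infinity-⇓ = inc-⇓ (p * (n * totalLength)) (≤far⇒small (n≤1+n _))
      (mul-⇓ p (n * totalLength) (small (≤-trans (m≤n+m p 3) (m≤m*n (3 + p) far)))
        (2far (n≤1+n _) (<⇒≤ far-enough))
        (fst-⇓ (snd-⇓ (snd-⇓ x0)))
        (mul-⇓ n totalLength n< (2far (<⇒≤ far-enough) (≤-trans (m≤n*m totalLength n) (<⇒≤ far-enough))) (fst-⇓ x0)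
          (app (fst-⇓ (snd-⇓ x0) ∷ []) lengthSum-⇓)))
      where
      2far : ∀ {a b} → a ≤ far → b ≤ far → a + b < 2 ^ B
      2far a≤ b≤ = small (≤-trans (+-mono-≤ a≤ b≤)
        (≤-trans (≤-reflexive (cong (_+_ far) (sym (+-identityʳ far)))) (*-monoˡ-≤ far (≤-trans (n≤1+n 2) (m≤m+n 3 p)))))

    setup-⇓ : B ∣ codeInstance ∷ [] ⊢ setup ⇓ γ
    setup-⇓ = bind (app (x0 ∷ []) infinity-⇓)
      (bind (app (app (fst-⇓ (snd-⇓ x1) ∷ []) (endpoints-⇓) ∷ []) (pairs-⇓))
        (bind (app (fst-⇓ (snd-⇓ x2) ∷ x0 ∷ x1 ∷ []) (distances-⇓ E E≤B))
          (cons (filter-⇓ codeEdge kept E E≤B (fst-⇓ (snd-⇓ x3)) (λ {e} _ →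
              app (x1 ∷ snd-⇓ (snd-⇓ x1) ∷ x5 ∷ cons (fst-⇓ (snd-⇓ (snd-⇓ x8))) (fst-⇓ (snd-⇓ (snd-⇓ (snd-⇓ x8)))) ∷ [])
                (settled-⇓ e (ℓ e) (≤-trans (ℓ-≤-total e) (≤-trans (m≤n*m totalLength n) (<⇒≤ far-enough))))))
            (cons x1 (cons x2 (cons x0 (cons (fst-⇓ (snd-⇓ (snd-⇓ x3))) (fst-⇓ (snd-⇓ (snd-⇓ (snd-⇓ x3))))))))))) 

    removal-⇓ : ∀ ϱ → ϱ < 2 ^ B → m + 0 < 2 ^ B →
                (∀ xs → Suitable xs → any (good ϱ 0) (subs xs) ≡ false → 2 ^ length xs ≤ B) →
                B ∣ node codeInstance (codeℕ ϱ) ∷ [] ⊢ removalT ⇓ codeBool (any (good ϱ 0) (subs N))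
    removal-⇓ ϱ ϱ< m< H = app (app (fst-⇓ x0 ∷ []) setup-⇓ ∷ snd-⇓ x0 ∷ nil ∷ []) (solveT-⇓ ϱ 0 ϱ< m< H)

    spanner-⇓ : m + W < 2 ^ B →
                (∀ xs → Suitable xs → any (good (length K) W) (subs xs) ≡ false → 2 ^ length xs ≤ B) →
                B ∣ codeInstance ∷ [] ⊢ spannerT ⇓ codeBool (any (good (length K) W) (subs N))
    spanner-⇓ W< H = bind (app (x0 ∷ []) setup-⇓)
      (app (x0 ∷ app (fst-⇓ x0 ∷ []) (count-⇓ codeEdge K K≤B K<) ∷ fst-⇓ (snd-⇓ (snd-⇓ (snd-⇓ (snd-⇓ x1)))) ∷ [])
        (solveT-⇓ (length K) W K< W< H))
      where
      K< : length K < 2 ^ B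
      K< = ≤-<-trans K≤B (n<2^n B)

-- Resource bounds

ones : ℕ → Tree
ones zero    = leaf
ones (suc a) = node (node leaf leaf) (ones a)

spine-ones : ∀ a → spine (ones a) ≡ a
spine-ones zero    = refl
spine-ones (suc a) = cong suc (spine-ones a)

-- In bijective binary, h digits 1 denote 2 ^ h ∸ 1.

codeℕ-ones : ∀ h → codeℕ (2 ^ h ∸ 1) ≡ ones h
codeℕ-ones h = trans (cong codeℕᵇ (ℕᵇ.toℕ-injective (trans (ℕᵇ.toℕ-fromℕ (2 ^ h ∸ 1)) (cong (_∸ 1) (sym (value h)))))) (code h)
  where
  onesᵇ : ℕ → ℕᵇ
  onesᵇ zero    = ℕᵇ.zero
  onesᵇ (suc h) = 1+[2 onesᵇ h ]
  value : ∀ h → suc (ℕᵇ.toℕ (onesᵇ h)) ≡ 2 ^ h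
  value zero    = refl
  value (suc h) = trans (sym (*-suc 2 (ℕᵇ.toℕ (onesᵇ h)))) (cong (2 *_) (value h))
  code : ∀ h → codeℕᵇ (onesᵇ h) ≡ ones h
  code zero    = refl
  code (suc h) = cong (node _) (code h)

opaque

  addOnes : Tm 2
  addOnes = fold x0 x3 (cons one x0)

  mulOnes : Tm 2
  mulOnes = fold x0 nil (app addOnes (x6 ∷ x0 ∷ []))

  unaryUp : Tm 6
  unaryUp = case x1 (cons one (cons one (app addOnes (x0 ∷ x0 ∷ [])))) (cons one (app addOnes (x2 ∷ x2 ∷ [])))

  unary : Tm 1
  unary = fold x0 nil unaryUp

  addOnes-⇓ : ∀ {B} a b → a ≤ B → B ∣ ones a ∷ ones b ∷ [] ⊢ addOnes ⇓ ones (a + b)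
  addOnes-⇓ {B} a b a≤ = rec x0 nil (≤-trans (≤-reflexive (spine-ones a)) a≤) (loop a)
    where
    loop : ∀ {v} a → Loop B (v ∷ ones b ∷ []) x3 nil (cons one x0) (ones a) leaf (ones (a + b))
    loop zero    = stop x3
    loop (suc a) = next nil (loop a) (cons one x0)

  mulOnes-⇓ : ∀ {B} a b → a ≤ B → b ≤ B → B ∣ ones a ∷ ones b ∷ [] ⊢ mulOnes ⇓ ones (a * b)
  mulOnes-⇓ {B} a b a≤ b≤ = rec x0 nil (≤-trans (≤-reflexive (spine-ones a)) a≤) (loop a)
    where
    loop : ∀ {v} a → Loop B (v ∷ ones b ∷ []) nil nil (app addOnes (x6 ∷ x0 ∷ [])) (ones a) leaf (ones (a * b))
    loop zero    = stop nil
    loop (suc a) = next nil (loop a) (app (x6 ∷ x0 ∷ []) (addOnes-⇓ b (a * b) b≤))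

  unary-⇓ᵇ : ∀ {B} x → ℕᵇ.toℕ x ≤ B → B ∣ codeℕᵇ x ∷ [] ⊢ unary ⇓ ones (ℕᵇ.toℕ x)
  unary-⇓ᵇ {B} x x≤ = rec x0 nil (spine-codeℕᵇ-≤ {B} x (≤-<-trans x≤ (n<2^n B))) (loop x x≤)
    where
    double : ∀ a → a + a ≡ 2 * a
    double a = cong (_+_ a) (sym (+-identityʳ a))
    loop : ∀ {v : Tree} x → ℕᵇ.toℕ x ≤ B → Loop B (v ∷ []) nil nil unaryUp (codeℕᵇ x) leaf (ones (ℕᵇ.toℕ x))
    loop ℕᵇ.zero  _  = stop nil
    loop 2[1+ x ] x≤ = let x≤′ = ≤-trans (ev≤ x) x≤ in next nil (loop x x≤′)
      (case-leaf x1 (cong-⇓ ones {suc (suc (ℕᵇ.toℕ x + ℕᵇ.toℕ x))} (trans (cong (_+_ 2) (double (ℕᵇ.toℕ x))) (sym (*-suc 2 (ℕᵇ.toℕ x))))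
        (cons one (cons one (app (x0 ∷ x0 ∷ []) (addOnes-⇓ (ℕᵇ.toℕ x) (ℕᵇ.toℕ x) x≤′))))))
    loop 1+[2 x ] x≤ = let x≤′ = ≤-trans (od≤ x) x≤ in next nil (loop x x≤′)
      (case-node x1 (cong-⇓ ones {suc (ℕᵇ.toℕ x + ℕᵇ.toℕ x)} (cong suc (double (ℕᵇ.toℕ x)))
        (cons one (app (x2 ∷ x2 ∷ []) (addOnes-⇓ (ℕᵇ.toℕ x) (ℕᵇ.toℕ x) x≤′)))))

unary-⇓ : ∀ {B} a → a ≤ B → B ∣ codeℕ a ∷ [] ⊢ unary ⇓ ones a
unary-⇓ {B} a a≤ = cong-⇓ ones (ℕᵇ.toℕ-fromℕ a) (unary-⇓ᵇ (fromℕ a) (subst (_≤ B) (sym (ℕᵇ.toℕ-fromℕ a)) a≤))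

literal : ∀ {n} → ℕ → Tm n
literal zero    = nil
literal (suc a) = cons one (literal a)

literal-⇓ : ∀ {B n} {ρ : Vec Tree n} a → B ∣ ρ ⊢ literal a ⇓ ones a
literal-⇓ zero    = nil
literal-⇓ (suc a) = cons one (literal-⇓ a)

-- With out-degrees at most l, this many vertices contain suc k independent ones.

kernel : ℕ → ℕ → ℕ
kernel k l = suc k * suc (l + l)

-- A number `2 ^ h ∸ 1` has a code of `h` equal digits, so unary arithmetic on the exponent computes
-- it. The `suc` in the exponent makes up for the subtracted 1.
fptFactor : ℕ → ℕ → ℕ → ℕ
fptFactor d k l = 2 ^ suc (d * kernel k l) ∸ 1

fptFactor-computable : ∀ d → Computable₂ (fptFactor d)
fptFactor-computable d = toProgram e , λ k l → let c , r , _ = toProgram-runs (e-⇓ k l) in c , r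
  where
  e : Tm 1
  e = cons one (app mulOnes (literal d ∷ app mulOnes
        (cons one (app unary (fst x0 ∷ [])) ∷ cons one (bind (app unary (snd x0 ∷ [])) (app addOnes (x0 ∷ x0 ∷ []))) ∷ []) ∷ []))
  -- Computability sets no time limit, so the sum of all lengths that occur serves as the bound.
  bnd : ℕ → ℕ → ℕ
  bnd k l = d + (kernel k l + (suc k + suc (l + l)))
  e-⇓ : ∀ k l → bnd k l ∣ node (codeℕ k) (codeℕ l) ∷ [] ⊢ e ⇓ codeℕ (fptFactor d k l)
  e-⇓ k l = cong-⇓ id (sym (codeℕ-ones (suc (d * kernel k l)))) (cons one (app
    (literal-⇓ d ∷ app (cons one (app (fst-⇓ x0 ∷ []) (unary-⇓ k (≤-trans (n≤1+n k) k<))) ∷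
                        cons one (bind (app (snd-⇓ x0 ∷ []) (unary-⇓ l l≤)) (app (x0 ∷ x0 ∷ []) (addOnes-⇓ l l l≤))) ∷ [])
                       (mulOnes-⇓ (suc k) (suc (l + l)) k< 2l<) ∷ [])
    (mulOnes-⇓ d (kernel k l) (m≤m+n d _) (≤-trans (m≤m+n (kernel k l) _) (m≤n+m _ d)))))
    where
    k< : suc k ≤ bnd k l
    k< = ≤-trans (m≤m+n (suc k) _) (≤-trans (m≤n+m _ (kernel k l)) (m≤n+m _ d))
    2l< : suc (l + l) ≤ bnd k l
    2l< = ≤-trans (m≤n+m _ (suc k)) (≤-trans (m≤n+m _ (kernel k l)) (m≤n+m _ d))
    l≤ : l ≤ bnd k l
    l≤ = ≤-trans (m≤m+n l l) (≤-trans (n≤1+n _) 2l<)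

-- 2 ^ J covers the sets examined by the search, and 8 * (Z * Z) all other
-- lists: edges, pairs of endpoints, and the binary digits of numbers.

budget : ℕ → ℕ → ℕ
budget Z J = 8 * (Z * Z) * 2 ^ J

monomial : ℕ → ℕ → Polynomial
monomial c zero    = c ∷ []
monomial c (suc d) = 0 ∷ monomial c d

eval-monomial : ∀ c d x → eval (monomial c d) x ≡ c * x ^ d
eval-monomial c zero    x = trans (cong (_+_ c) (*-zeroʳ x)) (trans (+-identityʳ c) (sym (*-identityʳ c)))
eval-monomial c (suc d) x = trans (cong (x *_) (eval-monomial c d x))
  (solve 3 (λ x c y → x :* (c :* y) := c :* (x :* y)) refl x c (x ^ d))
  where open +-*-Solver

size≥1 : ∀ t → 1 ≤ size t
size≥1 leaf       = s≤s z≤n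
size≥1 (node _ _) = s≤s z≤n

^-distribʳ-* : ∀ d a b → (a * b) ^ d ≡ a ^ d * b ^ d
^-distribʳ-* zero    a b = refl
^-distribʳ-* (suc d) a b = trans (cong (a * b *_) (^-distribʳ-* d a b))
  (solve 4 (λ a b x y → a :* b :* (x :* y) := a :* x :* (b :* y)) refl a b (a ^ d) (b ^ d))
  where open +-*-Solver

-- The power of `2 ^ κ` is absorbed by `fptFactor`, and what remains is a monomial in `Z`. The 9 is
-- the 8 of `budget` plus one for the `suc`.
budget-polynomial : ∀ c d Z k l → 1 ≤ Z →
                    c * suc (budget Z (kernel k l)) ^ d ≤ fptFactor d k l * eval (monomial (c * 9 ^ d) (2 * d)) Z
budget-polynomial c d Z k l 1≤Z = begin
  c * suc (budget Z κ) ^ d                        ≤⟨ *-monoʳ-≤ c (^-monoˡ-≤ d suc-budget) ⟩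
  c * (9 * (Z * Z) * 2 ^ κ) ^ d                   ≡⟨ cong (c *_) (^-distribʳ-* d (9 * (Z * Z)) (2 ^ κ)) ⟩
  c * ((9 * (Z * Z)) ^ d * (2 ^ κ) ^ d)           ≡⟨ cong (λ z → c * (z * (2 ^ κ) ^ d)) (^-distribʳ-* d 9 (Z * Z)) ⟩
  c * (9 ^ d * (Z * Z) ^ d * (2 ^ κ) ^ d)         ≡⟨ solve 4 (λ c n z t → c :* (n :* z :* t) := t :* (c :* n :* z)) refl c (9 ^ d) ((Z * Z) ^ d) ((2 ^ κ) ^ d) ⟩
  (2 ^ κ) ^ d * (c * 9 ^ d * (Z * Z) ^ d)         ≡⟨ cong₂ _*_ (trans (^-*-assoc 2 κ d) (cong (2 ^_) (*-comm κ d)))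
                                                       (cong (c * 9 ^ d *_) (trans (cong (λ z → (Z * z) ^ d) (sym (*-identityʳ Z))) (^-*-assoc Z 2 d))) ⟩
  2 ^ (d * κ) * (c * 9 ^ d * Z ^ (2 * d))         ≡⟨ cong (2 ^ (d * κ) *_) (eval-monomial (c * 9 ^ d) (2 * d) Z) ⟨
  2 ^ (d * κ) * eval (monomial (c * 9 ^ d) (2 * d)) Z ≤⟨ *-monoˡ-≤ _ pow ⟩
  fptFactor d k l * eval (monomial (c * 9 ^ d) (2 * d)) Z ∎
  where
  open ≤-Reasoning
  open +-*-Solver
  κ : ℕ
  κ = kernel k l
  1≤ZZ2^κ : 1 ≤ Z * Z * 2 ^ κ
  1≤ZZ2^κ = *-mono-≤ (*-mono-≤ 1≤Z 1≤Z) (m^n>0 2 κ)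
  suc-budget : suc (budget Z κ) ≤ 9 * (Z * Z) * 2 ^ κ
  suc-budget = ≤-trans (+-monoˡ-≤ (budget Z κ) 1≤ZZ2^κ) (≤-reflexive
    (solve 2 (λ z t → z :* t :+ con 8 :* z :* t := con 9 :* z :* t) refl (Z * Z) (2 ^ κ)))
  pow : 2 ^ (d * κ) ≤ fptFactor d k l
  pow = ≤-trans (≤-reflexive (sym (m+n∸n≡m (2 ^ (d * κ)) 1))) (∸-monoˡ-≤ 1
    (≤-trans (+-monoʳ-≤ (2 ^ (d * κ)) (m^n>0 2 (d * κ))) (≤-reflexive (cong (_+_ (2 ^ (d * κ))) (sym (+-identityʳ _))))))

-- From derivations to FPT algorithms

module _ (Π : ParameterizedProblem) where

  open ParameterizedProblem Π

  isFPT : ∀ (e : Tm 1) →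
          (∀ x → ∃ λ v → (IsNode v ⇔ Yes x) × (∃ λ B → B ∣ code x ∷ [] ⊢ e ⇓ v) ×
             (∀ k l → Parameter x k l → budget (size (code x)) (kernel k l) ∣ code x ∷ [] ⊢ e ⇓ v)) →
          toProgram e IsFPTAlgorithmFor Π
  isFPT e h = record
    { f            = fptFactor (degree e)
    ; f-computable = fptFactor-computable (degree e)
    ; poly         = monomial (factor e * 9 ^ degree e) (2 * degree e)
    ; runs         = λ x →
        let v , v⇔ , (B , d) , fast = h x
            c , r , _ = toProgram-runs d
        in v , c , r , v⇔ , λ k l par →
          let c′ , r′ , c′≤ = toProgram-runs (fast k l par)
          -- `c` and `c′` are costs of the same evaluation, so the bound that uses the parameters
          -- passes from `c′` to `c`.
          in ≤-trans (≤-reflexive (proj₂ (⇓-deterministic r r′))) (≤-trans c′≤ (≤-trans (costBound-polynomial _ e)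
               (budget-polynomial (factor e) (degree e) (size (code x)) k l (size≥1 (code x)))))
    }

  Accepts⇔Yes : ∀ {p} → p IsFPTAlgorithmFor Π → ∀ x → Accepts p (code x) ⇔ Yes x
  Accepts⇔Yes fpt x with v , c , r , v⇔ , _ ← _IsFPTAlgorithmFor_.runs fpt x = mk⇔
    (λ (v′ , c′ , r′ , isNode) → Equivalence.to v⇔ (subst IsNode (proj₁ (⇓-deterministic r′ r)) isNode))
    (λ yes → v , c , r , Equivalence.from v⇔ yes)

+-<-2^ : ∀ {a b x y} → x < 2 ^ a → y < 2 ^ b → x + y < 2 ^ suc (a + b)
+-<-2^ {a} {b} x< y< = ≤-trans (+-mono-<-≤ x< (<⇒≤ y<)) (≤-trans
  (+-mono-≤ (^-monoʳ-≤ 2 (m≤m+n a b)) (^-monoʳ-≤ 2 (m≤n+m b a))) (≤-reflexive (cong (_+_ (2 ^ (a + b))) (sym (+-identityʳ _)))))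

*-<-2^ : ∀ {a b x y} → x < 2 ^ a → y < 2 ^ b → x * y < 2 ^ (a + b)
*-<-2^ {a} {b} x< y< = ≤-trans (*-mono-< x< y<) (≤-reflexive (sym (^-distribˡ-+-* 2 a b)))

codeℕᵇ-< : ∀ x → ℕᵇ.toℕ x < 2 ^ size (codeℕᵇ x)
codeℕᵇ-< ℕᵇ.zero  = s≤s z≤n
codeℕᵇ-< 2[1+ x ] = ≤-<-trans (*-monoʳ-≤ 2 (codeℕᵇ-< x)) (^-monoʳ-< 2 (s≤s (s≤s z≤n)) (n<1+n (suc (size (codeℕᵇ x)))))
codeℕᵇ-< 1+[2 x ] = ≤-trans (≤-reflexive (sym (*-suc 2 (ℕᵇ.toℕ x))))
  (≤-trans (*-monoʳ-≤ 2 (codeℕᵇ-< x)) (^-monoʳ-≤ 2 (m≤n+m (suc (size (codeℕᵇ x))) 3)))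

codeℕ-< : ∀ {Z} a → size (codeℕ a) ≤ Z → a < 2 ^ Z
codeℕ-< {Z} a le = ≤-trans (subst (_< 2 ^ size (codeℕ a)) (ℕᵇ.toℕ-fromℕ a) (codeℕᵇ-< (fromℕ a))) (^-monoʳ-≤ 2 le)

size-left : ∀ {Z} l r → size (node l r) ≤ Z → size l ≤ Z
size-left l r = ≤-trans (≤-trans (m≤m+n (size l) _) (n≤1+n _))

size-right : ∀ {Z} l r → size (node l r) ≤ Z → size r ≤ Z
size-right l r = ≤-trans (≤-trans (m≤n+m _ (size l)) (n≤1+n _))

-- The budget in terms of the input size

module Budget (I : Instance) (Z J : ℕ) (I≤Z : size (Instance.codeInstance I) ≤ Z) where

  open Instance I
  open Removal I

  B : ℕ
  B = budget Z J

  private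
    rest₁ rest₂ rest₃ rest₄ edgeCodes : Tree
    rest₄ = codeList (codeℕ W ∷ [])
    rest₃ = node (codeℕ q) rest₄
    rest₂ = node (codeℕ p) rest₃
    rest₁ = node edgeCodes rest₂
    edgeCodes = codeList (List.map codeEdge E)

    rest₁≤Z : size rest₁ ≤ Z
    rest₁≤Z = size-right (codeℕ n) rest₁ I≤Z

    rest₂≤Z : size rest₂ ≤ Z
    rest₂≤Z = size-right edgeCodes rest₂ rest₁≤Z

    E≤Z : size edgeCodes ≤ Z
    E≤Z = size-left edgeCodes rest₂ rest₁≤Z

  n<2^Z : n < 2 ^ Z
  n<2^Z = codeℕ-< n (size-left (codeℕ n) rest₁ I≤Z)

  p<2^Z : p < 2 ^ Z
  p<2^Z = codeℕ-< p (size-left (codeℕ p) rest₃ rest₂≤Z)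

  W<2^Z : W < 2 ^ Z
  W<2^Z = codeℕ-< W (size-left (codeℕ W) leaf (size-right (codeℕ q) rest₄ (size-right (codeℕ p) rest₃ rest₂≤Z)))

  m≤Z : m ≤ Z
  m≤Z = ≤-trans (≤-reflexive (sym (length-tabulate {n = m} id))) (≤-trans (len E) E≤Z)
    where
    len : ∀ es → length es ≤ size (codes codeEdge es)
    len []       = z≤n
    len (e ∷ es) = s≤s (≤-trans (len es) (m≤n+m _ (size (codeEdge e))))

  total<2^Z : totalLength < 2 ^ Z
  total<2^Z = ≤-trans (go E) (^-monoʳ-≤ 2 E≤Z)
    where
    go : ∀ es → sum (List.map ℓ es) < 2 ^ size (codes codeEdge es)
    go []       = s≤s z≤n
    go (e ∷ es) = +-<-2^ {size (codeEdge e)} (codeℕ-< (ℓ e)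
      (size-right (codeℕ (Fin.toℕ (tgt e))) (codeℕ (ℓ e)) (size-right (codeℕ (Fin.toℕ (src e))) (node (codeℕ (Fin.toℕ (tgt e))) (codeℕ (ℓ e))) ≤-refl))) (go es)

  1≤Z : 1 ≤ Z
  1≤Z = ≤-trans (size≥1 codeInstance) I≤Z

  8ZZ≤B : 8 * (Z * Z) ≤ B
  8ZZ≤B = m≤m*n (8 * (Z * Z)) (2 ^ J) {{m^n≢0 2 J}}

  8Z≤B : 8 * Z ≤ B
  8Z≤B = ≤-trans (*-monoʳ-≤ 8 (n≤n*n Z)) 8ZZ≤B

  -- The origin of the 8 in `budget`: the largest number, `(3 + p) * far`, is below
  -- `2 ^ (4 * Z + 4)`, and this exponent is at most `8 * Z` as `1 ≤ Z`.
  fits : ∀ {x} a b → x < 2 ^ (a * Z + b) → a + b ≤ 8 → x < 2 ^ B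
  fits a b x< a+b≤8 = ≤-trans x< (^-monoʳ-≤ 2 (≤-trans (+-monoʳ-≤ (a * Z) (≤-trans (≤-reflexive (sym (*-identityʳ b))) (*-monoʳ-≤ b 1≤Z)))
    (≤-trans (≤-reflexive (sym (*-distribʳ-+ Z a b))) (≤-trans (*-monoˡ-≤ Z a+b≤8) 8Z≤B))))

  <2^Z⇒<2^B : ∀ {x} → x < 2 ^ Z → x < 2 ^ B
  <2^Z⇒<2^B {x} x< = fits 1 0 (subst (λ k → x < 2 ^ k) (solve 1 (λ z → z := con 1 :* z :+ con 0) refl Z) x<) (s≤s z≤n)
    where open +-*-Solver

  n<2^B : n < 2 ^ B
  n<2^B = <2^Z⇒<2^B n<2^Z

  far<2^B : (3 + p) * far < 2 ^ B
  far<2^B = fits 4 4 (subst (λ k → (3 + p) * far < 2 ^ k)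
      (solve 1 (λ z → con 1 :+ (con 2 :+ z) :+ (con 1 :+ (con 0 :+ (z :+ (z :+ z)))) := con 4 :* z :+ con 4) refl Z)
      (*-<-2^ {suc (2 + Z)} (+-<-2^ {2} {Z} (s≤s (s≤s (s≤s (s≤s z≤n)))) p<2^Z)
        (far-< (*-<-2^ {Z} p<2^Z (*-<-2^ {Z} n<2^Z total<2^Z))))) ≤-refl
    where
    open +-*-Solver
    far-< : ∀ {x} → x < 2 ^ (Z + (Z + Z)) → suc x < 2 ^ suc (0 + (Z + (Z + Z)))
    far-< x< = ≤-trans (s≤s x<) (≤-trans (+-monoˡ-≤ (2 ^ (Z + (Z + Z))) (m^n>0 2 (Z + (Z + Z)))) (≤-reflexive (cong (_+_ (2 ^ (Z + (Z + Z)))) (sym (+-identityʳ _)))))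

  m+-<2^B : ∀ {b} → b < 2 ^ Z → m + b < 2 ^ B
  m+-<2^B {b} b< = fits 2 1 (subst (λ k → m + b < 2 ^ k) (solve 1 (λ z → con 1 :+ (z :+ z) := con 2 :* z :+ con 1) refl Z)
    (+-<-2^ {Z} (≤-<-trans m≤Z (n<2^n Z)) b<)) (s≤s (s≤s (s≤s z≤n)))
    where open +-*-Solver

  pairs≤B : (m + m) * (m + m) ≤ B
  pairs≤B = ≤-trans (*-mono-≤ (+-mono-≤ m≤Z m≤Z) (+-mono-≤ m≤Z m≤Z)) (≤-trans (≤-reflexive
    (solve 1 (λ z → (z :+ z) :* (z :+ z) := con 4 :* (z :* z)) refl Z)) (≤-trans (*-monoˡ-≤ (Z * Z) (m≤m+n 4 4)) 8ZZ≤B))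
    where open +-*-Solver

  2^J≤B : ∀ {j} → j ≤ J → 2 ^ j ≤ B
  2^J≤B j≤J = ≤-trans (^-monoʳ-≤ 2 j≤J) (m≤n*m (2 ^ J) (8 * (Z * Z)) {{>-nonZero (≤-trans (*-mono-≤ 1≤Z 1≤Z) (m≤n*m (Z * Z) 8))}})

IsNode-codeBool : ∀ b → IsNode (codeBool b) ⇔ T b
IsNode-codeBool true  = mk⇔ _ _
IsNode-codeBool false = mk⇔ id id

-- The length of the search

module Kernel (I : Instance) where

  open Instance I
  open Removal I
  open Solutions I

  -- A longer list would contain a removable set of `k` edges, and the premise on `a` makes every
  -- such set good.
  none-found⇒≤kernel : ∀ {τ a b} k → Tightness τ → a ≤ k + b → ∀ xs → Suitable xs → any (good a b) (subs xs) ≡ false → length xs ≤ kernel k τ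
  none-found⇒≤kernel {τ} {a} {b} k tight a≤k+b xs (u , xs⊆N) none = ≮⇒≥ λ J<xs →
    -- `kernel` is dimensioned for `suc k` edges; here `k` are enough, and one summand is dropped.
    many⇒feasible tight k xs u xs⊆N (≤-trans (m≤n+m _ (suc (τ + τ))) (<⇒≤ J<xs)) λ (R , R∈ , k≤R , f) →
      subst T none (any⁺ (good a b) (Any.map (λ { refl → Equivalence.from T-∧ (≤⇒≤ᵇ (≤-trans a≤k+b (+-monoˡ-≤ b k≤R)) , f) }) R∈))

  -- More than φ edges cannot be removed.

  ≤kernel-φ : ∀ {τ} → Tightness τ → ∀ xs → Suitable xs → length xs ≤ kernel φ τ
  ≤kernel-φ {τ} tight xs (u , xs⊆N) = ≮⇒≥ λ J<xs → many⇒feasible tight (suc φ) xs u xs⊆N (<⇒≤ J<xs)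
    λ (R , R∈ , φ<R , f) → <⇒≱ φ<R (feasible⇒length-≤-φ (subs-unique u R∈) (xs⊆N ∘ subs-⊆ xs R∈) f)

  removal-derivation : ∀ ϱ J → (∀ xs → Suitable xs → any (good ϱ 0) (subs xs) ≡ false → length xs ≤ J) →
    budget (size (node codeInstance (codeℕ ϱ))) J ∣ node codeInstance (codeℕ ϱ) ∷ [] ⊢ removalT
      ⇓ codeBool (any (good ϱ 0) (subs N))
  removal-derivation ϱ J H = Algorithm.removal-⇓ I B far<2^B n<2^B pairs≤B ϱ
    (<2^Z⇒<2^B (codeℕ-< ϱ (size-right codeInstance (codeℕ ϱ) ≤-refl)))
    (m+-<2^B (m^n>0 2 (size (node codeInstance (codeℕ ϱ)))))
    (λ xs s none → 2^J≤B (H xs s none))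
    where
    open Budget I (size (node codeInstance (codeℕ ϱ))) J (size-left codeInstance (codeℕ ϱ) ≤-refl)

  spanner-derivation : ∀ J → (∀ xs → Suitable xs → length xs ≤ J) →
    budget (size codeInstance) J ∣ codeInstance ∷ [] ⊢ spannerT ⇓ codeBool (any (good (length K) W) (subs N))
  spanner-derivation J H = Algorithm.spanner-⇓ I B far<2^B n<2^B pairs≤B (m+-<2^B W<2^Z) (λ xs s _ → 2^J≤B (H xs s))
    where
    open Budget I (size codeInstance) J ≤-refl

  removal⇔ : ∀ ϱ → IsNode (codeBool (any (good ϱ 0) (subs N))) ⇔ ParameterizedProblem.Yes NontrivialRemoval (I , ϱ)
  removal⇔ ϱ = mk⇔
    (solvable⇒removal ∘ Equivalence.to (solvable⇔ ϱ 0) ∘ Equivalence.to (IsNode-codeBool _))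
    (Equivalence.from (IsNode-codeBool _) ∘ Equivalence.from (solvable⇔ ϱ 0) ∘ removal⇒solvable)

  spanner⇔ : IsNode (codeBool (any (good (length K) W) (subs N))) ⇔ ParameterizedProblem.Yes Spanner I
  spanner⇔ = mk⇔
    (solvable⇒spanner ∘ Equivalence.to (solvable⇔ (length K) W) ∘ Equivalence.to (IsNode-codeBool _))
    (Equivalence.from (IsNode-codeBool _) ∘ Equivalence.from (solvable⇔ (length K) W) ∘ spanner⇒solvable)

-- The two algorithms and the sweep

removal-fpt : toProgram removalT IsFPTAlgorithmFor NontrivialRemoval
removal-fpt = isFPT NontrivialRemoval removalT λ (I , ϱ) →
  _ , Kernel.removal⇔ I ϱ ,
  -- For halting alone, `m` bounds the number of edges in any list searched.
  (_ , Kernel.removal-derivation I ϱ (Instance.m I) (λ xs s _ → Solutions.suitable⇒length-≤ I s)) ,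
  λ { k τ (refl , tight) → Kernel.removal-derivation I ϱ (kernel k τ) (Kernel.none-found⇒≤kernel I k tight (m≤m+n k 0)) }

spanner-fpt : toProgram spannerT IsFPTAlgorithmFor Spanner
spanner-fpt = isFPT Spanner spannerT λ I →
  _ , Kernel.spanner⇔ I ,
  (_ , Kernel.spanner-derivation I (Instance.m I) (λ xs s → Solutions.suitable⇒length-≤ I s)) ,
  λ { k τ (refl , tight) → Kernel.spanner-derivation I (kernel k τ) (Kernel.≤kernel-φ I tight) }

module Sweep (I : Instance) where

  open Instance I
  open Removal I
  open Solutions I

  private
    A : Program
    A = toProgram removalT

    A⇔ : ∀ ϱ → Accepts A (node codeInstance (codeℕ ϱ)) ⇔ Solvable ϱ 0
    A⇔ ϱ = mk⇔ (removal⇒solvable ∘ Equivalence.to (Accepts⇔Yes NontrivialRemoval removal-fpt (I , ϱ)))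
               (Equivalence.from (Accepts⇔Yes NontrivialRemoval removal-fpt (I , ϱ)) ∘ solvable⇒removal)

    K-size : ∀ {S} → S Is Kept → Subset.∣ S ∣ ≡ length K
    K-size {S} S-kept = trans (sym (length-elements S)) (≤-antisym
      (unique-⊆⇒length-≤ (filter⁺ (Subset._∈? S) (allFin⁺ m)) (λ {e} e∈ → Equivalence.to (Kept⇔∈K e) (Equivalence.to (S-kept e) (∈-elements⁻ e∈))))
      (unique-⊆⇒length-≤ K-unique (λ {e} e∈ → ∈-elements⁺ (Equivalence.from (S-kept e) (Equivalence.from (Kept⇔∈K e) e∈)))))

    K-Is-Kept : fromList K Is Kept
    K-Is-Kept e = mk⇔ (Equivalence.from (Kept⇔∈K e) ∘ ∈-fromList⁻) (∈-fromList⁺ ∘ Equivalence.to (Kept⇔∈K e))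

  sweep⇒solvable : SweepAccepts A I → Solvable (length K) W
  sweep⇒solvable (S , S-kept , inj₁ K≤W) =
    -- If `K` is small enough already, the empty removal is a solution.
    [] , []∈subs N , ≤-trans (≤-reflexive (sym (K-size S-kept))) K≤W , tt
  sweep⇒solvable (S , S-kept , inj₂ (ϱ , 1≤ϱ , ϱ≤φ , K∸ϱ≤W , acc)) =
    let R , R∈ , ϱ≤R , f = Equivalence.to (A⇔ ϱ) acc in
    R , R∈ , ≤-trans (≤-reflexive (sym (K-size S-kept))) (≤-trans (≤-trans (m≤n+m∸n Subset.∣ S ∣ ϱ) (+-monoʳ-≤ ϱ K∸ϱ≤W))
      (+-monoˡ-≤ W (≤-trans ϱ≤R (≤-reflexive (+-identityʳ _))))) , f

  solvable⇒sweep : Solvable (length K) W → SweepAccepts A I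
  solvable⇒sweep (R , R∈ , K≤ , f) = fromList K , K-Is-Kept , choose (length K ≤? W)
    where
    ϱ : ℕ
    -- The least number of removals that brings `K` down to `W`; the set `R` shows that it is
    -- attainable, hence also at most `φ`.
    ϱ = length K ∸ W
    ϱ≤R : ϱ ≤ length R
    ϱ≤R = m≤n+o⇒m∸n≤o (length K) W (≤-trans K≤ (≤-reflexive (+-comm (length R) W)))
    choose : Dec (length K ≤ W) → _
    choose (yes K≤W) = inj₁ (≤-trans (≤-reflexive (K-size K-Is-Kept)) K≤W)
    -- The sweep starts at 1, and `W < length K` makes `ϱ` positive; it also turns `length K ∸ ϱ`
    -- into exactly `W`.
    choose (no K≰W)  = inj₂ (ϱ , m<n⇒0<n∸m (≰⇒> K≰W) ,
      ≤-trans ϱ≤R (feasible⇒length-≤-φ (subs-unique N-unique R∈) (subs-⊆ N R∈) f) ,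
      ≤-reflexive (trans (cong (_∸ ϱ) (K-size K-Is-Kept)) (m∸[m∸n]≡n (<⇒≤ (≰⇒> K≰W)))) ,
      Equivalence.from (A⇔ ϱ) (R , R∈ , ≤-trans ϱ≤R (m≤m+n _ 0) , f))

corollary7 : ∃₂ λ (B A : Program) →
    B IsFPTAlgorithmFor Spanner ×
    A IsFPTAlgorithmFor NontrivialRemoval ×
    (∀ (I : Instance) →
    Accepts B (Instance.codeInstance I) ⇔ SweepAccepts A I)
corollary7 = toProgram spannerT , toProgram removalT , spanner-fpt , removal-fpt , λ I → mk⇔
  (Sweep.solvable⇒sweep I ∘ Solutions.spanner⇒solvable I ∘ Equivalence.to (Accepts⇔Yes Spanner spanner-fpt I))
  (Equivalence.from (Accepts⇔Yes Spanner spanner-fpt I) ∘ Solutions.solvable⇒spanner I ∘ Sweep.sweep⇒solvable I)
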